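{- Let $n\ge 3$, and let $S_n$ be the symmetric group on $n$ elements equipped with the Hamming distance $d_H(\pi,\pi')=|\{i:\pi(i)\ne\pi'(i)\}|$. Let $J_n=K_n\,\square\,K_{n-1}\,\square\cdots\square\,K_2$. Then $$\sigma_{S_n}^2>\frac n4>\sigma_{J_n}^2+\frac14.$$
   Context: For a finite metric space $(\Omega,d)$ with the uniform probability distribution, a function $X:\Omega\to\mathbb{R}$ is Lipschitz if $|X(u)-X(v)|\le d(u,v)$ for all $u,v$, and $\sigma_X^2$ is the smallest $\sigma^2$ such that $\mathbb{E}\,e^{t(X-\mathbb{E}X)}\le e^{\sigma^2t^2/2}$ for all real $t$. The subgaussian constant $\sigma_\Omega^2$ is the supremum of $\sigma_X^2$ over all Lipschitz $X$ on $\Omega$. For a graph, $\Omega$ is the vertex set with the graph distance. $K_m$ is the complete graph on $m$ vertices, and $\square$ denotes the Cartesian product of graphs (vertex set the product of the vertex sets, distance the sum of the coordinate distances). -}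

module Defs where

open import Data.Nat.Base as ℕ using (ℕ; zero; suc; _!)
import Data.Nat.Properties as ℕ
open import Data.Nat.Properties using (_!≢0)
open import Data.Integer.Base as ℤ using (∣_∣; +≤+)
import Data.Integer.Properties as ℤ
open import Data.Rational.Base as ℚ
  using (ℚ; 0ℚ; 1ℚ; ½; _+_; _*_; _-_; -_; _≤_; _<_; 1/_; _/_; Positive; nonNegative; positive)
  renaming (∣_∣ to abs)
import Data.Rational.Properties as ℚ
import Data.Rational.Unnormalised.Base as ℚᵘ
import Data.Rational.Unnormalised.Properties as ℚᵘ
open import Data.Rational.Solver using (module +-*-Solver)
open import Data.Product.Base using (∃; _×_; _,_; proj₁; proj₂; swap)
open import Data.Sum.Base as Sum using (_⊎_; inj₁; inj₂)
open import Relation.Binary.PropositionalEquality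
  using (_≡_; _≢_; refl; sym; trans; cong; cong₂; subst; isEquivalence)
open import Relation.Binary.Structures using (IsEquivalence; IsPartialOrder)
open import Data.Bool.Base using (if_then_else_)
open import Data.Fin.Base as Fin using (Fin; suc; combine; quotient; remainder; punchIn)
open import Data.Fin.Patterns using (0F)
open import Data.Fin.Permutation as Perm using (Permutation′; _⟨$⟩ʳ_)
import Data.Fin.Properties as Fin
open import Data.Fin.Properties using (*↔×; combine-remQuot; remQuot-combine; punchIn-injective)
open import Data.List.Base using (length; filter; allFin; []; _∷_)
open import Data.List.Membership.Propositional using (lose)
open import Data.List.Membership.Propositional.Properties using (∈-allFin)
open import Data.List.Properties using (filter-≐; filter-none; filter-some)
import Data.List.Relation.Unary.All as All
open import Data.Product.Function.NonDependent.Propositional using (_×-↔_)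
open import Data.Vec.Functional using (foldr)
open import Function.Bundles using (_↔_; Inverse; Bijection)
open import Function.Construct.Composition using (_↔-∘_)
open import Function.Construct.Identity using (↔-id)
open import Function.Definitions using (Injective; Surjective; Bijective)
open import Function.Metric.Nat.Structures using (IsMetric)
open import Function.Metric.Structures using (IsGeneralMetric)
open import Function.Properties.Inverse using (↔⇒⤖)
open import Level using (0ℓ)
open import Relation.Binary.Core using (Rel)
open import Relation.Binary.Definitions using (Symmetric; Irreflexive)
open import Relation.Nullary using (does; yes; no; ¬?; contradiction)
open import Relation.Nullary.Decidable using (from-no; decidable-stable)
open import Relation.Unary using (Decidable)

fromℕℚ : ℕ → ℚ
fromℕℚ n = ℤ.+ n / 1

toℚᵘ-fromℕℚ : ∀ n → ℚ.toℚᵘ (fromℕℚ n) ℚᵘ.≃ ℚᵘ.mkℚᵘ (ℤ.+ n) 0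
toℚᵘ-fromℕℚ n = ℚ.toℚᵘ-fromℚᵘ (ℚᵘ.mkℚᵘ (ℤ.+ n) 0)

fromℕℚ-+ : ∀ m n → fromℕℚ (m ℕ.+ n) ≡ fromℕℚ m + fromℕℚ n
fromℕℚ-+ m n = ℚ.toℚᵘ-injective (begin
  ℚ.toℚᵘ (fromℕℚ (m ℕ.+ n))                       ≈⟨ toℚᵘ-fromℕℚ (m ℕ.+ n) ⟩
  ℚᵘ.mkℚᵘ (ℤ.+ (m ℕ.+ n)) 0                         ≈⟨ ℚᵘ.*≡* (cong (ℤ._* ℤ.+ 1) (cong₂ ℤ._+_ (sym (ℤ.*-identityʳ (ℤ.+ m))) (sym (ℤ.*-identityʳ (ℤ.+ n))))) ⟩
  ℚᵘ.mkℚᵘ (ℤ.+ m) 0 ℚᵘ.+ ℚᵘ.mkℚᵘ (ℤ.+ n) 0            ≈⟨ ℚᵘ.+-cong (toℚᵘ-fromℕℚ m) (toℚᵘ-fromℕℚ n) ⟨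
  ℚ.toℚᵘ (fromℕℚ m) ℚᵘ.+ ℚ.toℚᵘ (fromℕℚ n)        ≈⟨ ℚ.toℚᵘ-homo-+ (fromℕℚ m) (fromℕℚ n) ⟨
  ℚ.toℚᵘ (fromℕℚ m + fromℕℚ n)                    ∎)
  where open ℚᵘ.≃-Reasoning

fromℕℚ-mono : ∀ {m n} → m ℕ.≤ n → fromℕℚ m ≤ fromℕℚ n
fromℕℚ-mono {m} {n} m≤n = ℚ.toℚᵘ-cancel-≤
  (ℚᵘ.≤-respˡ-≃ (ℚᵘ.≃-sym (toℚᵘ-fromℕℚ m)) (ℚᵘ.≤-respʳ-≃ (ℚᵘ.≃-sym (toℚᵘ-fromℕℚ n))
    (ℚᵘ.*≤* (ℤ.*-monoʳ-≤-nonNeg (ℤ.+ 1) (+≤+ m≤n)))))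

fromℕℚ-nonNeg : ∀ n → 0ℚ ≤ fromℕℚ n
fromℕℚ-nonNeg n = fromℕℚ-mono {0} {n} ℕ.z≤n

archimedean : ∀ q → ∃ λ n → q ≤ fromℕℚ n
archimedean q@(ℚ.mkℚ i d _) = ∣ i ∣ , ℚ.toℚᵘ-cancel-≤
  (ℚᵘ.≤-respʳ-≃ (ℚᵘ.≃-sym (toℚᵘ-fromℕℚ ∣ i ∣))
    (ℚᵘ.*≤* (ℤ.≤-trans (ℤ.≤-reflexive (ℤ.*-identityʳ i)) (ℤ.≤-trans (i≤∣i∣ i) (lem ∣ i ∣ d)))))
  where
  i≤∣i∣ : ∀ i → i ℤ.≤ ℤ.+ ∣ i ∣
  i≤∣i∣ (ℤ.+ n)      = ℤ.≤-refl
  i≤∣i∣ ℤ.-[1+ n ] = ℤ.-≤+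
  lem : ∀ n d → ℤ.+ n ℤ.≤ ℤ.+ n ℤ.* ℤ.+ (suc d)
  lem n d = subst (ℤ.+ n ℤ.≤_) (ℤ.pos-* n (suc d)) (+≤+ (ℕ.m≤m*n n (suc d)))

open ℚ.≤-Reasoning

*-mono : ∀ {p q r s} → 0ℚ ≤ r → 0ℚ ≤ q → p ≤ q → r ≤ s → p * r ≤ q * s
*-mono {p} {q} {r} {s} 0≤r 0≤q p≤q r≤s = ℚ.≤-trans
  (ℚ.*-monoʳ-≤-nonNeg r {{nonNegative 0≤r}} p≤q) (ℚ.*-monoˡ-≤-nonNeg q {{nonNegative 0≤q}} r≤s)

*-nonNeg : ∀ {p q} → 0ℚ ≤ p → 0ℚ ≤ q → 0ℚ ≤ p * q
*-nonNeg {p} {q} 0≤p 0≤q = subst (_≤ p * q) (ℚ.*-zeroˡ q) (ℚ.*-monoʳ-≤-nonNeg q {{nonNegative 0≤q}} 0≤p)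

+-nonNeg : ∀ {p q} → 0ℚ ≤ p → 0ℚ ≤ q → 0ℚ ≤ p + q
+-nonNeg = ℚ.+-mono-≤ {0ℚ} {_} {0ℚ}

p≤p+q : ∀ {p q} → 0ℚ ≤ q → p ≤ p + q
p≤p+q {p} {q} 0≤q = subst (_≤ p + q) (ℚ.+-identityʳ p) (ℚ.+-monoʳ-≤ p 0≤q)

abs-minus : ∀ p q → abs (p - q) ≡ abs (q - p)
abs-minus p q = trans (sym (ℚ.∣-p∣≡∣p∣ (p - q)))
  (cong abs (solve 2 (λ p q → :- (p :- q) := q :- p) refl p q))
  where open +-*-Solver

p≤∣p∣ : ∀ p → p ≤ abs p
p≤∣p∣ p with ℚ.≤-total 0ℚ p
... | inj₁ 0≤p = ℚ.≤-reflexive (sym (ℚ.0≤p⇒∣p∣≡p 0≤p))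
... | inj₂ p≤0 = ℚ.≤-trans p≤0 (ℚ.0≤∣p∣ p)

∣p∣≤ : ∀ {p q} → p ≤ q → - p ≤ q → abs p ≤ q
∣p∣≤ {p} {q} p≤q -p≤q with ℚ.∣p∣≡p∨∣p∣≡-p p
... | inj₁ e = subst (_≤ q) (sym e) p≤q
... | inj₂ e = subst (_≤ q) (sym e) -p≤q

halfPos : ∀ {ε} → 0ℚ < ε → 0ℚ < ½ * ε
halfPos {ε} 0<ε = subst (_< ½ * ε) (ℚ.*-zeroʳ ½) (ℚ.*-monoʳ-<-pos ½ 0<ε)

half+half : ∀ ε → ½ * ε + ½ * ε ≡ ε
half+half ε = trans (sym (ℚ.*-distribʳ-+ ε ½ ½)) (ℚ.*-identityˡ ε)

shrink : ∀ {B ε} → 0ℚ < B → 0ℚ < ε → ∃ λ δ → 0ℚ < δ × B * δ ≡ ε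
shrink {B} {ε} 0<B 0<ε = 1/ B * ε
  , ℚ.positive⁻¹ _ {{ℚ.pos*pos⇒pos (1/ B) {{ℚ.1/pos⇒pos B}} ε {{positive 0<ε}}}}
  , trans (sym (ℚ.*-assoc B (1/ B) ε)) (trans (cong (_* ε) (ℚ.*-inverseʳ B)) (ℚ.*-identityˡ ε))
  where instance
    posB : Positive B
    posB = positive 0<B
    nzB : ℚ.NonZero B
    nzB = ℚ.pos⇒nonZero B

-- Real numbers are Cauchy sequences of rationals, with _≃_ as equality.
IsCauchy : (ℕ → ℚ) → Set
IsCauchy s = ∀ {ε} → 0ℚ < ε → ∃ λ N → ∀ {m n} → N ℕ.≤ m → N ℕ.≤ n → abs (s m - s n) ≤ ε

record ℝ : Set where
  constructor mkℝ
  field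
    seq    : ℕ → ℚ
    cauchy : IsCauchy seq

open ℝ public

infix 4 _≃_ _≤ᴿ_ _<ᴿ_

record _≤ᴿ_ (x y : ℝ) : Set where
  constructor mk≤ᴿ
  field
    within : ∀ {ε} → 0ℚ < ε → ∃ λ N → ∀ {n} → N ℕ.≤ n → seq x n ≤ seq y n + ε

record _<ᴿ_ (x y : ℝ) : Set where
  constructor mk<ᴿ
  field
    {gap} : ℚ
    0<gap : 0ℚ < gap
    apart : ∃ λ N → ∀ {n} → N ℕ.≤ n → seq x n + gap ≤ seq y n

open _≤ᴿ_ public
open _<ᴿ_ public

_≃_ : ℝ → ℝ → Set
x ≃ y = x ≤ᴿ y × y ≤ᴿ x

pointwise⇒≤ᴿ : ∀ {x y} → (∀ n → seq x n ≤ seq y n) → x ≤ᴿ y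
pointwise⇒≤ᴿ h = mk≤ᴿ λ 0<ε → 0 , λ {n} _ → ℚ.≤-trans (h n) (p≤p+q (ℚ.<⇒≤ 0<ε))

≤ᴿ-refl : ∀ {x} → x ≤ᴿ x
≤ᴿ-refl = pointwise⇒≤ᴿ (λ _ → ℚ.≤-refl)

≤ᴿ-trans : ∀ {x y z} → x ≤ᴿ y → y ≤ᴿ z → x ≤ᴿ z
≤ᴿ-trans {x} {y} {z} x≤y y≤z = mk≤ᴿ λ {ε} 0<ε →
  let M , p = within x≤y (halfPos 0<ε)
      N , q = within y≤z (halfPos 0<ε)
  in M ℕ.⊔ N , λ {n} le → begin
    seq x n                     ≤⟨ p (ℕ.m⊔n≤o⇒m≤o M N le) ⟩
    seq y n + ½ * ε             ≤⟨ ℚ.+-monoˡ-≤ (½ * ε) (q (ℕ.m⊔n≤o⇒n≤o M N le)) ⟩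
    seq z n + ½ * ε + ½ * ε     ≡⟨ ℚ.+-assoc (seq z n) (½ * ε) (½ * ε) ⟩
    seq z n + (½ * ε + ½ * ε)   ≡⟨ cong (seq z n +_) (half+half ε) ⟩
    seq z n + ε                 ∎

≃-isEquivalence : IsEquivalence _≃_
≃-isEquivalence = record
  { refl  = ≤ᴿ-refl , ≤ᴿ-refl
  ; sym   = swap
  ; trans = λ (a , b) (c , d) → ≤ᴿ-trans a c , ≤ᴿ-trans d b
  }

≤ᴿ-isPartialOrder : IsPartialOrder _≃_ _≤ᴿ_
≤ᴿ-isPartialOrder = record
  { isPreorder = record
    { isEquivalence = ≃-isEquivalence
    ; reflexive     = proj₁
    ; trans         = ≤ᴿ-trans
    }
  ; antisym = _,_
  }

abstract
  const-cauchy : ∀ q → IsCauchy (λ _ → q)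
  const-cauchy q 0<ε = 0 , λ _ _ → subst (_≤ _) (sym (cong abs (ℚ.+-inverseʳ q))) (ℚ.<⇒≤ 0<ε)

fromℚ : ℚ → ℝ
fromℚ q = mkℝ (λ _ → q) (const-cauchy q)

fromℕ : ℕ → ℝ
fromℕ n = fromℚ (fromℕℚ n)

0ᴿ : ℝ
0ᴿ = fromℕ 0

infixl 6 _+ᴿ_ _-ᴿ_
infixl 7 _*ᴿ_

abstract
  +-cauchy : ∀ x y → IsCauchy (λ n → seq x n + seq y n)
  +-cauchy x y {ε} 0<ε with cauchy x (halfPos 0<ε) | cauchy y (halfPos 0<ε)
  ... | M , p | N , q = M ℕ.⊔ N , λ {m} {n} hm hn → begin
    abs (seq x m + seq y m - (seq x n + seq y n))
      ≡⟨ cong abs (solve 4 (λ a b c d → a :+ b :- (c :+ d) := (a :- c) :+ (b :- d)) refl (seq x m) (seq y m) (seq x n) (seq y n)) ⟩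
    abs ((seq x m - seq x n) + (seq y m - seq y n))
      ≤⟨ ℚ.∣p+q∣≤∣p∣+∣q∣ (seq x m - seq x n) (seq y m - seq y n) ⟩
    abs (seq x m - seq x n) + abs (seq y m - seq y n)
      ≤⟨ ℚ.+-mono-≤ (p (ℕ.m⊔n≤o⇒m≤o M N hm) (ℕ.m⊔n≤o⇒m≤o M N hn)) (q (ℕ.m⊔n≤o⇒n≤o M N hm) (ℕ.m⊔n≤o⇒n≤o M N hn)) ⟩
    ½ * ε + ½ * ε
      ≡⟨ half+half ε ⟩
    ε ∎
    where open +-*-Solver

_+ᴿ_ : ℝ → ℝ → ℝ
x +ᴿ y = mkℝ (λ n → seq x n + seq y n) (+-cauchy x y)

abstract
  neg-cauchy : ∀ x → IsCauchy (λ n → - seq x n)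
  neg-cauchy x 0<ε = let N , p = cauchy x 0<ε in
    N , λ {m} {n} hm hn → subst (_≤ _) (lem (seq x m) (seq x n)) (p hm hn)
    where
    open +-*-Solver
    lem : ∀ a b → abs (a - b) ≡ abs (- a - - b)
    lem a b = trans (abs-minus a b) (cong abs (solve 2 (λ a b → b :- a := (:- a) :- (:- b)) refl a b))

-ᴿ_ : ℝ → ℝ
-ᴿ x = mkℝ (λ n → - seq x n) (neg-cauchy x)

_-ᴿ_ : ℝ → ℝ → ℝ
x -ᴿ y = x +ᴿ (-ᴿ y)

abstract
  abs-cauchy : ∀ x → IsCauchy (λ n → abs (seq x n))
  abs-cauchy x 0<ε = let N , p = cauchy x 0<ε in
    N , λ {m} {n} hm hn → ℚ.≤-trans (lem (seq x m) (seq x n)) (p hm hn)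
    where
    open +-*-Solver
    half-lem : ∀ a b → abs a - abs b ≤ abs (a - b)
    half-lem a b = begin
      abs a - abs b                   ≡⟨ cong (λ z → abs z - abs b) (solve 2 (λ a b → a := (a :- b) :+ b) refl a b) ⟩
      abs ((a - b) + b) - abs b       ≤⟨ ℚ.+-monoˡ-≤ (- abs b) (ℚ.∣p+q∣≤∣p∣+∣q∣ (a - b) b) ⟩
      abs (a - b) + abs b - abs b     ≡⟨ solve 2 (λ c d → c :+ d :- d := c) refl (abs (a - b)) (abs b) ⟩
      abs (a - b)                     ∎
    lem : ∀ a b → abs (abs a - abs b) ≤ abs (a - b)
    lem a b = ∣p∣≤ (half-lem a b) (begin
      - (abs a - abs b)   ≡⟨ solve 2 (λ c d → :- (c :- d) := d :- c) refl (abs a) (abs b) ⟩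
      abs b - abs a       ≤⟨ half-lem b a ⟩
      abs (b - a)         ≡⟨ abs-minus b a ⟩
      abs (a - b)         ∎)

∣_∣ᴿ : ℝ → ℝ
∣ x ∣ᴿ = mkℝ (λ n → abs (seq x n)) (abs-cauchy x)

bounded : ∀ x → ∃ λ B → 0ℚ < B × ∀ n → abs (seq x n) ≤ B
bounded x with cauchy x (ℚ.positive⁻¹ 1ℚ)
... | N , p = total N + 1ℚ , ℚ.<-≤-trans (ℚ.positive⁻¹ 1ℚ) (subst (_≤ total N + 1ℚ) (ℚ.+-identityˡ 1ℚ) (ℚ.+-monoˡ-≤ 1ℚ (total≥0 N))) , bound
  where
  total : ℕ → ℚ
  total zero    = abs (seq x 0)
  total (suc n) = total n + abs (seq x (suc n))

  total≥0 : ∀ n → 0ℚ ≤ total n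
  total≥0 zero    = ℚ.0≤∣p∣ (seq x 0)
  total≥0 (suc n) = +-nonNeg (total≥0 n) (ℚ.0≤∣p∣ (seq x (suc n)))

  total-last : ∀ n → abs (seq x n) ≤ total n
  total-last zero    = ℚ.≤-refl
  total-last (suc n) = subst (_≤ total (suc n)) (ℚ.+-identityˡ _) (ℚ.+-monoˡ-≤ (abs (seq x (suc n))) (total≥0 n))

  total-mono : ∀ {m n} → m ℕ.≤′ n → total m ≤ total n
  total-mono ℕ.≤′-refl         = ℚ.≤-refl
  total-mono (ℕ.≤′-step m≤n) = ℚ.≤-trans (total-mono m≤n) (p≤p+q (ℚ.0≤∣p∣ _))

  bound : ∀ n → abs (seq x n) ≤ total N + 1ℚ
  bound n with ℕ.≤-total n N
  ... | inj₁ n≤N = ℚ.≤-trans (total-last n) (ℚ.≤-trans (total-mono (ℕ.≤⇒≤′ n≤N)) (p≤p+q (ℚ.<⇒≤ (ℚ.positive⁻¹ 1ℚ))))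
  ... | inj₂ N≤n = begin
    abs (seq x n)                               ≡⟨ cong abs (solve 2 (λ a b → a := b :+ (a :- b)) refl (seq x n) (seq x N)) ⟩
    abs (seq x N + (seq x n - seq x N))         ≤⟨ ℚ.∣p+q∣≤∣p∣+∣q∣ (seq x N) (seq x n - seq x N) ⟩
    abs (seq x N) + abs (seq x n - seq x N)     ≤⟨ ℚ.+-mono-≤ (total-last N) (p N≤n ℕ.≤-refl) ⟩
    total N + 1ℚ                                ∎
    where open +-*-Solver

abstract
  *-cauchy : ∀ x y → IsCauchy (λ n → seq x n * seq y n)
  *-cauchy x y {ε} 0<ε =
    let A , 0<A , bx = bounded x
        B , 0<B , by = bounded y
        δ , 0<δ , eδ = shrink 0<A (halfPos 0<ε)
        γ , 0<γ , eγ = shrink 0<B (halfPos 0<ε)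
        M , p        = cauchy y 0<δ
        N , q        = cauchy x 0<γ
    in M ℕ.⊔ N , λ {m} {n} hm hn → begin
    abs (seq x m * seq y m - seq x n * seq y n)
      ≡⟨ cong abs (solve 4 (λ a b c d → a :* b :- c :* d := a :* (b :- d) :+ d :* (a :- c)) refl (seq x m) (seq y m) (seq x n) (seq y n)) ⟩
    abs (seq x m * (seq y m - seq y n) + seq y n * (seq x m - seq x n))
      ≤⟨ ℚ.∣p+q∣≤∣p∣+∣q∣ (seq x m * (seq y m - seq y n)) (seq y n * (seq x m - seq x n)) ⟩
    abs (seq x m * (seq y m - seq y n)) + abs (seq y n * (seq x m - seq x n))
      ≡⟨ cong₂ _+_ (ℚ.∣p*q∣≡∣p∣*∣q∣ (seq x m) (seq y m - seq y n)) (ℚ.∣p*q∣≡∣p∣*∣q∣ (seq y n) (seq x m - seq x n)) ⟩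
    abs (seq x m) * abs (seq y m - seq y n) + abs (seq y n) * abs (seq x m - seq x n)
      ≤⟨ ℚ.+-mono-≤ (*-mono (ℚ.0≤∣p∣ _) (ℚ.<⇒≤ 0<A) (bx m) (p (ℕ.m⊔n≤o⇒m≤o M N hm) (ℕ.m⊔n≤o⇒m≤o M N hn)))
                    (*-mono (ℚ.0≤∣p∣ _) (ℚ.<⇒≤ 0<B) (by n) (q (ℕ.m⊔n≤o⇒n≤o M N hm) (ℕ.m⊔n≤o⇒n≤o M N hn))) ⟩
    A * δ + B * γ
      ≡⟨ cong₂ _+_ eδ eγ ⟩
    ½ * ε + ½ * ε
      ≡⟨ half+half ε ⟩
    ε ∎
    where open +-*-Solver

_*ᴿ_ : ℝ → ℝ → ℝ
x *ᴿ y = mkℝ (λ n → seq x n * seq y n) (*-cauchy x y)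

-- expTerm q k = q ^ k / k !
expTerm : ℚ → ℕ → ℚ
expTerm q zero    = 1ℚ
expTerm q (suc k) = expTerm q k * (q * (ℤ.+ 1 / suc k))

-- expSum q n = Σ_{k < n} q ^ k / k !
expSum : ℚ → ℕ → ℚ
expSum q zero    = 0ℚ
expSum q (suc n) = expSum q n + expTerm q n

recip-fromℕ : ∀ k → (ℤ.+ 1 / suc k) * fromℕℚ (suc k) ≡ 1ℚ
recip-fromℕ k = ℚ.toℚᵘ-injective (R.begin
  ℚ.toℚᵘ ((ℤ.+ 1 / suc k) * fromℕℚ (suc k))               R.≈⟨ ℚ.toℚᵘ-homo-* (ℤ.+ 1 / suc k) (fromℕℚ (suc k)) ⟩
  ℚ.toℚᵘ (ℤ.+ 1 / suc k) ℚᵘ.* ℚ.toℚᵘ (fromℕℚ (suc k))     R.≈⟨ ℚᵘ.*-cong (ℚ.toℚᵘ-fromℚᵘ (ℚᵘ.mkℚᵘ (ℤ.+ 1) k)) (toℚᵘ-fromℕℚ (suc k)) ⟩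
  ℚᵘ.mkℚᵘ (ℤ.+ 1) k ℚᵘ.* ℚᵘ.mkℚᵘ (ℤ.+ (suc k)) 0              R.≈⟨ ℚᵘ.*≡* (trans (ℤ.*-identityʳ (ℤ.+ 1 ℤ.* ℤ.+ (suc k))) (cong (λ j → ℤ.+ 1 ℤ.* ℤ.+ (suc j)) (sym (ℕ.*-identityʳ k)))) ⟩
  ℚᵘ.1ℚᵘ                                                R.∎)
  where module R = ℚᵘ.≃-Reasoning

recip≥0 : ∀ k → 0ℚ ≤ ℤ.+ 1 / suc k
recip≥0 k = ℚ.nonNegative⁻¹ _ {{ℚ.normalize-nonNeg 1 (suc k)}}

expTerm≥0 : ∀ {B} → 0ℚ ≤ B → ∀ k → 0ℚ ≤ expTerm B k
expTerm≥0 0≤B zero    = ℚ.<⇒≤ (ℚ.positive⁻¹ 1ℚ)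
expTerm≥0 0≤B (suc k) = *-nonNeg (expTerm≥0 0≤B k) (*-nonNeg 0≤B (recip≥0 k))

expTerm-step : ∀ B k → expTerm B (suc k) * fromℕℚ (suc k) ≡ B * expTerm B k
expTerm-step B k = begin-equality
  t * (B * c) * s   ≡⟨ solve 4 (λ t B c s → t :* (B :* c) :* s := B :* t :* (c :* s)) refl t B c s ⟩
  B * t * (c * s)   ≡⟨ cong (B * t *_) (recip-fromℕ k) ⟩
  B * t * 1ℚ        ≡⟨ ℚ.*-identityʳ (B * t) ⟩
  B * t             ∎
  where
  open +-*-Solver
  t = expTerm B k
  c = ℤ.+ 1 / suc k
  s = fromℕℚ (suc k)

expTerm-bound : ∀ {q B} → 0ℚ ≤ B → abs q ≤ B → ∀ k → abs (expTerm q k) ≤ expTerm B k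
expTerm-bound 0≤B q≤B zero = ℚ.≤-refl
expTerm-bound {q} {B} 0≤B q≤B (suc k) = begin
  abs (expTerm q k * (q * c))          ≡⟨ ℚ.∣p*q∣≡∣p∣*∣q∣ (expTerm q k) (q * c) ⟩
  abs (expTerm q k) * abs (q * c)      ≡⟨ cong (abs (expTerm q k) *_) (trans (ℚ.∣p*q∣≡∣p∣*∣q∣ q c) (cong (abs q *_) (ℚ.0≤p⇒∣p∣≡p (recip≥0 k)))) ⟩
  abs (expTerm q k) * (abs q * c)      ≤⟨ *-mono (*-nonNeg (ℚ.0≤∣p∣ q) (recip≥0 k)) (expTerm≥0 0≤B k) (expTerm-bound 0≤B q≤B k)
                                           (ℚ.*-monoʳ-≤-nonNeg c {{nonNegative (recip≥0 k)}} q≤B) ⟩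
  expTerm B k * (B * c)                ∎
  where c = ℤ.+ 1 / suc k

expTerm-diff′ : ∀ {q r B} → 0ℚ ≤ B → abs q ≤ B → abs r ≤ B → ∀ k →
                B * abs (expTerm q k - expTerm r k) ≤ abs (q - r) * (fromℕℚ k * expTerm B k)
expTerm-diff′ {q} {r} {B} 0≤B q≤B r≤B zero = ℚ.≤-reflexive (trans (ℚ.*-zeroʳ B) (sym (trans (cong (abs (q - r) *_) (ℚ.*-zeroˡ 1ℚ)) (ℚ.*-zeroʳ (abs (q - r))))))
expTerm-diff′ {q} {r} {B} 0≤B q≤B r≤B (suc k) = begin
  B * abs (tq * (q * c) - tr * (r * c))
    ≡⟨ cong (λ z → B * abs z) (solve 5 (λ tq tr q r c → tq :* (q :* c) :- tr :* (r :* c) := (q :* (tq :- tr) :+ (q :- r) :* tr) :* c) refl tq tr q r c) ⟩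
  B * abs ((q * (tq - tr) + (q - r) * tr) * c)
    ≡⟨ cong (B *_) (trans (ℚ.∣p*q∣≡∣p∣*∣q∣ (q * (tq - tr) + (q - r) * tr) c) (cong (abs (q * (tq - tr) + (q - r) * tr) *_) (ℚ.0≤p⇒∣p∣≡p (recip≥0 k)))) ⟩
  B * (abs (q * (tq - tr) + (q - r) * tr) * c)
    ≤⟨ ℚ.*-monoˡ-≤-nonNeg B {{nonNegative 0≤B}} (ℚ.*-monoʳ-≤-nonNeg c {{nonNegative (recip≥0 k)}} (begin
         abs (q * (tq - tr) + (q - r) * tr)              ≤⟨ ℚ.∣p+q∣≤∣p∣+∣q∣ (q * (tq - tr)) ((q - r) * tr) ⟩
         abs (q * (tq - tr)) + abs ((q - r) * tr)        ≡⟨ cong₂ _+_ (ℚ.∣p*q∣≡∣p∣*∣q∣ q (tq - tr)) (ℚ.∣p*q∣≡∣p∣*∣q∣ (q - r) tr) ⟩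
         abs q * abs (tq - tr) + abs (q - r) * abs tr    ≤⟨ ℚ.+-mono-≤ (ℚ.*-monoʳ-≤-nonNeg (abs (tq - tr)) {{nonNegative (ℚ.0≤∣p∣ (tq - tr))}} q≤B)
                                                                       (ℚ.*-monoˡ-≤-nonNeg d {{nonNegative (ℚ.0≤∣p∣ (q - r))}} (expTerm-bound 0≤B r≤B k)) ⟩
         B * abs (tq - tr) + d * t                       ≤⟨ ℚ.+-monoˡ-≤ (d * t) (expTerm-diff′ {q} {r} 0≤B q≤B r≤B k) ⟩
         d * (fromℕℚ k * t) + d * t                      ∎)) ⟩
  B * ((d * (fromℕℚ k * t) + d * t) * c)
    ≡⟨ solve 5 (λ B d k t c → B :* ((d :* (k :* t) :+ d :* t) :* c) := d :* ((con 1ℚ :+ k) :* (t :* (B :* c)))) refl B d (fromℕℚ k) t c ⟩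
  d * ((1ℚ + fromℕℚ k) * (t * (B * c)))
    ≡⟨ cong (λ z → d * (z * (t * (B * c)))) (sym (fromℕℚ-+ 1 k)) ⟩
  d * (fromℕℚ (suc k) * (t * (B * c))) ∎
  where
  open +-*-Solver
  c  = ℤ.+ 1 / suc k
  tq = expTerm q k
  tr = expTerm r k
  t  = expTerm B k
  d  = abs (q - r)

expTerm-diff : ∀ {q r B} → 0ℚ < B → abs q ≤ B → abs r ≤ B → ∀ k →
               abs (expTerm q (suc k) - expTerm r (suc k)) ≤ abs (q - r) * expTerm B k
expTerm-diff {q} {r} {B} 0<B q≤B r≤B k = ℚ.*-cancelˡ-≤-pos B {{positive 0<B}} (begin
  B * abs (expTerm q (suc k) - expTerm r (suc k))    ≤⟨ expTerm-diff′ {q} {r} (ℚ.<⇒≤ 0<B) q≤B r≤B (suc k) ⟩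
  d * (fromℕℚ (suc k) * expTerm B (suc k))           ≡⟨ cong (d *_) (trans (ℚ.*-comm (fromℕℚ (suc k)) (expTerm B (suc k))) (expTerm-step B k)) ⟩
  d * (B * expTerm B k)                              ≡⟨ solve 3 (λ d B t → d :* (B :* t) := B :* (d :* t)) refl d B (expTerm B k) ⟩
  B * (d * expTerm B k)                              ∎)
  where
  open +-*-Solver
  d = abs (q - r)

expSum-diff : ∀ {q r B} → 0ℚ < B → abs q ≤ B → abs r ≤ B → ∀ n →
              abs (expSum q (suc n) - expSum r (suc n)) ≤ abs (q - r) * expSum B n
expSum-diff {q} {r} 0<B q≤B r≤B zero = ℚ.≤-reflexive (sym (ℚ.*-zeroʳ (abs (q - r))))
expSum-diff {q} {r} {B} 0<B q≤B r≤B (suc n) = begin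
  abs (a + b - (c + e))              ≡⟨ cong abs (solve 4 (λ a b c e → a :+ b :- (c :+ e) := (a :- c) :+ (b :- e)) refl a b c e) ⟩
  abs ((a - c) + (b - e))            ≤⟨ ℚ.∣p+q∣≤∣p∣+∣q∣ (a - c) (b - e) ⟩
  abs (a - c) + abs (b - e)          ≤⟨ ℚ.+-mono-≤ (expSum-diff {q} {r} 0<B q≤B r≤B n) (expTerm-diff {q} {r} 0<B q≤B r≤B n) ⟩
  d * expSum B n + d * expTerm B n   ≡⟨ sym (ℚ.*-distribˡ-+ d (expSum B n) (expTerm B n)) ⟩
  d * (expSum B n + expTerm B n)     ∎
  where
  open +-*-Solver
  d = abs (q - r)
  a = expSum q (suc n)
  b = expTerm q (suc n)
  c = expSum r (suc n)
  e = expTerm r (suc n)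

-- Past K ≥ 2 B the terms at least halve, so expSum B n + 2 expTerm B n decreases.
module ExpTail {B : ℚ} (0<B : 0ℚ < B) where
  0≤B : 0ℚ ≤ B
  0≤B = ℚ.<⇒≤ 0<B

  K : ℕ
  K = proj₁ (archimedean (B + B))

  2B≤K : B + B ≤ fromℕℚ K
  2B≤K = proj₂ (archimedean (B + B))

  t s u : ℕ → ℚ
  t = expTerm B
  s = expSum B
  u n = s n + (t n + t n)

  halving : ∀ {n} → K ℕ.≤ n → t (suc n) + t (suc n) ≤ t n
  halving {n} K≤n = ℚ.*-cancelʳ-≤-pos (fromℕℚ (suc n)) {{σ>0}} (begin
    (t (suc n) + t (suc n)) * σ           ≡⟨ ℚ.*-distribʳ-+ σ (t (suc n)) (t (suc n)) ⟩
    t (suc n) * σ + t (suc n) * σ         ≡⟨ cong (λ z → z + z) (expTerm-step B n) ⟩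
    B * t n + B * t n                     ≡⟨ sym (ℚ.*-distribʳ-+ (t n) B B) ⟩
    (B + B) * t n                         ≤⟨ ℚ.*-monoʳ-≤-nonNeg (t n) {{nonNegative (expTerm≥0 0≤B n)}} (ℚ.≤-trans 2B≤K (fromℕℚ-mono (ℕ.m≤n⇒m≤1+n K≤n))) ⟩
    σ * t n                               ≡⟨ ℚ.*-comm σ (t n) ⟩
    t n * σ                               ∎)
    where
    σ = fromℕℚ (suc n)
    σ>0 : Positive σ
    σ>0 = positive (ℚ.<-≤-trans (ℚ.positive⁻¹ 1ℚ) (fromℕℚ-mono {1} {suc n} (ℕ.s≤s ℕ.z≤n)))

  u-step : ∀ {n} → K ℕ.≤ n → u (suc n) ≤ u n
  u-step {n} K≤n = begin
    s n + t n + (t (suc n) + t (suc n))   ≤⟨ ℚ.+-monoʳ-≤ (s n + t n) (halving K≤n) ⟩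
    s n + t n + t n                       ≡⟨ ℚ.+-assoc (s n) (t n) (t n) ⟩
    s n + (t n + t n)                     ∎

  u-mono : ∀ {m n} → K ℕ.≤ m → m ℕ.≤′ n → u n ≤ u m
  u-mono K≤m ℕ.≤′-refl       = ℚ.≤-refl
  u-mono K≤m (ℕ.≤′-step m≤n) = ℚ.≤-trans (u-step (ℕ.≤-trans K≤m (ℕ.≤′⇒≤ m≤n))) (u-mono K≤m m≤n)

  s-mono : ∀ {m n} → m ℕ.≤′ n → s m ≤ s n
  s-mono ℕ.≤′-refl       = ℚ.≤-refl
  s-mono (ℕ.≤′-step {n} m≤n) = ℚ.≤-trans (s-mono m≤n) (p≤p+q (expTerm≥0 0≤B n))

  s≤u : ∀ n → s n ≤ u n
  s≤u n = p≤p+q (+-nonNeg (expTerm≥0 0≤B n) (expTerm≥0 0≤B n))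

  s-bound : ∀ n → s n ≤ u K
  s-bound n with ℕ.≤-total n K
  ... | inj₁ n≤K = ℚ.≤-trans (s-mono (ℕ.≤⇒≤′ n≤K)) (s≤u K)
  ... | inj₂ K≤n = ℚ.≤-trans (s≤u n) (u-mono ℕ.≤-refl (ℕ.≤⇒≤′ K≤n))

  s≥0 : ∀ n → 0ℚ ≤ s n
  s≥0 n = s-mono {0} {n} (ℕ.≤⇒≤′ ℕ.z≤n)

  t-bound : ∀ n → t n ≤ u K
  t-bound n = ℚ.≤-trans (subst (_≤ s n + t n) (ℚ.+-identityˡ (t n)) (ℚ.+-monoˡ-≤ (t n) (s≥0 n))) (s-bound (suc n))

  0<u : 0ℚ < u K
  0<u = ℚ.<-≤-trans (ℚ.positive⁻¹ 1ℚ) (t-bound 0)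

  t→0 : ∀ {ε} → 0ℚ < ε → ∃ λ N → ∀ {n} → N ℕ.≤ n → t n ≤ ε
  t→0 {ε} 0<ε with shrink 0<ε (ℚ.positive⁻¹ 1ℚ)
  ... | ε⁻¹ , 0<ε⁻¹ , eq with archimedean (ε⁻¹ * (B * u K))
  ... | N , le = suc N , small
    where
    small : ∀ {n} → suc N ℕ.≤ n → t n ≤ ε
    small {suc n} (ℕ.s≤s N≤n) = ℚ.*-cancelʳ-≤-pos (fromℕℚ (suc n))
      {{positive (ℚ.<-≤-trans (ℚ.positive⁻¹ 1ℚ) (fromℕℚ-mono {1} {suc n} (ℕ.s≤s ℕ.z≤n)))}} (begin
        t (suc n) * fromℕℚ (suc n)   ≡⟨ expTerm-step B n ⟩
        B * t n                      ≤⟨ ℚ.*-monoˡ-≤-nonNeg B {{nonNegative 0≤B}} (t-bound n) ⟩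
        B * u K                      ≡⟨ sym (ℚ.*-identityˡ (B * u K)) ⟩
        1ℚ * (B * u K)               ≡⟨ cong (_* (B * u K)) (sym eq) ⟩
        ε * ε⁻¹ * (B * u K)          ≡⟨ ℚ.*-assoc ε ε⁻¹ (B * u K) ⟩
        ε * (ε⁻¹ * (B * u K))        ≤⟨ ℚ.*-monoˡ-≤-nonNeg ε {{nonNegative (ℚ.<⇒≤ 0<ε)}} (ℚ.≤-trans le (fromℕℚ-mono (ℕ.m≤n⇒m≤1+n N≤n))) ⟩
        ε * fromℕℚ (suc n)           ∎)

  tail : ∀ {q} → abs q ≤ B → ∀ {m n} → m ℕ.≤′ n → abs (expSum q n - expSum q m) ≤ s n - s m
  tail {q} q≤B {m} ℕ.≤′-refl = ℚ.≤-reflexive (trans (cong abs (ℚ.+-inverseʳ (expSum q m))) (sym (ℚ.+-inverseʳ (s m))))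
  tail {q} q≤B {m} (ℕ.≤′-step {n} m≤n) = begin
    abs (expSum q n + expTerm q n - expSum q m)       ≡⟨ cong abs (solve 3 (λ a b c → a :+ b :- c := (a :- c) :+ b) refl (expSum q n) (expTerm q n) (expSum q m)) ⟩
    abs ((expSum q n - expSum q m) + expTerm q n)     ≤⟨ ℚ.∣p+q∣≤∣p∣+∣q∣ (expSum q n - expSum q m) (expTerm q n) ⟩
    abs (expSum q n - expSum q m) + abs (expTerm q n) ≤⟨ ℚ.+-mono-≤ (tail q≤B m≤n) (expTerm-bound 0≤B q≤B n) ⟩
    (s n - s m) + t n                                 ≡⟨ solve 3 (λ a b c → (a :- c) :+ b := a :+ b :- c) refl (s n) (t n) (s m) ⟩
    s n + t n - s m                                   ∎
    where open +-*-Solver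

  s-tail : ∀ {m n} → K ℕ.≤ m → m ℕ.≤′ n → s n - s m ≤ t m + t m
  s-tail {m} {n} K≤m m≤n = begin
    s n - s m                 ≤⟨ ℚ.+-monoˡ-≤ (- s m) (ℚ.≤-trans (s≤u n) (u-mono K≤m m≤n)) ⟩
    s m + (t m + t m) - s m   ≡⟨ solve 2 (λ a b → a :+ b :- a := b) refl (s m) (t m + t m) ⟩
    t m + t m                 ∎
    where open +-*-Solver

abstract
  exp-cauchy : ∀ x → IsCauchy (λ n → expSum (seq x n) n)
  exp-cauchy x {ε} 0<ε =
    let B , 0<B , bx   = bounded x
        δ , 0<δ , eδ   = shrink (ExpTail.0<u 0<B) (halfPos 0<ε)
        N , small      = ExpTail.t→0 0<B (halfPos (halfPos 0<ε))
        M , close      = cauchy x 0<δ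
    in from-moduli B 0<B bx δ 0<δ eδ N small M close
    where
    from-moduli : ∀ B (0<B : 0ℚ < B) → (∀ n → abs (seq x n) ≤ B) →
                  ∀ δ → 0ℚ < δ → ExpTail.u 0<B (ExpTail.K 0<B) * δ ≡ ½ * ε →
                  ∀ N → (∀ {n} → N ℕ.≤ n → expTerm B n ≤ ½ * (½ * ε)) →
                  ∀ M → (∀ {m n} → M ℕ.≤ m → M ℕ.≤ n → abs (seq x m - seq x n) ≤ δ) →
                  ∃ λ N₀ → ∀ {m n} → N₀ ℕ.≤ m → N₀ ℕ.≤ n →
                  abs (expSum (seq x m) m - expSum (seq x n) n) ≤ ε
    from-moduli B 0<B bx δ 0<δ eδ N small M close = N₀ , main
      where
      open ExpTail 0<B
      open +-*-Solver using (solve; _:+_; _:-_; _:=_)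
      N₀ : ℕ
      N₀ = suc (K ℕ.⊔ N ℕ.⊔ M)

      N₀≥K : K ℕ.≤ N₀
      N₀≥K = ℕ.m≤n⇒m≤1+n (ℕ.≤-trans (ℕ.m≤m⊔n K N) (ℕ.m≤m⊔n _ M))
      N₀≥N : N ℕ.≤ N₀
      N₀≥N = ℕ.m≤n⇒m≤1+n (ℕ.≤-trans (ℕ.m≤n⊔m K N) (ℕ.m≤m⊔n _ M))
      N₀≥M : M ℕ.≤ N₀
      N₀≥M = ℕ.m≤n⇒m≤1+n (ℕ.m≤n⊔m _ M)

      E : ℕ → ℕ → ℚ
      E i n = expSum (seq x i) n

      ordered : ∀ {m n} → N₀ ℕ.≤ m → m ℕ.≤ n → abs (E m m - E n n) ≤ ε
      ordered {suc m} {n} hm m≤n = begin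
        abs (E i i - E n n)                         ≡⟨ cong abs (solve 3 (λ a b c → a :- c := (a :- b) :+ (b :- c)) refl (E i i) (E n i) (E n n)) ⟩
        abs ((E i i - E n i) + (E n i - E n n))     ≤⟨ ℚ.∣p+q∣≤∣p∣+∣q∣ (E i i - E n i) (E n i - E n n) ⟩
        abs (E i i - E n i) + abs (E n i - E n n)   ≤⟨ ℚ.+-mono-≤ first second ⟩
        ½ * ε + ½ * ε                               ≡⟨ half+half ε ⟩
        ε                                           ∎
        where
        i : ℕ
        i = suc m
        first : abs (E i i - E n i) ≤ ½ * ε
        first = begin
          abs (E i i - E n i)                    ≤⟨ expSum-diff 0<B (bx i) (bx n) m ⟩
          abs (seq x i - seq x n) * s m          ≤⟨ *-mono (s≥0 m) (ℚ.<⇒≤ 0<δ) (close (ℕ.≤-trans N₀≥M hm) (ℕ.≤-trans N₀≥M (ℕ.≤-trans hm m≤n))) (s-bound m) ⟩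
          δ * u K                                ≡⟨ trans (ℚ.*-comm δ (u K)) eδ ⟩
          ½ * ε                                  ∎
        second : abs (E n i - E n n) ≤ ½ * ε
        second = begin
          abs (E n i - E n n)                    ≡⟨ abs-minus (E n i) (E n n) ⟩
          abs (E n n - E n i)                    ≤⟨ tail (bx n) (ℕ.≤⇒≤′ m≤n) ⟩
          s n - s i                              ≤⟨ s-tail (ℕ.≤-trans N₀≥K hm) (ℕ.≤⇒≤′ m≤n) ⟩
          t i + t i                              ≤⟨ ℚ.+-mono-≤ (small (ℕ.≤-trans N₀≥N hm)) (small (ℕ.≤-trans N₀≥N hm)) ⟩
          ½ * (½ * ε) + ½ * (½ * ε)              ≡⟨ half+half (½ * ε) ⟩
          ½ * ε                                  ∎

      main : ∀ {m n} → N₀ ℕ.≤ m → N₀ ℕ.≤ n → abs (E m m - E n n) ≤ ε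
      main {m} {n} hm hn with ℕ.≤-total m n
      ... | inj₁ m≤n = ordered hm m≤n
      ... | inj₂ n≤m = ℚ.≤-trans (ℚ.≤-reflexive (abs-minus (E m m) (E n n))) (ordered hn n≤m)

-- The n-th approximant is the n-th partial sum of Σ qᵏ / k ! at q = seq x n.
-- These sums converge uniformly on bounded sets and the seq x n are bounded, so
-- this diagonal has the same limit as Σ xᵏ / k !.
exp : ℝ → ℝ
exp x = mkℝ (λ n → expSum (seq x n) n) (exp-cauchy x)

-- Functions on Carrier are not separately required to respect _≈_: Lipschitz
-- ones do, since u ≈ v gives d u v ≃ 0.
record FiniteMetricSpace : Set₁ where
  infix 4 _≈_
  field
    Carrier         : Set
    _≈_             : Rel Carrier 0ℓ
    d               : Carrier → Carrier → ℝ
    isMetric        : IsGeneralMetric _≈_ _≃_ _≤ᴿ_ 0ᴿ _+ᴿ_ d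
    size            : ℕ
    nonempty        : ℕ.NonZero size
    point           : Fin size → Carrier
    point-bijective : Bijective _≡_ _≈_ point

fromℕ-mono : ∀ {m n} → m ℕ.≤ n → fromℕ m ≤ᴿ fromℕ n
fromℕ-mono m≤n = pointwise⇒≤ᴿ (λ _ → fromℕℚ-mono m≤n)

fromℕ-cong : ∀ {m n} → m ≡ n → fromℕ m ≃ fromℕ n
fromℕ-cong refl = ≤ᴿ-refl , ≤ᴿ-refl

fromℕ≃0⇒≡0 : ∀ {m} → fromℕ m ≃ 0ᴿ → m ≡ 0
fromℕ≃0⇒≡0 {zero}  _           = refl
fromℕ≃0⇒≡0 {suc m} (m+1≤0 , _) = contradiction
  (ℚ.≤-trans (fromℕℚ-mono {1} {suc m} (ℕ.s≤s ℕ.z≤n)) (proj₂ (within m+1≤0 (ℚ.positive⁻¹ ½)) ℕ.≤-refl))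
  (from-no (1ℚ ℚ.≤? (0ℚ + ½)))

fromℕ-isMetric : ∀ {A : Set} {_≈_ : Rel A 0ℓ} {d : A → A → ℕ} → IsMetric _≈_ d →
                 IsGeneralMetric _≈_ _≃_ _≤ᴿ_ 0ᴿ _+ᴿ_ (λ x y → fromℕ (d x y))
fromℕ-isMetric {d = d} isM = record
  { isSemiMetric = record
    { isQuasiSemiMetric = record
      { isPreMetric = record
        { isProtoMetric = record
          { isPartialOrder  = ≤ᴿ-isPartialOrder
          ; ≈-isEquivalence = M.≈-isEquivalence
          ; cong            = λ p q → fromℕ-cong (M.cong p q)
          ; nonNegative     = λ {x} {y} → fromℕ-mono {0} {d x y} ℕ.z≤n
          }
        ; ≈⇒0 = λ p → fromℕ-cong (M.≈⇒0 p)
        }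
      ; 0⇒≈ = λ p → M.0⇒≈ (fromℕ≃0⇒≡0 p)
      }
    ; sym = λ x y → fromℕ-cong (M.sym x y)
    }
  ; triangle = λ x y z → pointwise⇒≤ᴿ
      (λ _ → ℚ.≤-trans (fromℕℚ-mono (M.triangle x y z)) (ℚ.≤-reflexive (fromℕℚ-+ (d x y) (d y z))))
  }
  where module M = IsMetric isM

sumᴿ : ∀ {n} → (Fin n → ℝ) → ℝ
sumᴿ = foldr _+ᴿ_ 0ᴿ

IsLeast : (ℝ → Set) → ℝ → Set
IsLeast P x = P x × (∀ y → P y → x ≤ᴿ y)

IsSupremum : (ℝ → Set) → ℝ → Set
IsSupremum P = IsLeast (λ b → ∀ x → P x → x ≤ᴿ b)

IsSupremum-unique : ∀ {P x y} → IsSupremum P x → IsSupremum P y → x ≃ y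
IsSupremum-unique {P} {x} {y} (ub , least) (ub′ , least′) = least y ub′ , least′ x ub

module _ (Ω : FiniteMetricSpace) where
  open FiniteMetricSpace Ω

  𝔼 : (Carrier → ℝ) → ℝ
  𝔼 X = fromℚ ((ℤ.+ 1 / size) {{nonempty}}) *ᴿ sumᴿ (λ i → X (point i))

  IsLipschitz : (Carrier → ℝ) → Set
  IsLipschitz X = ∀ u v → ∣ X u -ᴿ X v ∣ᴿ ≤ᴿ d u v

  -- The argument s stands for σ², hence the requirement 0 ≤ s.
  IsSubgaussian : (Carrier → ℝ) → ℝ → Set
  IsSubgaussian X s = 0ᴿ ≤ᴿ s ×
    (∀ t → 𝔼 (λ u → exp (t *ᴿ (X u -ᴿ 𝔼 X))) ≤ᴿ exp (s *ᴿ (t *ᴿ t) *ᴿ fromℚ ½))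

  -- IsVarianceProxy X s says that s is the optimal σ²_X.
  IsVarianceProxy : (Carrier → ℝ) → ℝ → Set
  IsVarianceProxy X = IsLeast (IsSubgaussian X)

  IsSubgaussianConstant : ℝ → Set
  IsSubgaussianConstant = IsSupremum (λ s → ∃ λ X → IsLipschitz X × IsVarianceProxy X s)

record Graph : Set₁ where
  field
    Vertex     : Set
    Adj        : Rel Vertex 0ℓ
    Adj-sym    : Symmetric Adj
    Adj-irrefl : Irreflexive _≡_ Adj

data Walk (G : Graph) : Graph.Vertex G → Graph.Vertex G → ℕ → Set where
  []  : ∀ {u} → Walk G u u 0
  _∷_ : ∀ {u v w k} → Graph.Adj G u v → Walk G v w k → Walk G u w (suc k)

-- This determines dist uniquely, and makes G connected.
record IsGraphDistance (G : Graph) (dist : Graph.Vertex G → Graph.Vertex G → ℕ) : Set where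
  field
    geodesic : ∀ u v → Walk G u v (dist u v)
    minimal  : ∀ {u v k} → Walk G u v k → dist u v ℕ.≤ k

record FiniteConnectedGraph : Set₁ where
  field
    graph           : Graph
  open Graph graph public
  field
    size            : ℕ
    nonempty        : ℕ.NonZero size
    enumeration     : Fin size ↔ Vertex
    dist            : Vertex → Vertex → ℕ
    isGraphDistance : IsGraphDistance graph dist
  open IsGraphDistance isGraphDistance public

module _ {G : Graph} where
  open Graph G

  _++ʷ_ : ∀ {u v w k l} → Walk G u v k → Walk G v w l → Walk G u w (k ℕ.+ l)
  []      ++ʷ q = q
  (a ∷ p) ++ʷ q = a ∷ (p ++ʷ q)

  snocʷ : ∀ {u v w k} → Walk G u v k → Adj v w → Walk G u w (suc k)
  snocʷ []      b = b ∷ []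
  snocʷ (a ∷ p) b = a ∷ snocʷ p b

  reverseʷ : ∀ {u v k} → Walk G u v k → Walk G v u k
  reverseʷ []      = []
  reverseʷ (a ∷ p) = snocʷ (reverseʷ p) (Adj-sym a)

  Walk-0 : ∀ {u v k} → Walk G u v k → k ≡ 0 → u ≡ v
  Walk-0 [] _ = refl

graphMetricSpace : FiniteConnectedGraph → FiniteMetricSpace
graphMetricSpace G = record
  { Carrier         = Vertex
  ; _≈_             = _≡_
  ; d               = λ u v → fromℕ (dist u v)
  ; isMetric        = fromℕ-isMetric record
    { isSemiMetric = record
      { isQuasiSemiMetric = record
        { isPreMetric = record
          { isProtoMetric = record
            { isPartialOrder  = ℕ.≤-isPartialOrder
            ; ≈-isEquivalence = isEquivalence
            ; cong            = cong₂ dist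
            ; nonNegative     = ℕ.z≤n
            }
          ; ≈⇒0 = λ { refl → ℕ.n≤0⇒n≡0 (minimal []) }
          }
        ; 0⇒≈ = λ {u} {v} → Walk-0 (geodesic u v)
        }
      ; sym = λ u v → ℕ.≤-antisym (minimal (reverseʷ (geodesic v u))) (minimal (reverseʷ (geodesic u v)))
      }
    ; triangle = λ u v w → minimal (geodesic u v ++ʷ geodesic v w)
    }
  ; size            = size
  ; nonempty        = nonempty
  ; point           = Inverse.to enumeration
  ; point-bijective = Bijection.bijective (↔⇒⤖ enumeration)
  }
  where open FiniteConnectedGraph G

K : (m : ℕ) {{_ : ℕ.NonZero m}} → FiniteConnectedGraph
K m {{m≢0}} = record
  { graph           = complete
  ; size            = m
  ; nonempty        = m≢0
  ; enumeration     = ↔-id (Fin m)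
  ; dist            = distance
  ; isGraphDistance = record { geodesic = geodesic ; minimal = minimal }
  }
  where
  complete : Graph
  complete = record
    { Vertex     = Fin m
    ; Adj        = _≢_
    ; Adj-sym    = λ u≢v v≡u → u≢v (sym v≡u)
    ; Adj-irrefl = λ u≡v u≢v → u≢v u≡v
    }

  distance : Fin m → Fin m → ℕ
  distance u v = if does (u Fin.≟ v) then 0 else 1

  geodesic : ∀ u v → Walk complete u v (distance u v)
  geodesic u v with u Fin.≟ v
  ... | yes refl = []
  ... | no  u≢v  = u≢v ∷ []

  minimal : ∀ {u v k} → Walk complete u v k → distance u v ℕ.≤ k
  minimal {u} {v} p with u Fin.≟ v | p
  ... | yes _   | _     = ℕ.z≤n
  ... | no  u≢v | []    = contradiction refl u≢v
  ... | no  _   | _ ∷ _ = ℕ.s≤s ℕ.z≤n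

infixr 6 _□_

_□_ : FiniteConnectedGraph → FiniteConnectedGraph → FiniteConnectedGraph
G □ H = record
  { graph           = product
  ; size            = G.size ℕ.* H.size
  ; nonempty        = ℕ.m*n≢0 G.size H.size {{G.nonempty}} {{H.nonempty}}
  ; enumeration     = (G.enumeration ×-↔ H.enumeration) ↔-∘ *↔×
  ; dist            = distance
  ; isGraphDistance = record
    { geodesic = λ (u , u′) (v , v′) → liftˡ (G.geodesic u v) ++ʷ liftʳ (H.geodesic u′ v′)
    ; minimal  = minimal
    }
  }
  where
  module G = FiniteConnectedGraph G
  module H = FiniteConnectedGraph H

  product : Graph
  product = record
    { Vertex     = G.Vertex × H.Vertex
    ; Adj        = λ (u , u′) (v , v′) → (u ≡ v × H.Adj u′ v′) ⊎ (G.Adj u v × u′ ≡ v′)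
    ; Adj-sym    = Sum.map (λ (e , a) → sym e , H.Adj-sym a) (λ (a , e) → G.Adj-sym a , sym e)
    ; Adj-irrefl = λ { refl (inj₁ (_ , a)) → H.Adj-irrefl refl a ; refl (inj₂ (a , _)) → G.Adj-irrefl refl a }
    }

  distance : G.Vertex × H.Vertex → G.Vertex × H.Vertex → ℕ
  distance (u , u′) (v , v′) = G.dist u v ℕ.+ H.dist u′ v′

  liftˡ : ∀ {u v w k} → Walk G.graph u v k → Walk product (u , w) (v , w) k
  liftˡ []      = []
  liftˡ (a ∷ p) = inj₂ (a , refl) ∷ liftˡ p

  liftʳ : ∀ {u v w k} → Walk H.graph u v k → Walk product (w , u) (w , v) k
  liftʳ []      = []
  liftʳ (a ∷ p) = inj₁ (refl , a) ∷ liftʳ p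

  project : ∀ {u u′ v v′ k} → Walk product (u , u′) (v , v′) k →
            ∃ λ i → ∃ λ j → Walk G.graph u v i × Walk H.graph u′ v′ j × i ℕ.+ j ≡ k
  project [] = 0 , 0 , [] , [] , refl
  project (inj₁ (refl , a) ∷ p) with project p
  ... | i , j , q , r , e = i , suc j , q , a ∷ r , trans (ℕ.+-suc i j) (cong suc e)
  project (inj₂ (a , refl) ∷ p) with project p
  ... | i , j , q , r , e = suc i , j , a ∷ q , r , cong suc e

  minimal : ∀ {x y k} → Walk product x y k → distance x y ℕ.≤ k
  minimal p with project p
  ... | i , j , q , r , refl = ℕ.+-mono-≤ (G.minimal q) (H.minimal r)

-- J n = K n □ K (n - 1) □ ⋯ □ K 2; the empty product (n ≤ 1) is a point.
J : ℕ → FiniteConnectedGraph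
J 0               = K 1
J 1               = K 1
J 2               = K 2
J (suc n@(suc (suc _))) = K (suc n) □ J n

module _ {n : ℕ} where
  hamming : Permutation′ n → Permutation′ n → ℕ
  hamming π ρ = length (filter (λ i → ¬? (π ⟨$⟩ʳ i Fin.≟ ρ ⟨$⟩ʳ i)) (allFin n))

  hamming-isMetric : IsMetric Perm._≈_ hamming
  hamming-isMetric = record
    { isSemiMetric = record
      { isQuasiSemiMetric = record
        { isPreMetric = record
          { isProtoMetric = record
            { isPartialOrder  = ℕ.≤-isPartialOrder
            ; ≈-isEquivalence = record
              { refl  = λ _ → refl
              ; sym   = λ p i → sym (p i)
              ; trans = λ p q i → trans (p i) (q i)
              }
            ; cong            = λ {π} {π′} {ρ} {ρ′} p q → cong length
                (filter-≐ (differ? π ρ) (differ? π′ ρ′)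
                  ( (λ {i} ne e → ne (trans (p i) (trans e (sym (q i)))))
                  , (λ {i} ne e → ne (trans (sym (p i)) (trans e (q i))))) (allFin n))
            ; nonNegative     = ℕ.z≤n
            }
          ; ≈⇒0 = λ {π} {ρ} p → cong length (filter-none (differ? π ρ) (All.tabulate {xs = allFin n} (λ {i} _ ne → ne (p i))))
          }
        ; 0⇒≈ = λ {π} {ρ} e i → decidable-stable (π ⟨$⟩ʳ i Fin.≟ ρ ⟨$⟩ʳ i)
            (λ ne → ℕ.<⇒≢ (filter-some (differ? π ρ) (lose (∈-allFin i) ne)) (sym e))
        }
      ; sym = λ π ρ → cong length (filter-≐ (differ? π ρ) (differ? ρ π) ((λ ne e → ne (sym e)) , (λ ne e → ne (sym e))) (allFin n))
      }
    ; triangle = λ π ρ τ → count-triangle π ρ τ (allFin n)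
    }
    where
    differ? : (π ρ : Permutation′ n) → Decidable (λ i → π ⟨$⟩ʳ i ≢ ρ ⟨$⟩ʳ i)
    differ? π ρ i = ¬? (π ⟨$⟩ʳ i Fin.≟ ρ ⟨$⟩ʳ i)

    count-triangle : ∀ π ρ τ is → length (filter (differ? π τ) is) ℕ.≤
                     length (filter (differ? π ρ) is) ℕ.+ length (filter (differ? ρ τ) is)
    count-triangle π ρ τ [] = ℕ.z≤n
    count-triangle π ρ τ (i ∷ is) with ih ← count-triangle π ρ τ is
      | π ⟨$⟩ʳ i Fin.≟ τ ⟨$⟩ʳ i | π ⟨$⟩ʳ i Fin.≟ ρ ⟨$⟩ʳ i | ρ ⟨$⟩ʳ i Fin.≟ τ ⟨$⟩ʳ i
    ... | yes _ | yes _ | yes _ = ih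
    ... | yes _ | yes _ | no  _ = ℕ.≤-trans ih (ℕ.+-monoʳ-≤ _ (ℕ.n≤1+n _))
    ... | yes _ | no  _ | yes _ = ℕ.m≤n⇒m≤1+n ih
    ... | yes _ | no  _ | no  _ = ℕ.m≤n⇒m≤1+n (ℕ.≤-trans ih (ℕ.+-monoʳ-≤ _ (ℕ.n≤1+n _)))
    ... | no  a | yes b | yes c = contradiction (trans b c) a
    ... | no  _ | yes _ | no  _ = ℕ.≤-trans (ℕ.s≤s ih) (ℕ.≤-reflexive (sym (ℕ.+-suc _ _)))
    ... | no  _ | no  _ | yes _ = ℕ.s≤s ih
    ... | no  _ | no  _ | no  _ = ℕ.s≤s (ℕ.≤-trans ih (ℕ.+-monoʳ-≤ _ (ℕ.n≤1+n _)))

nthPermutation : ∀ n → Fin (n !) → Permutation′ n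
nthPermutation zero    _ = Perm.id
nthPermutation (suc n) k = Perm.insert 0F (quotient {suc n} (n !) k) (nthPermutation n (remainder {suc n} (n !) k))

nthPermutation-bijective : ∀ n → Bijective _≡_ Perm._≈_ (nthPermutation n)
nthPermutation-bijective zero = (λ { {0F} {0F} _ → refl }) , λ π → 0F , λ _ ()
nthPermutation-bijective (suc n) = injective , surjective
  where
  ih = nthPermutation-bijective n

  injective : Injective _≡_ Perm._≈_ (nthPermutation (suc n))
  injective {k} {l} p = trans (sym (combine-remQuot {suc n} (n !) k))
    (trans (cong₂ combine quo≡ (proj₁ ih rem≈)) (combine-remQuot {suc n} (n !) l))
    where
    quo = quotient {suc n} (n !)
    rem = remainder {suc n} (n !)
    quo≡ : quo k ≡ quo l
    quo≡ = p 0F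
    rem≈ : nthPermutation n (rem k) Perm.≈ nthPermutation n (rem l)
    rem≈ i = punchIn-injective (quo k) _ _
      (trans (sym (Perm.insert-punchIn 0F (quo k) (nthPermutation n (rem k)) i))
      (trans (p (suc i))
      (trans (Perm.insert-punchIn 0F (quo l) (nthPermutation n (rem l)) i)
             (cong (λ q → punchIn q (nthPermutation n (rem l) ⟨$⟩ʳ i)) (sym quo≡)))))

  insert-cong : ∀ j {π ρ : Permutation′ n} → π Perm.≈ ρ → Perm.insert 0F j π Perm.≈ Perm.insert 0F j ρ
  insert-cong j p 0F = refl
  insert-cong j {π} {ρ} p (suc i) = trans (Perm.insert-punchIn 0F j π i)
    (trans (cong (punchIn j) (p i)) (sym (Perm.insert-punchIn 0F j ρ i)))

  surjective : Surjective _≡_ Perm._≈_ (nthPermutation (suc n))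
  surjective π with proj₂ ih (Perm.remove 0F π)
  ... | k , hits = combine (π ⟨$⟩ʳ 0F) k , λ { refl i → trans
    (cong (λ (q , r) → Perm.insert 0F q (nthPermutation n r) ⟨$⟩ʳ i) (remQuot-combine {suc n} (π ⟨$⟩ʳ 0F) k))
    (trans (insert-cong (π ⟨$⟩ʳ 0F) {nthPermutation n k} {Perm.remove 0F π} (hits refl) i) (Perm.insert-remove 0F π i)) }

S : ℕ → FiniteMetricSpace
S n = record
  { Carrier         = Permutation′ n
  ; _≈_             = Perm._≈_
  ; d               = λ π ρ → fromℕ (hamming π ρ)
  ; isMetric        = fromℕ-isMetric hamming-isMetric
  ; size            = n !
  ; nonempty        = n !≢0
  ; point           = nthPermutation n
  ; point-bijective = nthPermutation-bijective n
  }

-- Upper bound: if X has range at most 1, then Z = exp (h X) takes values in some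
-- [a , b] with b / a ≤ exp ∣h∣, so E Z² ≤ (a + b)² / (4 a b) (E Z)² ≤ cosh² (h / 2) (E Z)².
-- Hence a variance proxy s improves to s / 2 + 1/8, and the optimal one is at most 1/4
-- (Hoeffding).  On three points this is strict: for small t the variance, at most 2/9,
-- decides, and for large t the bound cosh y ≤ exp (y² / 2) has room to spare.
-- Conditioning on one coordinate, subgaussian constants are subadditive under □,
-- which bounds that of J n by (n - 1) / 4 minus the gain from the factor K 3.
--
-- Lower bound: a variance proxy is at least the variance, and ½ Σ εᵢ ε_{π i} with
-- alternating signs ε is a Lipschitz function on S n of variance greater than n / 4.
--
-- Excluded middle gives the total order, the suprema and the infima of the reals.

{-# OPTIONS --safe #-}
module Submission where

open import Defs
open import Axiom.ExcludedMiddle using (ExcludedMiddle)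
open import Data.Integer.Base using (+_)
open import Data.Nat.Base using (ℕ; _≤_)
open import Data.Product.Base using (∃; _×_)
open import Data.Rational.Base using (_/_)
open import Level using (0ℓ)
open import Algebra.Bundles using (CommutativeRing)
open import Algebra.Solver.Ring.AlmostCommutativeRing using (fromCommutativeRing; _-Raw-AlmostCommutative⟶_)
import Algebra.Properties.CommutativeMonoid.Sum as Sum
import Algebra.Solver.Ring
open import Data.Fin.Base as Fin using (Fin; zero; suc)
import Data.Fin.Properties as Fin
import Data.Integer.Base as ℤ
import Data.Integer.Properties as ℤ
open import Data.Maybe.Base as Maybe using (Maybe)
open import Data.Fin.Permutation using (Permutation′; insert; insert-punchIn; _⟨$⟩ʳ_)
open import Data.List.Base using (length; filter; tabulate; allFin)
open import Data.List.Properties using (length-filter; length-tabulate)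
open import Data.Nat.Base as ℕ using (zero; suc; _!)
import Data.Nat.Properties as ℕ
open import Data.Nat.Properties using (_!≢0)
open import Data.Product.Base using (_,_; proj₁; proj₂)
open import Data.Rational.Base as ℚ using (ℚ; 0ℚ; 1ℚ; ½; _+_; _*_; _-_; -_; nonNegative; positive)
  renaming (∣_∣ to abs)
import Data.Rational.Properties as ℚ
import Data.Rational.Unnormalised.Base as ℚᵘ
import Data.Rational.Unnormalised.Properties as ℚᵘ
open import Data.Rational.Solver using (module +-*-Solver)
open import Data.Sum.Base using (_⊎_; inj₁; inj₂)
open import Function.Base using (_∘_; id)
open import Function.Bundles using (Inverse)
open import Function.Metric.Structures using (IsGeneralMetric)
open import Relation.Binary.PropositionalEquality
  using (_≡_; refl; sym; trans; cong; cong₂; subst; subst₂)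
open import Relation.Nullary using (Dec; yes; no; ¬_; ¬?; contradiction)
open import Relation.Nullary.Decidable using (from-yes; dec⇒maybe; decidable-stable)
open import Relation.Unary using (Decidable)

-- The margin is thin: σ² of `J n` has to stay below (n - 1) / 4, which is exactly what
-- subadditivity and Hoeffding give, and `K 2` attains 1/4. Strictness must come from one factor,
-- and `K 3` occurs in every `J n` with n ≥ 3. As the constant is a supremum over all Lipschitz
-- functions, a strict inequality for each of them is not enough: the gain has to be one rational
-- number `σ₃` below 1/4, valid for all X at once.
--
-- The usual proof of Hoeffding's lemma differentiates log E exp (t X) twice. Here the step is
-- algebraic, an inequality between averages at 2 y and 4 y, and 1/4 appears as the fixed point of s
-- ↦ s / 2 + 1/8. This requires a least proxy that is attained, and before that some crude finite
-- proxy. The step keeps the constant c of cosh y ≤ exp (c y²) as a parameter; a c below ½ is what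
-- the gain on three points exploits.
--
-- On `S n` the alternating signs have sum 0 or 1, which keeps the mean at most 1 / (2 n), and the
-- second moment is computed exactly by recursion on the image of the first element.

-- Real numbers as an ordered commutative ring

module _ where
  open ℚ.≤-Reasoning
  open +-*-Solver

  pointwise⇒≃ : ∀ {x y} → (∀ n → seq x n ≡ seq y n) → x ≃ y
  pointwise⇒≃ h = pointwise⇒≤ᴿ (λ n → ℚ.≤-reflexive (h n)) , pointwise⇒≤ᴿ (λ n → ℚ.≤-reflexive (sym (h n)))

  eventually⇒≤ᴿ : ∀ {x y} → (∃ λ N → ∀ {n} → N ≤ n → seq x n ℚ.≤ seq y n) → x ≤ᴿ y
  eventually⇒≤ᴿ (N , h) = mk≤ᴿ λ 0<ε → N , λ N≤n → ℚ.≤-trans (h N≤n) (p≤p+q (ℚ.<⇒≤ 0<ε))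

  ≃-refl : ∀ {x} → x ≃ x
  ≃-refl = ≤ᴿ-refl , ≤ᴿ-refl

  ≃-sym : ∀ {x y} → x ≃ y → y ≃ x
  ≃-sym (p , q) = q , p

  ≃-trans : ∀ {x y z} → x ≃ y → y ≃ z → x ≃ z
  ≃-trans (a , b) (c , d) = ≤ᴿ-trans a c , ≤ᴿ-trans d b

  +ᴿ-mono-≤ : ∀ {x y u v} → x ≤ᴿ y → u ≤ᴿ v → x +ᴿ u ≤ᴿ y +ᴿ v
  +ᴿ-mono-≤ {x} {y} {u} {v} x≤y u≤v = mk≤ᴿ λ {ε} 0<ε →
    let M , p = within x≤y (halfPos 0<ε)
        N , q = within u≤v (halfPos 0<ε)
    in M ℕ.⊔ N , λ {n} le → begin
      seq x n + seq u n                             ≤⟨ ℚ.+-mono-≤ (p (ℕ.m⊔n≤o⇒m≤o M N le)) (q (ℕ.m⊔n≤o⇒n≤o M N le)) ⟩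
      seq y n + ½ * ε + (seq v n + ½ * ε)           ≡⟨ solve 3 (λ y v ε → y :+ con ½ :* ε :+ (v :+ con ½ :* ε) := y :+ v :+ ε) refl (seq y n) (seq v n) ε ⟩
      seq y n + seq v n + ε                         ∎

  -ᴿ-anti-≤ : ∀ {x y} → x ≤ᴿ y → (-ᴿ y) ≤ᴿ (-ᴿ x)
  -ᴿ-anti-≤ {x} {y} x≤y = mk≤ᴿ λ {ε} 0<ε → let M , p = within x≤y 0<ε in
    M , λ {n} le → begin
      - seq y n                       ≡⟨ solve 2 (λ y ε → :- y := :- (y :+ ε) :+ ε) refl (seq y n) ε ⟩
      - (seq y n + ε) + ε             ≤⟨ ℚ.+-monoˡ-≤ ε (ℚ.neg-antimono-≤ (p le)) ⟩
      - seq x n + ε                   ∎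

  abs-≤ : ∀ {p q r} → abs (p - q) ℚ.≤ r → p ℚ.≤ q + r
  abs-≤ {p} {q} {r} h = begin
    p               ≡⟨ solve 2 (λ p q → p := q :+ (p :- q)) refl p q ⟩
    q + (p - q)     ≤⟨ ℚ.+-monoʳ-≤ q (ℚ.≤-trans (p≤∣p∣ (p - q)) h) ⟩
    q + r           ∎

  -- Since `u` may have either sign, both halves of `x ≃ y` enter: together they bound the absolute
  -- difference, which is then scaled by a bound `U` for `u`.
  *ᴿ-congˡ-≤ : ∀ u {x y} → x ≃ y → u *ᴿ x ≤ᴿ u *ᴿ y
  *ᴿ-congˡ-≤ u {x} {y} (x≤y , y≤x) = mk≤ᴿ λ {ε} 0<ε →
    let U , 0<U , bu = bounded u
        δ , 0<δ , eδ = shrink 0<U 0<ε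
        M , p = within x≤y 0<δ
        N , q = within y≤x 0<δ
    in M ℕ.⊔ N , λ {n} le → abs-≤ (begin
      abs (seq u n * seq x n - seq u n * seq y n)  ≡⟨ cong abs (solve 3 (λ u x y → u :* x :- u :* y := u :* (x :- y)) refl (seq u n) (seq x n) (seq y n)) ⟩
      abs (seq u n * (seq x n - seq y n))          ≡⟨ ℚ.∣p*q∣≡∣p∣*∣q∣ (seq u n) (seq x n - seq y n) ⟩
      abs (seq u n) * abs (seq x n - seq y n)      ≤⟨ *-mono (ℚ.0≤∣p∣ (seq x n - seq y n)) (ℚ.<⇒≤ 0<U) (bu n)
                                                        (∣p∣≤ (diff (p (ℕ.m⊔n≤o⇒m≤o M N le)))
                                                          (subst (ℚ._≤ δ) (solve 2 (λ x y → y :- x := :- (x :- y)) refl (seq x n) (seq y n))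
                                                            (diff (q (ℕ.m⊔n≤o⇒n≤o M N le))))) ⟩
      U * δ                                        ≡⟨ eδ ⟩
      ε                                            ∎)
    where
    diff : ∀ {a b δ} → a ℚ.≤ b + δ → a - b ℚ.≤ δ
    diff {a} {b} {δ} h = begin
      a - b        ≤⟨ ℚ.+-monoˡ-≤ (- b) h ⟩
      b + δ - b    ≡⟨ solve 2 (λ b δ → b :+ δ :- b := δ) refl b δ ⟩
      δ            ∎

  +ᴿ-cong : ∀ {x y u v} → x ≃ y → u ≃ v → x +ᴿ u ≃ y +ᴿ v
  +ᴿ-cong (a , b) (c , d) = +ᴿ-mono-≤ a c , +ᴿ-mono-≤ b d

  -ᴿ-cong : ∀ {x y} → x ≃ y → (-ᴿ x) ≃ (-ᴿ y)
  -ᴿ-cong (a , b) = -ᴿ-anti-≤ b , -ᴿ-anti-≤ a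

  *ᴿ-comm : ∀ x y → x *ᴿ y ≃ y *ᴿ x
  *ᴿ-comm x y = pointwise⇒≃ λ n → ℚ.*-comm (seq x n) (seq y n)

  *ᴿ-congˡ : ∀ u {x y} → x ≃ y → u *ᴿ x ≃ u *ᴿ y
  *ᴿ-congˡ u e = *ᴿ-congˡ-≤ u e , *ᴿ-congˡ-≤ u (≃-sym e)

  *ᴿ-cong : ∀ {x y u v} → x ≃ y → u ≃ v → x *ᴿ u ≃ y *ᴿ v
  *ᴿ-cong {x} {y} {u} {v} e f = ≃-trans (*ᴿ-congˡ x f) (≃-trans (*ᴿ-comm x v) (≃-trans (*ᴿ-congˡ v e) (*ᴿ-comm v y)))

  *ᴿ-nonNeg : ∀ {x y} → 0ᴿ ≤ᴿ x → 0ᴿ ≤ᴿ y → 0ᴿ ≤ᴿ x *ᴿ y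
  *ᴿ-nonNeg {x} {y} 0≤x 0≤y = mk≤ᴿ λ {ε} 0<ε →
    let A , 0<A , bx = bounded x
        B , 0<B , by = bounded y
        -- (a + δ)(b + δ) exceeds a b by δ (a + b + δ). With δ = ε / C the summand ε in C forces δ ≤
        -- 1, and then C bounds a + b + δ.
        C = A + B + (1ℚ + ε)
        0<1+ε : 0ℚ ℚ.< 1ℚ + ε
        0<1+ε = ℚ.<-trans 0<ε (subst (ℚ._< 1ℚ + ε) (ℚ.+-identityˡ ε) (ℚ.+-monoˡ-< ε (ℚ.positive⁻¹ 1ℚ)))
        0<C : 0ℚ ℚ.< C
        0<C = ℚ.<-≤-trans 0<1+ε (subst (ℚ._≤ C) (ℚ.+-identityˡ (1ℚ + ε)) (ℚ.+-monoˡ-≤ (1ℚ + ε) (+-nonNeg (ℚ.<⇒≤ 0<A) (ℚ.<⇒≤ 0<B))))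
        δ , 0<δ , eδ = shrink 0<C 0<ε
        0≤δ = ℚ.<⇒≤ 0<δ
        δ≤1 : δ ℚ.≤ 1ℚ
        δ≤1 = ℚ.*-cancelˡ-≤-pos C {{positive 0<C}} (begin
          C * δ    ≡⟨ eδ ⟩
          ε        ≤⟨ subst (ε ℚ.≤_) (solve 3 (λ a b ε → ε :+ (a :+ b :+ con 1ℚ) := (a :+ b :+ (con 1ℚ :+ ε)) :* con 1ℚ) refl A B ε)
                        (p≤p+q (+-nonNeg (+-nonNeg (ℚ.<⇒≤ 0<A) (ℚ.<⇒≤ 0<B)) (ℚ.<⇒≤ (ℚ.positive⁻¹ 1ℚ)))) ⟩
          C * 1ℚ   ∎)
        M , p = within 0≤x 0<δ
        N , q = within 0≤y 0<δ
    in M ℕ.⊔ N , λ {n} le →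
      let a = seq x n
          b = seq y n
      in begin
      0ℚ                                        ≤⟨ *-nonNeg (p (ℕ.m⊔n≤o⇒m≤o M N le)) (q (ℕ.m⊔n≤o⇒n≤o M N le)) ⟩
      (a + δ) * (b + δ)                         ≡⟨ solve 3 (λ a b δ → (a :+ δ) :* (b :+ δ) := a :* b :+ δ :* (a :+ b :+ δ)) refl a b δ ⟩
      a * b + δ * (a + b + δ)                   ≤⟨ ℚ.+-monoʳ-≤ (a * b) (ℚ.*-monoˡ-≤-nonNeg δ {{nonNegative 0≤δ}}
                                                     (ℚ.+-mono-≤ (ℚ.+-mono-≤ (ℚ.≤-trans (p≤∣p∣ a) (bx n)) (ℚ.≤-trans (p≤∣p∣ b) (by n)))
                                                       (ℚ.≤-trans δ≤1 (p≤p+q (ℚ.<⇒≤ 0<ε))))) ⟩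
      a * b + δ * C                             ≡⟨ cong (λ w → a * b + w) (trans (ℚ.*-comm δ C) eδ) ⟩
      a * b + ε                                 ∎

1ᴿ : ℝ
1ᴿ = fromℚ 1ℚ

module _ where
  open +-*-Solver

  ℝ-commutativeRing : CommutativeRing 0ℓ 0ℓ
  ℝ-commutativeRing = record
    { Carrier = ℝ ; _≈_ = _≃_ ; _+_ = _+ᴿ_ ; _*_ = _*ᴿ_ ; -_ = -ᴿ_ ; 0# = fromℚ 0ℚ ; 1# = 1ᴿ
    ; isCommutativeRing = record
      { isRing = record
        { +-isAbelianGroup = record
          { isGroup = record
            { isMonoid = record
              { isSemigroup = record
                { isMagma = record { isEquivalence = ≃-isEquivalence ; ∙-cong = +ᴿ-cong }
                ; assoc = λ x y z → pointwise⇒≃ λ n → ℚ.+-assoc (seq x n) (seq y n) (seq z n)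
                }
              ; identity = (λ x → pointwise⇒≃ λ n → ℚ.+-identityˡ (seq x n)) , (λ x → pointwise⇒≃ λ n → ℚ.+-identityʳ (seq x n))
              }
            ; inverse = (λ x → pointwise⇒≃ λ n → ℚ.+-inverseˡ (seq x n)) , (λ x → pointwise⇒≃ λ n → ℚ.+-inverseʳ (seq x n))
            ; ⁻¹-cong = -ᴿ-cong
            }
          ; comm = λ x y → pointwise⇒≃ λ n → ℚ.+-comm (seq x n) (seq y n)
          }
        ; *-cong = *ᴿ-cong
        ; *-assoc = λ x y z → pointwise⇒≃ λ n → ℚ.*-assoc (seq x n) (seq y n) (seq z n)
        ; *-identity = (λ x → pointwise⇒≃ λ n → ℚ.*-identityˡ (seq x n)) , (λ x → pointwise⇒≃ λ n → ℚ.*-identityʳ (seq x n))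
        ; distrib = (λ x y z → pointwise⇒≃ λ n → ℚ.*-distribˡ-+ (seq x n) (seq y n) (seq z n))
                  , (λ x y z → pointwise⇒≃ λ n → ℚ.*-distribʳ-+ (seq x n) (seq y n) (seq z n))
        }
      ; *-comm = *ᴿ-comm
      }
    }

-- Rational coefficients make the ring solver effective on ℝ: equality of constants is decidable in
-- ℚ, while `≃` comes with no decision procedure.
fromℚ-homomorphism : CommutativeRing.rawRing ℚ.+-*-commutativeRing -Raw-AlmostCommutative⟶ fromCommutativeRing ℝ-commutativeRing
fromℚ-homomorphism = record
  { ⟦_⟧    = fromℚ
  ; +-homo = λ _ _ → pointwise⇒≃ λ _ → refl
  ; *-homo = λ _ _ → pointwise⇒≃ λ _ → refl
  ; -‿homo = λ _ → pointwise⇒≃ λ _ → refl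
  ; 0-homo = ≃-refl
  ; 1-homo = ≃-refl
  }

fromℚ-≟ : ∀ p q → Maybe (fromℚ p ≃ fromℚ q)
fromℚ-≟ p q = Maybe.map (λ { refl → ≃-refl }) (dec⇒maybe (p ℚ.≟ q))

module ℝ-Solver = Algebra.Solver.Ring (CommutativeRing.rawRing ℚ.+-*-commutativeRing)
  (fromCommutativeRing ℝ-commutativeRing) fromℚ-homomorphism fromℚ-≟

module ≤ᴿ-Reasoning where
  infix  1 begin_
  infixr 2 step-≤ step-≃
  infix  3 _∎

  begin_ : ∀ {x y} → x ≤ᴿ y → x ≤ᴿ y
  begin p = p

  step-≤ : ∀ x {y z} → y ≤ᴿ z → x ≤ᴿ y → x ≤ᴿ z
  step-≤ _ q p = ≤ᴿ-trans p q

  step-≃ : ∀ x {y z} → y ≤ᴿ z → x ≃ y → x ≤ᴿ z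
  step-≃ _ q p = ≤ᴿ-trans (proj₁ p) q

  _∎ : ∀ x → x ≤ᴿ x
  _ ∎ = ≤ᴿ-refl

  syntax step-≤ x q p = x ≤⟨ p ⟩ q
  syntax step-≃ x q p = x ≃⟨ p ⟩ q

module _ where
  open ≤ᴿ-Reasoning
  open ℝ-Solver

  ≤⇒0≤- : ∀ {x y} → x ≤ᴿ y → 0ᴿ ≤ᴿ y -ᴿ x
  ≤⇒0≤- {x} {y} x≤y = begin
    0ᴿ         ≃⟨ solve 1 (λ x → con 0ℚ := x :- x) ≃-refl x ⟩
    x -ᴿ x     ≤⟨ +ᴿ-mono-≤ x≤y ≤ᴿ-refl ⟩
    y -ᴿ x     ∎

  0≤-⇒≤ : ∀ {x y} → 0ᴿ ≤ᴿ y -ᴿ x → x ≤ᴿ y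
  0≤-⇒≤ {x} {y} h = begin
    x               ≃⟨ solve 1 (λ x → x := x :+ con 0ℚ) ≃-refl x ⟩
    x +ᴿ 0ᴿ         ≤⟨ +ᴿ-mono-≤ ≤ᴿ-refl h ⟩
    x +ᴿ (y -ᴿ x)   ≃⟨ solve 2 (λ x y → x :+ (y :- x) := y) ≃-refl x y ⟩
    y               ∎

  *ᴿ-monoˡ-≤ : ∀ {z x y} → 0ᴿ ≤ᴿ z → x ≤ᴿ y → z *ᴿ x ≤ᴿ z *ᴿ y
  *ᴿ-monoˡ-≤ {z} {x} {y} 0≤z x≤y = 0≤-⇒≤ (begin
    0ᴿ                  ≤⟨ *ᴿ-nonNeg 0≤z (≤⇒0≤- x≤y) ⟩
    z *ᴿ (y -ᴿ x)       ≃⟨ solve 3 (λ x y z → z :* (y :- x) := z :* y :- z :* x) ≃-refl x y z ⟩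
    z *ᴿ y -ᴿ z *ᴿ x    ∎)

  *ᴿ-monoʳ-≤ : ∀ {z x y} → 0ᴿ ≤ᴿ z → x ≤ᴿ y → x *ᴿ z ≤ᴿ y *ᴿ z
  *ᴿ-monoʳ-≤ {z} {x} {y} 0≤z x≤y = ≤ᴿ-trans (proj₁ (*ᴿ-comm x z)) (≤ᴿ-trans (*ᴿ-monoˡ-≤ 0≤z x≤y) (proj₁ (*ᴿ-comm z y)))

  *ᴿ-mono-≤ : ∀ {x y u v} → 0ᴿ ≤ᴿ u → 0ᴿ ≤ᴿ y → x ≤ᴿ y → u ≤ᴿ v → x *ᴿ u ≤ᴿ y *ᴿ v
  *ᴿ-mono-≤ 0≤u 0≤y x≤y u≤v = ≤ᴿ-trans (*ᴿ-monoʳ-≤ 0≤u x≤y) (*ᴿ-monoˡ-≤ 0≤y u≤v)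

  square-nonNeg : ∀ p → 0ℚ ℚ.≤ p * p
  square-nonNeg p with ℚ.≤-total 0ℚ p
  ... | inj₁ 0≤p = *-nonNeg 0≤p 0≤p
  ... | inj₂ p≤0 = subst (0ℚ ℚ.≤_) (ℚS.solve 1 (λ p → (ℚS.:- p) ℚS.:* (ℚS.:- p) ℚS.:= p ℚS.:* p) refl p)
                     (*-nonNeg (ℚ.neg-antimono-≤ p≤0) (ℚ.neg-antimono-≤ p≤0))
    where module ℚS = +-*-Solver

  squareᴿ-nonNeg : ∀ x → 0ᴿ ≤ᴿ x *ᴿ x
  squareᴿ-nonNeg x = pointwise⇒≤ᴿ λ n → square-nonNeg (seq x n)

  fromℚ-mono : ∀ {p q} → p ℚ.≤ q → fromℚ p ≤ᴿ fromℚ q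
  fromℚ-mono p≤q = pointwise⇒≤ᴿ λ _ → p≤q

  -- The approximants of `z` are bounded, so a smaller ε absorbs this fixed factor. Passages to the
  -- limit ε → 0 go through this lemma.
  ≤ᴿ-of-approx : ∀ {x y} z → (∀ {ε} → 0ℚ ℚ.< ε → x ≤ᴿ y +ᴿ fromℚ ε *ᴿ z) → x ≤ᴿ y
  ≤ᴿ-of-approx {x} {y} z h = mk≤ᴿ λ {ε} 0<ε →
    let Z , 0<Z , bz = bounded z
        δ , 0<δ , eδ = shrink 0<Z (halfPos 0<ε)
        N , p        = within (h 0<δ) (halfPos 0<ε)
    in N , λ {n} N≤n → Q.begin
      seq x n                                 Q.≤⟨ p N≤n ⟩
      seq y n + δ * seq z n + ½ * ε           Q.≤⟨ ℚ.+-monoˡ-≤ (½ * ε) (ℚ.+-monoʳ-≤ (seq y n) (ℚ.*-monoˡ-≤-nonNeg δ {{nonNegative (ℚ.<⇒≤ 0<δ)}}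
                                                   (ℚ.≤-trans (p≤∣p∣ (seq z n)) (bz n)))) ⟩
      seq y n + δ * Z + ½ * ε                 Q.≡⟨ cong (λ w → seq y n + w + ½ * ε) (trans (ℚ.*-comm δ Z) eδ) ⟩
      seq y n + ½ * ε + ½ * ε                 Q.≡⟨ trans (ℚ.+-assoc (seq y n) _ _) (cong (λ w → seq y n + w) (half+half ε)) ⟩
      seq y n + ε                             Q.∎
    where module Q = ℚ.≤-Reasoning

-- Partial sums of the exponential series

partialSum : (ℕ → ℚ) → ℕ → ℚ
partialSum a zero    = 0ℚ
partialSum a (suc n) = partialSum a n + a n

-- Coefficients of the product of two formal power series (the Cauchy product).
conv : (ℕ → ℚ) → (ℕ → ℚ) → ℕ → ℚ
conv a b zero    = a 0 * b 0
conv a b (suc n) = a 0 * b (suc n) + conv (a ∘ suc) b n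

-- triangleSum a b n = Σ_{i + j < n} a i * b j
triangleSum : (ℕ → ℚ) → (ℕ → ℚ) → ℕ → ℚ
triangleSum a b zero    = 0ℚ
triangleSum a b (suc n) = a 0 * partialSum b (suc n) + triangleSum (a ∘ suc) b n

-- Coefficients of the formal derivative of Σ a k xᵏ.
derive : (ℕ → ℚ) → ℕ → ℚ
derive a k = fromℕℚ (suc k) * a (suc k)

recip : ℕ → ℚ
recip k = + 1 / suc k

module _ where
  open ℚ.≤-Reasoning
  open +-*-Solver

  partialSum-cong : ∀ {a b} → (∀ k → a k ≡ b k) → ∀ n → partialSum a n ≡ partialSum b n
  partialSum-cong e zero    = refl
  partialSum-cong e (suc n) = cong₂ _+_ (partialSum-cong e n) (e n)

  expSum≡partialSum : ∀ q n → expSum q n ≡ partialSum (expTerm q) n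
  expSum≡partialSum q zero    = refl
  expSum≡partialSum q (suc n) = cong (λ s → s + expTerm q n) (expSum≡partialSum q n)

  partialSum-suc : ∀ a n → partialSum a (suc n) ≡ a 0 + partialSum (a ∘ suc) n
  partialSum-suc a zero    = ℚ.+-comm 0ℚ (a 0)
  partialSum-suc a (suc n) = trans (cong (λ s → s + a (suc n)) (partialSum-suc a n)) (ℚ.+-assoc (a 0) _ _)

  triangleSum-suc : ∀ a b n → triangleSum a b (suc n) ≡ triangleSum a b n + conv a b n
  triangleSum-suc a b zero    = solve 2 (λ x y → x :* (con 0ℚ :+ y) :+ con 0ℚ := con 0ℚ :+ x :* y) refl (a 0) (b 0)
  triangleSum-suc a b (suc n) = begin-equality
    a 0 * (partialSum b (suc n) + b (suc n)) + triangleSum (a ∘ suc) b (suc n)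
      ≡⟨ cong (λ s → a 0 * (partialSum b (suc n) + b (suc n)) + s) (triangleSum-suc (a ∘ suc) b n) ⟩
    a 0 * (partialSum b (suc n) + b (suc n)) + (triangleSum (a ∘ suc) b n + conv (a ∘ suc) b n)
      ≡⟨ solve 5 (λ x p y t c → x :* (p :+ y) :+ (t :+ c) := x :* p :+ t :+ (x :* y :+ c)) refl
           (a 0) (partialSum b (suc n)) (b (suc n)) (triangleSum (a ∘ suc) b n) (conv (a ∘ suc) b n) ⟩
    triangleSum a b (suc n) + conv a b (suc n) ∎

  conv-congˡ : ∀ {a a′} b → (∀ k → a k ≡ a′ k) → ∀ n → conv a b n ≡ conv a′ b n
  conv-congˡ b e zero    = cong (_* b 0) (e 0)
  conv-congˡ b e (suc n) = cong₂ _+_ (cong (_* b (suc n)) (e 0)) (conv-congˡ b (e ∘ suc) n)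

  conv-congʳ : ∀ a {b b′} → (∀ k → b k ≡ b′ k) → ∀ n → conv a b n ≡ conv a b′ n
  conv-congʳ a e zero    = cong (a 0 *_) (e 0)
  conv-congʳ a e (suc n) = cong₂ _+_ (cong (a 0 *_) (e (suc n))) (conv-congʳ (a ∘ suc) e n)

  conv-+ˡ : ∀ a a′ b n → conv (λ k → a k + a′ k) b n ≡ conv a b n + conv a′ b n
  conv-+ˡ a a′ b zero    = ℚ.*-distribʳ-+ (b 0) (a 0) (a′ 0)
  conv-+ˡ a a′ b (suc n) = trans (cong (λ s → (a 0 + a′ 0) * b (suc n) + s) (conv-+ˡ (a ∘ suc) (a′ ∘ suc) b n))
    (solve 5 (λ x x′ y c c′ → (x :+ x′) :* y :+ (c :+ c′) := (x :* y :+ c) :+ (x′ :* y :+ c′)) refl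
      (a 0) (a′ 0) (b (suc n)) (conv (a ∘ suc) b n) (conv (a′ ∘ suc) b n))

  conv-*ˡ : ∀ q a b n → conv (λ k → q * a k) b n ≡ q * conv a b n
  conv-*ˡ q a b zero    = ℚ.*-assoc q (a 0) (b 0)
  conv-*ˡ q a b (suc n) = trans (cong (λ s → q * a 0 * b (suc n) + s) (conv-*ˡ q (a ∘ suc) b n))
    (solve 4 (λ q x y c → q :* x :* y :+ q :* c := q :* (x :* y :+ c)) refl q (a 0) (b (suc n)) (conv (a ∘ suc) b n))

  conv-*ʳ : ∀ q a b n → conv a (λ k → q * b k) n ≡ q * conv a b n
  conv-*ʳ q a b zero    = solve 3 (λ q x y → x :* (q :* y) := q :* (x :* y)) refl q (a 0) (b 0)
  conv-*ʳ q a b (suc n) = trans (cong (λ s → a 0 * (q * b (suc n)) + s) (conv-*ʳ q (a ∘ suc) b n))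
    (solve 4 (λ q x y c → x :* (q :* y) :+ q :* c := q :* (x :* y :+ c)) refl q (a 0) (b (suc n)) (conv (a ∘ suc) b n))

  -- The Leibniz rule for formal power series, read off at one coefficient. Together with exp (q x)′
  -- = q exp (q x) it gives the addition law of the exponential series without binomial
  -- coefficients.
  derive-conv : ∀ a b n → fromℕℚ (suc n) * conv a b (suc n) ≡ conv (derive a) b n + conv a (derive b) n
  derive-conv a b zero = solve 4 (λ x x′ y y′ → con 1ℚ :* (x :* y′ :+ x′ :* y) := con 1ℚ :* x′ :* y :+ x :* (con 1ℚ :* y′)) refl
    (a 0) (a 1) (b 0) (b 1)
  derive-conv a b (suc n) = begin-equality
    fromℕℚ (2 ℕ.+ n) * (x * y + c)                         ≡⟨ cong (_* (x * y + c)) (fromℕℚ-+ 1 (suc n)) ⟩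
    (1ℚ + N) * (x * y + c)                                 ≡⟨ solve 4 (λ N x y c → (con 1ℚ :+ N) :* (x :* y :+ c) := N :* c :+ c :+ x :* ((con 1ℚ :+ N) :* y)) refl N x y c ⟩
    N * c + c + x * ((1ℚ + N) * y)                         ≡⟨ cong (λ s → s + c + x * ((1ℚ + N) * y)) (derive-conv (a ∘ suc) b n) ⟩
    (d + e) + (a 1 * b (suc n) + f) + x * ((1ℚ + N) * y)   ≡⟨ solve 7 (λ d e x′ y′ f x z → (d :+ e) :+ (x′ :* y′ :+ f) :+ x :* z := con 1ℚ :* x′ :* y′ :+ (d :+ f) :+ (x :* z :+ e)) refl
                                                                d e (a 1) (b (suc n)) f x ((1ℚ + N) * y) ⟩
    1ℚ * a 1 * b (suc n) + (d + f) + (x * ((1ℚ + N) * y) + e)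
      ≡⟨ cong₂ (λ s z → 1ℚ * a 1 * b (suc n) + s + (x * (z * y) + e)) (sym shifted) (sym (fromℕℚ-+ 1 (suc n))) ⟩
    conv (derive a) b (suc n) + conv a (derive b) (suc n)  ∎
    where
    N = fromℕℚ (suc n)
    x = a 0
    y = b (2 ℕ.+ n)
    c = conv (a ∘ suc) b (suc n)
    d = conv (derive (a ∘ suc)) b n
    e = conv (a ∘ suc) (derive b) n
    f = conv (λ k → a (2 ℕ.+ k)) b n
    shifted : conv (derive a ∘ suc) b n ≡ d + f
    shifted = trans (conv-congˡ b (λ k → trans (cong (_* a (2 ℕ.+ k)) (fromℕℚ-+ 1 (suc k)))
        (solve 2 (λ N x → (con 1ℚ :+ N) :* x := N :* x :+ x) refl (fromℕℚ (suc k)) (a (2 ℕ.+ k)))) n)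
      (conv-+ˡ (derive (a ∘ suc)) (λ k → a (2 ℕ.+ k)) b n)

  derive-expTerm : ∀ q k → derive (expTerm q) k ≡ q * expTerm q k
  derive-expTerm q k = trans (ℚ.*-comm (fromℕℚ (suc k)) (expTerm q (suc k))) (expTerm-step q k)

  fromℕℚ-suc-pos : ∀ k → ℚ.Positive (fromℕℚ (suc k))
  fromℕℚ-suc-pos k = positive (ℚ.<-≤-trans (ℚ.positive⁻¹ 1ℚ) (fromℕℚ-mono {1} {suc k} (ℕ.s≤s ℕ.z≤n)))

  *-cancelˡ-≡-pos : ∀ r {p q} → ℚ.Positive r → r * p ≡ r * q → p ≡ q
  *-cancelˡ-≡-pos r 0<r e = ℚ.≤-antisym (ℚ.*-cancelˡ-≤-pos r {{0<r}} (ℚ.≤-reflexive e)) (ℚ.*-cancelˡ-≤-pos r {{0<r}} (ℚ.≤-reflexive (sym e)))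

  -- Both sides satisfy (n + 1) c (n + 1) = (q + r) c n.
  conv-expTerm : ∀ q r n → conv (expTerm q) (expTerm r) n ≡ expTerm (q + r) n
  conv-expTerm q r zero    = refl
  conv-expTerm q r (suc n) = *-cancelˡ-≡-pos (fromℕℚ (suc n)) (fromℕℚ-suc-pos n) (begin-equality
    fromℕℚ (suc n) * conv a b (suc n)            ≡⟨ derive-conv a b n ⟩
    conv (derive a) b n + conv a (derive b) n    ≡⟨ cong₂ _+_ (trans (conv-congˡ b (derive-expTerm q) n) (conv-*ˡ q a b n))
                                                              (trans (conv-congʳ a (derive-expTerm r) n) (conv-*ʳ r a b n)) ⟩
    q * conv a b n + r * conv a b n              ≡⟨ cong (λ c → q * c + r * c) (conv-expTerm q r n) ⟩
    q * t + r * t                                ≡⟨ sym (ℚ.*-distribʳ-+ t q r) ⟩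
    (q + r) * t                                  ≡⟨ sym (derive-expTerm (q + r) n) ⟩
    fromℕℚ (suc n) * expTerm (q + r) (suc n)     ∎)
    where
    a = expTerm q
    b = expTerm r
    t = expTerm (q + r) n

  triangleSum-expTerm : ∀ q r n → triangleSum (expTerm q) (expTerm r) n ≡ expSum (q + r) n
  triangleSum-expTerm q r zero    = refl
  triangleSum-expTerm q r (suc n) = trans (triangleSum-suc (expTerm q) (expTerm r) n)
    (cong₂ _+_ (triangleSum-expTerm q r n) (conv-expTerm q r n))

  partialSum-nonNeg : ∀ {a} → (∀ k → 0ℚ ℚ.≤ a k) → ∀ n → 0ℚ ℚ.≤ partialSum a n
  partialSum-nonNeg h zero    = ℚ.≤-refl
  partialSum-nonNeg h (suc n) = +-nonNeg (partialSum-nonNeg h n) (h n)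

  partialSum-mono : ∀ {a} → (∀ k → 0ℚ ℚ.≤ a k) → ∀ {m n} → m ℕ.≤′ n → partialSum a m ℚ.≤ partialSum a n
  partialSum-mono h ℕ.≤′-refl           = ℚ.≤-refl
  partialSum-mono h (ℕ.≤′-step {n} m≤n) = ℚ.≤-trans (partialSum-mono h m≤n) (p≤p+q (h n))

  partialSum-tail : ∀ {a α} → (∀ k → abs (a k) ℚ.≤ α k) → ∀ {m n} → m ℕ.≤′ n →
    abs (partialSum a n - partialSum a m) ℚ.≤ partialSum α n - partialSum α m
  partialSum-tail {a} {α} h {m} ℕ.≤′-refl = ℚ.≤-reflexive (trans (cong abs (ℚ.+-inverseʳ (partialSum a m))) (sym (ℚ.+-inverseʳ (partialSum α m))))
  partialSum-tail {a} {α} h {m} (ℕ.≤′-step {n} m≤n) = begin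
    abs (A + a n - A′)            ≡⟨ cong abs (solve 3 (λ x y z → x :+ y :- z := (x :- z) :+ y) refl A (a n) A′) ⟩
    abs (A - A′ + a n)            ≤⟨ ℚ.∣p+q∣≤∣p∣+∣q∣ (A - A′) (a n) ⟩
    abs (A - A′) + abs (a n)      ≤⟨ ℚ.+-mono-≤ (partialSum-tail h m≤n) (h n) ⟩
    B - B′ + α n                  ≡⟨ solve 3 (λ x y z → x :- z :+ y := x :+ y :- z) refl B (α n) B′ ⟩
    B + α n - B′                  ∎
    where
    A  = partialSum a n
    A′ = partialSum a m
    B  = partialSum α n
    B′ = partialSum α m

  -- The difference collects the terms a i b j with i < n, j < N and n ≤ i + j, since n ≤ N puts the
  -- whole triangle inside the rectangle. Each of them is dominated by α i β j, hence so is their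
  -- sum.
  square-triangle : ∀ {a α b β} → (∀ k → abs (a k) ℚ.≤ α k) → (∀ k → abs (b k) ℚ.≤ β k) → ∀ {n N} → n ≤ N →
    abs (partialSum a n * partialSum b N - triangleSum a b n) ℚ.≤ partialSum α n * partialSum β N - triangleSum α β n
  square-triangle {b = b} {β} ha hb {zero} {N} _ = ℚ.≤-reflexive (trans
    (cong (λ z → abs (z - 0ℚ)) (ℚ.*-zeroˡ (partialSum b N))) (cong (λ z → z - 0ℚ) (sym (ℚ.*-zeroˡ (partialSum β N)))))
  square-triangle {a} {α} {b} {β} ha hb {suc n} {N} n<N = begin
    abs (partialSum a (suc n) * B - (a 0 * B′ + T))       ≡⟨ cong (λ s → abs (s * B - (a 0 * B′ + T))) (partialSum-suc a n) ⟩
    abs ((a 0 + A) * B - (a 0 * B′ + T))                  ≡⟨ cong abs (rearrange (a 0) A B B′ T) ⟩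
    abs (a 0 * (B - B′) + (A * B - T))                    ≤⟨ ℚ.∣p+q∣≤∣p∣+∣q∣ (a 0 * (B - B′)) (A * B - T) ⟩
    abs (a 0 * (B - B′)) + abs (A * B - T)                ≡⟨ cong (λ s → s + abs (A * B - T)) (ℚ.∣p*q∣≡∣p∣*∣q∣ (a 0) (B - B′)) ⟩
    abs (a 0) * abs (B - B′) + abs (A * B - T)            ≤⟨ ℚ.+-mono-≤ (*-mono (ℚ.0≤∣p∣ (B - B′)) (ℚ.≤-trans (ℚ.0≤∣p∣ (a 0)) (ha 0)) (ha 0) (partialSum-tail hb (ℕ.≤⇒≤′ n<N)))
                                                               (square-triangle (ha ∘ suc) hb (ℕ.<⇒≤ n<N)) ⟩
    α 0 * (C - C′) + (D * C - U)                          ≡⟨ sym (rearrange (α 0) D C C′ U) ⟩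
    (α 0 + D) * C - (α 0 * C′ + U)                        ≡⟨ cong (λ s → s * C - (α 0 * C′ + U)) (sym (partialSum-suc α n)) ⟩
    partialSum α (suc n) * C - (α 0 * C′ + U)             ∎
    where
    A  = partialSum (a ∘ suc) n
    B  = partialSum b N
    B′ = partialSum b (suc n)
    T  = triangleSum (a ∘ suc) b n
    D  = partialSum (α ∘ suc) n
    C  = partialSum β N
    C′ = partialSum β (suc n)
    U  = triangleSum (α ∘ suc) β n
    rearrange : ∀ x A B B′ T → (x + A) * B - (x * B′ + T) ≡ x * (B - B′) + (A * B - T)
    rearrange = solve 5 (λ x A B B′ T → (x :+ A) :* B :- (x :* B′ :+ T) := x :* (B :- B′) :+ (A :* B :- T)) refl

  triangleSum-nonNeg : ∀ {a b} → (∀ k → 0ℚ ℚ.≤ a k) → (∀ k → 0ℚ ℚ.≤ b k) → ∀ n → 0ℚ ℚ.≤ triangleSum a b n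
  triangleSum-nonNeg ha hb zero    = ℚ.≤-refl
  triangleSum-nonNeg ha hb (suc n) = +-nonNeg (*-nonNeg (ha 0) (partialSum-nonNeg hb (suc n))) (triangleSum-nonNeg (ha ∘ suc) hb n)

  -- i < n and j < m imply i + j < n + m, so the rectangle lies in the triangle, and all terms are
  -- nonnegative.
  product≤triangleSum : ∀ {a b} → (∀ k → 0ℚ ℚ.≤ a k) → (∀ k → 0ℚ ℚ.≤ b k) → ∀ n m →
    partialSum a n * partialSum b m ℚ.≤ triangleSum a b (n ℕ.+ m)
  product≤triangleSum {b = b} ha hb zero m = ℚ.≤-trans (ℚ.≤-reflexive (ℚ.*-zeroˡ (partialSum b m))) (triangleSum-nonNeg ha hb m)
  product≤triangleSum {a} {b} ha hb (suc n) m = begin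
    partialSum a (suc n) * B                          ≡⟨ cong (_* B) (partialSum-suc a n) ⟩
    (a 0 + partialSum (a ∘ suc) n) * B                ≡⟨ ℚ.*-distribʳ-+ B (a 0) (partialSum (a ∘ suc) n) ⟩
    a 0 * B + partialSum (a ∘ suc) n * B              ≤⟨ ℚ.+-mono-≤ (ℚ.*-monoˡ-≤-nonNeg (a 0) {{nonNegative (ha 0)}} (partialSum-mono hb (ℕ.≤⇒≤′ (ℕ.m≤n+m m (suc n)))))
                                                           (product≤triangleSum (ha ∘ suc) hb n m) ⟩
    triangleSum a b (suc n ℕ.+ m)                     ∎
    where B = partialSum b m

  -- The error is the corner of the square above the diagonal. Majorants move it to the series at B,
  -- where the square fits into a triangle of side 2 n; what is left is a segment of the series at B
  -- + B.
  expSum-+-error : ∀ {B q r} → (0<B+B : 0ℚ ℚ.< B + B) → 0ℚ ℚ.≤ B → abs q ℚ.≤ B → abs r ℚ.≤ B → ∀ {n} → ExpTail.K 0<B+B ≤ n →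
    abs (expSum q n * expSum r n - expSum (q + r) n) ℚ.≤ expTerm (B + B) n + expTerm (B + B) n
  expSum-+-error {B} {q} {r} 0<B+B 0≤B q≤B r≤B {n} K≤n = begin
    abs (expSum q n * expSum r n - expSum (q + r) n)
      ≡⟨ cong abs (cong₂ _-_ (cong₂ _*_ (expSum≡partialSum q n) (expSum≡partialSum r n)) (sym (triangleSum-expTerm q r n))) ⟩
    abs (partialSum (expTerm q) n * partialSum (expTerm r) n - triangleSum (expTerm q) (expTerm r) n)
      ≤⟨ square-triangle (expTerm-bound 0≤B q≤B) (expTerm-bound 0≤B r≤B) (ℕ.≤-refl {n}) ⟩
    partialSum t n * partialSum t n - triangleSum t t n
      ≤⟨ ℚ.+-monoˡ-≤ (- triangleSum t t n) (product≤triangleSum (expTerm≥0 0≤B) (expTerm≥0 0≤B) n n) ⟩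
    triangleSum t t (n ℕ.+ n) - triangleSum t t n
      ≡⟨ cong₂ _-_ (triangleSum-expTerm B B (n ℕ.+ n)) (triangleSum-expTerm B B n) ⟩
    expSum (B + B) (n ℕ.+ n) - expSum (B + B) n
      ≤⟨ ExpTail.s-tail 0<B+B K≤n (ℕ.≤⇒≤′ (ℕ.m≤m+n n n)) ⟩
    expTerm (B + B) n + expTerm (B + B) n ∎
    where t = expTerm B

  recip-antitone : ∀ {m n} → m ≤ n → recip n ℚ.≤ recip m
  recip-antitone {m} {n} m≤n = begin
    recip n                                    ≡⟨ sym (trans (cong (recip n *_) (recip-fromℕ m)) (ℚ.*-identityʳ (recip n))) ⟩
    recip n * (recip m * fromℕℚ (suc m))       ≤⟨ ℚ.*-monoˡ-≤-nonNeg (recip n) {{nonNegative (recip≥0 n)}}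
                                                    (ℚ.*-monoˡ-≤-nonNeg (recip m) {{nonNegative (recip≥0 m)}} (fromℕℚ-mono (ℕ.s≤s m≤n))) ⟩
    recip n * (recip m * fromℕℚ (suc n))       ≡⟨ solve 3 (λ a b c → a :* (b :* c) := b :* (a :* c)) refl (recip n) (recip m) (fromℕℚ (suc n)) ⟩
    recip m * (recip n * fromℕℚ (suc n))       ≡⟨ trans (cong (recip m *_) (recip-fromℕ n)) (ℚ.*-identityʳ (recip m)) ⟩
    recip m                                    ∎

  -- From the third term on, the terms of the series at |q| ≤ 2 at least halve.
  module CubicTail {q : ℚ} (q≤2 : abs q ℚ.≤ fromℕℚ 2) where
    -- Twice the first omitted term ∣q∣³ / 6: the sum of the geometric series with ratio ½ that
    -- dominates the tail.
    c : ℚ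
    c = abs q * abs q * abs q * (+ 1 / 3)

    bound : ℕ → ℚ
    bound zero    = c
    bound (suc n) = ½ * bound n

    bound-nonNeg : ∀ n → 0ℚ ℚ.≤ bound n
    bound-nonNeg zero    = *-nonNeg (*-nonNeg (*-nonNeg (ℚ.0≤∣p∣ q) (ℚ.0≤∣p∣ q)) (ℚ.0≤∣p∣ q)) (recip≥0 2)
    bound-nonNeg (suc n) = *-nonNeg (recip≥0 1) (bound-nonNeg n)

    ratio≤½ : ∀ n → abs q * recip (3 ℕ.+ n) ℚ.≤ ½
    ratio≤½ n = *-mono {abs q} {fromℕℚ 2} (recip≥0 (3 ℕ.+ n)) (fromℕℚ-nonNeg 2) q≤2 (recip-antitone {3} {3 ℕ.+ n} (ℕ.m≤m+n 3 n))

    abs-expTerm-suc : ∀ k → abs (expTerm q (suc k)) ≡ abs (expTerm q k) * (abs q * recip k)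
    abs-expTerm-suc k = trans (ℚ.∣p*q∣≡∣p∣*∣q∣ (expTerm q k) (q * recip k))
      (cong (abs (expTerm q k) *_) (trans (ℚ.∣p*q∣≡∣p∣*∣q∣ q (recip k)) (cong (abs q *_) (ℚ.0≤p⇒∣p∣≡p (recip≥0 k)))))

    term≤ : ∀ n → abs (expTerm q (3 ℕ.+ n)) ℚ.≤ ½ * bound n
    term≤ zero    = ℚ.≤-reflexive (trans (abs-expTerm-suc 2) (trans (cong (_* (abs q * recip 2)) (trans (abs-expTerm-suc 1) (cong (_* (abs q * recip 1)) (abs-expTerm-suc 0))))
      (solve 1 (λ a → con 1ℚ :* (a :* con 1ℚ) :* (a :* con ½) :* (a :* con (+ 1 / 3)) := con ½ :* (a :* a :* a :* con (+ 1 / 3))) refl (abs q))))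
    term≤ (suc n) = begin
      abs (expTerm q (4 ℕ.+ n))                                 ≡⟨ abs-expTerm-suc (3 ℕ.+ n) ⟩
      abs (expTerm q (3 ℕ.+ n)) * (abs q * recip (3 ℕ.+ n))     ≤⟨ *-mono (*-nonNeg (ℚ.0≤∣p∣ q) (recip≥0 (3 ℕ.+ n))) (*-nonNeg (recip≥0 1) (bound-nonNeg n)) (term≤ n) (ratio≤½ n) ⟩
      ½ * bound n * ½                                           ≡⟨ ℚ.*-comm (½ * bound n) ½ ⟩
      ½ * bound (suc n)                                         ∎

    -- The part of the budget not yet spent, `bound n`, stays on the left: each new term uses at
    -- most half of it, and the other half is `bound (suc n)`.
    tail≤′ : ∀ n → abs (expSum q (3 ℕ.+ n) - expSum q 3) + bound n ℚ.≤ c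
    tail≤′ zero = ℚ.≤-reflexive (trans (cong (λ z → abs z + c) (ℚ.+-inverseʳ (expSum q 3))) (ℚ.+-identityˡ c))
    tail≤′ (suc n) = begin
      abs (E + t - E₃) + ½ * bound n                 ≡⟨ cong (λ z → abs z + ½ * bound n) (solve 3 (λ a b c → a :+ b :- c := (a :- c) :+ b) refl E t E₃) ⟩
      abs (E - E₃ + t) + ½ * bound n                 ≤⟨ ℚ.+-monoˡ-≤ (½ * bound n) (ℚ.∣p+q∣≤∣p∣+∣q∣ (E - E₃) t) ⟩
      abs (E - E₃) + abs t + ½ * bound n             ≤⟨ ℚ.+-monoˡ-≤ (½ * bound n) (ℚ.+-monoʳ-≤ (abs (E - E₃)) (term≤ n)) ⟩
      abs (E - E₃) + ½ * bound n + ½ * bound n       ≡⟨ solve 2 (λ a b → a :+ con ½ :* b :+ con ½ :* b := a :+ b) refl (abs (E - E₃)) (bound n) ⟩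
      abs (E - E₃) + bound n                         ≤⟨ tail≤′ n ⟩
      c                                              ∎
      where
      E  = expSum q (3 ℕ.+ n)
      E₃ = expSum q 3
      t  = expTerm q (3 ℕ.+ n)

    tail≤ : ∀ {n} → 3 ≤ n → abs (expSum q n - (1ℚ + q + ½ * (q * q))) ℚ.≤ c
    tail≤ {suc (suc (suc n))} (ℕ.s≤s (ℕ.s≤s (ℕ.s≤s _))) = begin
      abs (expSum q (3 ℕ.+ n) - (1ℚ + q + ½ * (q * q)))  ≡⟨ cong (λ z → abs (expSum q (3 ℕ.+ n) - z))
                                                              (solve 1 (λ q → con 1ℚ :+ q :+ con ½ :* (q :* q) := con 0ℚ :+ con 1ℚ :+ con 1ℚ :* (q :* con 1ℚ) :+ con 1ℚ :* (q :* con 1ℚ) :* (q :* con ½)) refl q) ⟩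
      abs (expSum q (3 ℕ.+ n) - expSum q 3)              ≤⟨ p≤p+q (bound-nonNeg n) ⟩
      abs (expSum q (3 ℕ.+ n) - expSum q 3) + bound n    ≤⟨ tail≤′ n ⟩
      c                                                  ∎

  abs-square : ∀ q → abs q * abs q ≡ q * q
  abs-square q = trans (sym (ℚ.∣p*q∣≡∣p∣*∣q∣ q q)) (ℚ.0≤p⇒∣p∣≡p (square-nonNeg q))

  -- For negative q the quadratic term must outweigh the tail: q² / 2 ≥ ∣q∣³ / 3 means ∣q∣ ≤ 3/2.
  -- The range reaches below -1 so that it contains the late approximants of every real x ≥ -1.
  1+q≤expSum : ∀ {q} → - (+ 3 / 2) ℚ.≤ q → ∀ {n} → 3 ≤ n → 1ℚ + q ℚ.≤ expSum q n
  1+q≤expSum {q} -3/2≤q {n} 3≤n with ℚ.≤-total 0ℚ q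
  ... | inj₁ 0≤q = begin
    1ℚ + q                        ≡⟨ solve 1 (λ q → con 1ℚ :+ q := con 0ℚ :+ con 1ℚ :+ con 1ℚ :* (q :* con 1ℚ)) refl q ⟩
    partialSum (expTerm q) 2      ≤⟨ partialSum-mono (expTerm≥0 0≤q) (ℕ.≤⇒≤′ (ℕ.≤-trans (ℕ.n≤1+n 2) 3≤n)) ⟩
    partialSum (expTerm q) n      ≡⟨ sym (expSum≡partialSum q n) ⟩
    expSum q n                    ∎
  ... | inj₂ q≤0 = begin
    1ℚ + q                              ≡⟨ solve 2 (λ q a → con 1ℚ :+ q := con 1ℚ :+ q :+ con ½ :* a :- a :* (con (+ 3 / 2) :* con (+ 1 / 3))) refl q (q * q) ⟩
    P - (q * q) * (+ 3 / 2 * (+ 1 / 3)) ≡⟨ cong (λ z → P - z * (+ 3 / 2 * (+ 1 / 3))) (sym (abs-square q)) ⟩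
    P - (a * a) * (+ 3 / 2 * (+ 1 / 3)) ≤⟨ ℚ.+-monoʳ-≤ P (ℚ.neg-antimono-≤ (subst (ℚ._≤ (a * a) * (+ 3 / 2 * (+ 1 / 3))) (sym (ℚ.*-assoc (a * a) a (+ 1 / 3)))
                                             (ℚ.*-monoˡ-≤-nonNeg (a * a) {{nonNegative (square-nonNeg a)}} (ℚ.*-monoʳ-≤-nonNeg (+ 1 / 3) q≤)))) ⟩
    P - c                               ≤⟨ ℚ.+-monoˡ-≤ (- c) (abs-≤ {P} {expSum q n} (ℚ.≤-trans (ℚ.≤-reflexive (abs-minus P (expSum q n))) (tail≤ 3≤n))) ⟩
    expSum q n + c - c                  ≡⟨ solve 2 (λ a b → a :+ b :- b := a) refl (expSum q n) c ⟩
    expSum q n                          ∎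
    where
    q≤ : abs q ℚ.≤ + 3 / 2
    q≤ = ∣p∣≤ (ℚ.≤-trans q≤0 (from-yes (0ℚ ℚ.≤? + 3 / 2))) (ℚ.neg-antimono-≤ -3/2≤q)
    open CubicTail {q} (ℚ.≤-trans q≤ (from-yes (+ 3 / 2 ℚ.≤? fromℕℚ 2)))
    P = 1ℚ + q + ½ * (q * q)
    a = abs q

  -- The tail ∣q∣³ / 3 is at most (2 δ / 3) q². The hypothesis allows 2 δ because approximants of a
  -- real bounded by δ may exceed δ slightly.
  expSum≤ : ∀ {q δ} → abs q ℚ.≤ δ + δ → δ ℚ.≤ 1ℚ → ∀ {n} → 3 ≤ n → expSum q n ℚ.≤ 1ℚ + q + (½ + δ) * (q * q)
  expSum≤ {q} {δ} q≤ δ≤1 {n} 3≤n = begin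
    expSum q n                                     ≤⟨ abs-≤ (tail≤ 3≤n) ⟩
    P + c                                          ≤⟨ ℚ.+-monoʳ-≤ P (ℚ.*-monoʳ-≤-nonNeg (+ 1 / 3) (ℚ.*-monoˡ-≤-nonNeg (a * a) {{nonNegative (square-nonNeg a)}} q≤)) ⟩
    P + (a * a) * (δ + δ) * (+ 1 / 3)              ≡⟨ cong (λ z → P + z * (δ + δ) * (+ 1 / 3)) (abs-square q) ⟩
    P + (q * q) * (δ + δ) * (+ 1 / 3)              ≤⟨ p≤p+q (*-nonNeg (*-nonNeg (square-nonNeg q) 0≤δ) (recip≥0 2)) ⟩
    P + (q * q) * (δ + δ) * (+ 1 / 3) + (q * q) * δ * (+ 1 / 3)
      ≡⟨ solve 2 (λ q δ → con 1ℚ :+ q :+ con ½ :* (q :* q) :+ (q :* q) :* (δ :+ δ) :* con (+ 1 / 3) :+ (q :* q) :* δ :* con (+ 1 / 3)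
           := con 1ℚ :+ q :+ (con ½ :+ δ) :* (q :* q)) refl q δ ⟩
    1ℚ + q + (½ + δ) * (q * q)                     ∎
    where
    open CubicTail {q} (ℚ.≤-trans q≤ (ℚ.+-mono-≤ δ≤1 δ≤1))
    P = 1ℚ + q + ½ * (q * q)
    a = abs q
    0≤δ : 0ℚ ℚ.≤ δ
    0≤δ = ℚ.*-cancelˡ-≤-pos (fromℕℚ 2) (subst₂ ℚ._≤_ refl (solve 1 (λ d → d :+ d := con (fromℕℚ 2) :* d) refl δ) (ℚ.≤-trans (ℚ.0≤∣p∣ q) q≤))

-- Truncations of 2 cosh q against truncations of exponentials.

module _ where
  open ℚ.≤-Reasoning
  open +-*-Solver

  module EvenPart (q : ℚ) where
    term sum : ℕ → ℚ
    term k = expTerm q k + expTerm (- q) k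
    sum n  = expSum q n + expSum (- q) n

    sum-suc : ∀ n → sum (suc n) ≡ sum n + term n
    sum-suc n = solve 4 (λ a b c d → a :+ b :+ (c :+ d) := a :+ c :+ (b :+ d)) refl (expSum q n) (expTerm q n) (expSum (- q) n) (expTerm (- q) n)

    term-2+ : ∀ k → term (2 ℕ.+ k) ≡ q * q * (recip k * recip (suc k)) * term k
    term-2+ k = solve 5 (λ q a b c d → a :* (q :* c) :* (q :* d) :+ b :* (:- q :* c) :* (:- q :* d) := q :* q :* (c :* d) :* (a :+ b)) refl
      q (expTerm q k) (expTerm (- q) k) (recip k) (recip (suc k))

    term-1 : term 1 ≡ 0ℚ
    term-1 = solve 1 (λ q → con 1ℚ :* (q :* con 1ℚ) :+ con 1ℚ :* (:- q :* con 1ℚ) := con 0ℚ) refl q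

    term-nonNeg : ∀ k → 0ℚ ℚ.≤ term k
    term-nonNeg zero          = fromℕℚ-nonNeg 2
    term-nonNeg (suc zero)    = ℚ.≤-reflexive (sym term-1)
    term-nonNeg (suc (suc k)) = subst (0ℚ ℚ.≤_) (sym (term-2+ k))
      (*-nonNeg (*-nonNeg (square-nonNeg q) (*-nonNeg (recip≥0 k) (recip≥0 (suc k)))) (term-nonNeg k))

    sum-mono : ∀ {m n} → m ℕ.≤′ n → sum m ℚ.≤ sum n
    sum-mono ℕ.≤′-refl           = ℚ.≤-refl
    sum-mono (ℕ.≤′-step {n} m≤n) = ℚ.≤-trans (sum-mono m≤n) (ℚ.≤-trans (p≤p+q (term-nonNeg n)) (ℚ.≤-reflexive (sym (sum-suc n))))

    sum-3 : sum 3 ≡ fromℕℚ 2 + q * q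
    sum-3 = solve 1 (λ q → con 0ℚ :+ con 1ℚ :+ con 1ℚ :* (q :* con 1ℚ) :+ con 1ℚ :* (q :* con 1ℚ) :* (q :* con ½)
        :+ (con 0ℚ :+ con 1ℚ :+ con 1ℚ :* (:- q :* con 1ℚ) :+ con 1ℚ :* (:- q :* con 1ℚ) :* (:- q :* con ½)) := con (fromℕℚ 2) :+ q :* q) refl q

    sum≥ : ∀ {n} → 3 ≤ n → fromℕℚ 2 + q * q ℚ.≤ sum n
    sum≥ 3≤n = ℚ.≤-trans (ℚ.≤-reflexive (sym sum-3)) (sum-mono (ℕ.≤⇒≤′ 3≤n))

    double : ℕ → ℕ
    double zero    = zero
    double (suc k) = suc (suc (double k))

    n≤double : ∀ n → n ≤ double n
    n≤double zero    = ℕ.z≤n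
    n≤double (suc n) = ℕ.s≤s (ℕ.m≤n⇒m≤1+n (n≤double n))

    fromℕℚ-double : ∀ n → fromℕℚ (double n) ≡ fromℕℚ 2 * fromℕℚ n
    fromℕℚ-double zero    = refl
    fromℕℚ-double (suc n) = trans (fromℕℚ-+ 2 (double n)) (trans (cong (λ z → fromℕℚ 2 + z) (fromℕℚ-double n))
      (trans (solve 1 (λ z → con (fromℕℚ 2) :+ con (fromℕℚ 2) :* z := con (fromℕℚ 2) :* (con 1ℚ :+ z)) refl (fromℕℚ n))
        (cong (λ z → fromℕℚ 2 * z) (sym (fromℕℚ-+ 1 n)))))

    recip-suc-double : ∀ k → recip (suc (double k)) ≡ ½ * recip k
    recip-suc-double k = begin-equality
      r                                     ≡⟨ sym (trans (cong (r *_) (recip-fromℕ k)) (ℚ.*-identityʳ r)) ⟩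
      r * (recip k * N)                     ≡⟨ solve 3 (λ r c N → r :* (c :* N) := r :* (con (fromℕℚ 2) :* N) :* (con ½ :* c)) refl r (recip k) N ⟩
      r * (fromℕℚ 2 * N) * (½ * recip k)    ≡⟨ cong (_* (½ * recip k)) (trans (cong (r *_) (sym (fromℕℚ-double (suc k)))) (recip-fromℕ (suc (double k)))) ⟩
      1ℚ * (½ * recip k)                    ≡⟨ ℚ.*-identityˡ (½ * recip k) ⟩
      ½ * recip k                           ∎
      where
      r = recip (suc (double k))
      N = fromℕℚ (suc k)

    term-odd : ∀ k → term (suc (double k)) ≡ 0ℚ
    term-odd zero    = term-1
    term-odd (suc k) = trans (term-2+ (suc (double k)))
      (trans (cong (q * q * (recip (suc (double k)) * recip (suc (suc (double k)))) *_) (term-odd k)) (ℚ.*-zeroʳ (q * q * (recip (suc (double k)) * recip (suc (suc (double k)))))))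

    -- Compares cosh q with exp (c q²) termwise, except that the surplus
    -- c² q⁴ / 2 - q⁴ / 24 of the third term has to pay for the deficit
    -- (1/2 - c) q² of the second.
    module _ {c : ℚ} (⅓≤c : + 1 / 3 ℚ.≤ c) (1-2c≤ : 1ℚ - fromℕℚ 2 * c ℚ.≤ + 1 / 36 * (q * q)) where
      w : ℚ
      w = c * (q * q)

      0≤c : 0ℚ ℚ.≤ c
      0≤c = ℚ.≤-trans (recip≥0 2) ⅓≤c

      0≤w : 0ℚ ℚ.≤ w
      0≤w = *-nonNeg 0≤c (square-nonNeg q)

      square-mono : (+ 1 / 9) ℚ.≤ c * c
      square-mono = *-mono {+ 1 / 3} {c} {+ 1 / 3} {c} (recip≥0 2) 0≤c ⅓≤c ⅓≤c

      term-4≤ : term 4 ℚ.≤ fromℕℚ 2 * expTerm w 2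
      term-4≤ = begin
        term 4                         ≡⟨ solve 1 (λ q → con 1ℚ :* (q :* con 1ℚ) :* (q :* con ½) :* (q :* con (+ 1 / 3)) :* (q :* con (+ 1 / 4))
                                            :+ con 1ℚ :* (:- q :* con 1ℚ) :* (:- q :* con ½) :* (:- q :* con (+ 1 / 3)) :* (:- q :* con (+ 1 / 4))
                                            := con (+ 1 / 12) :* ((q :* q) :* (q :* q))) refl q ⟩
        + 1 / 12 * ((q * q) * (q * q)) ≤⟨ ℚ.*-monoʳ-≤-nonNeg ((q * q) * (q * q)) {{nonNegative (square-nonNeg (q * q))}}
                                            (ℚ.≤-trans (from-yes (+ 1 / 12 ℚ.≤? + 1 / 9)) square-mono) ⟩
        c * c * ((q * q) * (q * q))    ≡⟨ solve 2 (λ c q → c :* c :* ((q :* q) :* (q :* q))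
                                            := con (fromℕℚ 2) :* (con 1ℚ :* (c :* (q :* q) :* con 1ℚ) :* (c :* (q :* q) :* con ½))) refl c q ⟩
        fromℕℚ 2 * expTerm w 2         ∎

      -- Successive even terms of cosh have ratio q² / ((k + 1)(k + 2)) with k + 2 = 2 (j + 3) and k
      -- + 1 ≥ 2. This is at most (q² / 4) / (j + 3), below the ratio c q² / (j + 3) of the
      -- exponential series.
      term≤ : ∀ j → term (double (2 ℕ.+ j)) ℚ.≤ fromℕℚ 2 * expTerm w (2 ℕ.+ j)
      term≤ zero    = term-4≤
      term≤ (suc j) = begin
        term (2 ℕ.+ k)                                   ≡⟨ term-2+ k ⟩
        q * q * (recip k * recip (suc k)) * term k       ≤⟨ *-mono (term-nonNeg k) (*-nonNeg 0≤w (recip≥0 (2 ℕ.+ j))) ratio (term≤ j) ⟩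
        w * R * (fromℕℚ 2 * expTerm w (2 ℕ.+ j))         ≡⟨ solve 3 (λ w R t → w :* R :* (con (fromℕℚ 2) :* t) := con (fromℕℚ 2) :* (t :* (w :* R))) refl w R (expTerm w (2 ℕ.+ j)) ⟩
        fromℕℚ 2 * expTerm w (3 ℕ.+ j)                   ∎
        where
        k = double (2 ℕ.+ j)
        R = recip (2 ℕ.+ j)
        ratio : q * q * (recip k * recip (suc k)) ℚ.≤ w * R
        ratio = begin
          q * q * (recip k * recip (suc k))   ≡⟨ cong (λ z → q * q * (recip k * z)) (recip-suc-double (2 ℕ.+ j)) ⟩
          q * q * (recip k * (½ * R))         ≤⟨ ℚ.*-monoˡ-≤-nonNeg (q * q) {{nonNegative (square-nonNeg q)}} (ℚ.*-monoʳ-≤-nonNeg (½ * R)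
                                                   {{nonNegative (*-nonNeg (recip≥0 1) (recip≥0 (2 ℕ.+ j)))}} (recip-antitone {1} {k} (ℕ.s≤s ℕ.z≤n))) ⟩
          q * q * (½ * (½ * R))               ≡⟨ solve 2 (λ s R → s :* (con ½ :* (con ½ :* R)) := con (+ 1 / 4) :* s :* R) refl (q * q) R ⟩
          + 1 / 4 * (q * q) * R               ≤⟨ ℚ.*-monoʳ-≤-nonNeg R {{nonNegative (recip≥0 (2 ℕ.+ j))}} (ℚ.*-monoʳ-≤-nonNeg (q * q) {{nonNegative (square-nonNeg q)}}
                                                   (ℚ.≤-trans (from-yes (+ 1 / 4 ℚ.≤? + 1 / 3)) ⅓≤c)) ⟩
          w * R                               ∎

      -- With s = q² the fourth-order surplus c² s² - s² / 12 is at least (1/9 - 1/12) s² = s² / 36,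
      -- exactly the allowance for (1 - 2 c) s. This is the origin of the constant 1/36.
      sum-6≤ : sum 6 ℚ.≤ fromℕℚ 2 * expSum w 3
      sum-6≤ = begin
        sum 6                                               ≡⟨ trans (sum-suc 5) (cong₂ _+_ (trans (sum-suc 4) (cong₂ _+_ (trans (sum-suc 3) (cong₂ _+_ sum-3 (term-odd 1))) refl)) (term-odd 2)) ⟩
        fromℕℚ 2 + q * q + 0ℚ + term 4 + 0ℚ                 ≡⟨ solve 1 (λ q → con (fromℕℚ 2) :+ q :* q :+ con 0ℚ
                                            :+ (con 1ℚ :* (q :* con 1ℚ) :* (q :* con ½) :* (q :* con (+ 1 / 3)) :* (q :* con (+ 1 / 4))
                                            :+ con 1ℚ :* (:- q :* con 1ℚ) :* (:- q :* con ½) :* (:- q :* con (+ 1 / 3)) :* (:- q :* con (+ 1 / 4))) :+ con 0ℚ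
                                            := con (fromℕℚ 2) :+ q :* q :+ con (+ 1 / 12) :* ((q :* q) :* (q :* q))) refl q ⟩
        fromℕℚ 2 + s + + 1 / 12 * (s * s)                   ≡⟨ solve 2 (λ s c → con (fromℕℚ 2) :+ s :+ con (+ 1 / 12) :* (s :* s)
                                                                 := con (fromℕℚ 2) :+ con (fromℕℚ 2) :* (c :* s) :+ s :* (con 1ℚ :- con (fromℕℚ 2) :* c) :+ con (+ 1 / 12) :* (s :* s)) refl s c ⟩
        fromℕℚ 2 + fromℕℚ 2 * (c * s) + s * (1ℚ - fromℕℚ 2 * c) + + 1 / 12 * (s * s)
                                                            ≤⟨ ℚ.+-monoˡ-≤ (+ 1 / 12 * (s * s)) (ℚ.+-monoʳ-≤ (fromℕℚ 2 + fromℕℚ 2 * (c * s)) (ℚ.*-monoˡ-≤-nonNeg s {{nonNegative (square-nonNeg q)}} 1-2c≤)) ⟩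
        fromℕℚ 2 + fromℕℚ 2 * (c * s) + s * (+ 1 / 36 * s) + + 1 / 12 * (s * s)
                                                            ≡⟨ solve 2 (λ s c → con (fromℕℚ 2) :+ con (fromℕℚ 2) :* (c :* s) :+ s :* (con (+ 1 / 36) :* s) :+ con (+ 1 / 12) :* (s :* s)
                                                                 := con (fromℕℚ 2) :+ con (fromℕℚ 2) :* (c :* s) :+ con (+ 1 / 9) :* (s :* s)) refl s c ⟩
        fromℕℚ 2 + fromℕℚ 2 * (c * s) + + 1 / 9 * (s * s)   ≤⟨ ℚ.+-monoʳ-≤ (fromℕℚ 2 + fromℕℚ 2 * (c * s)) (ℚ.*-monoʳ-≤-nonNeg (s * s) {{nonNegative (square-nonNeg s)}} square-mono) ⟩
        fromℕℚ 2 + fromℕℚ 2 * (c * s) + c * c * (s * s)     ≡⟨ solve 2 (λ c s → con (fromℕℚ 2) :+ con (fromℕℚ 2) :* (c :* s) :+ c :* c :* (s :* s)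
                                                                 := con (fromℕℚ 2) :* (con 0ℚ :+ con 1ℚ :+ con 1ℚ :* (c :* s :* con 1ℚ) :+ con 1ℚ :* (c :* s :* con 1ℚ) :* (c :* s :* con ½))) refl c s ⟩
        fromℕℚ 2 * expSum w 3                               ∎
        where s = q * q

      -- The power 2 i of q in cosh is matched with the power i of `w`, so the truncation of cosh at
      -- twice the length is the partner of the truncation of exp w.
      sum-double≤ : ∀ j → sum (double (3 ℕ.+ j)) ℚ.≤ fromℕℚ 2 * expSum w (3 ℕ.+ j)
      sum-double≤ zero    = sum-6≤
      sum-double≤ (suc j) = begin
        sum (2 ℕ.+ k)                                             ≡⟨ trans (sum-suc (suc k)) (cong₂ _+_ (sum-suc k) (term-odd (3 ℕ.+ j))) ⟩
        sum k + term k + 0ℚ                                       ≡⟨ ℚ.+-identityʳ (sum k + term k) ⟩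
        sum k + term k                                            ≤⟨ ℚ.+-mono-≤ (sum-double≤ j) (term≤ (suc j)) ⟩
        fromℕℚ 2 * expSum w (3 ℕ.+ j) + fromℕℚ 2 * expTerm w (3 ℕ.+ j) ≡⟨ sym (ℚ.*-distribˡ-+ (fromℕℚ 2) (expSum w (3 ℕ.+ j)) (expTerm w (3 ℕ.+ j))) ⟩
        fromℕℚ 2 * expSum w (4 ℕ.+ j)                             ∎
        where k = double (3 ℕ.+ j)

      sum≤ : ∀ {n} → 3 ≤ n → sum n ℚ.≤ fromℕℚ 2 * expSum w n
      sum≤ {suc (suc (suc n))} (ℕ.s≤s (ℕ.s≤s (ℕ.s≤s _))) = ℚ.≤-trans (sum-mono (ℕ.≤⇒≤′ (n≤double (3 ℕ.+ n)))) (sum-double≤ n)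

-- The real exponential

module _ where
  open ℚ.≤-Reasoning

  close⇒≃ : ∀ {x y} → (∀ {ε} → 0ℚ ℚ.< ε → ∃ λ N → ∀ {n} → N ≤ n → abs (seq x n - seq y n) ℚ.≤ ε) → x ≃ y
  close⇒≃ {x} {y} h =
    mk≤ᴿ (λ 0<ε → let N , p = h 0<ε in N , λ N≤n → abs-≤ (p N≤n)) ,
    mk≤ᴿ (λ 0<ε → let N , p = h 0<ε in N , λ {n} N≤n → abs-≤ (ℚ.≤-trans (ℚ.≤-reflexive (abs-minus (seq y n) (seq x n))) (p N≤n)))

  exp-cong-pointwise : ∀ {x y} → (∀ n → seq x n ≡ seq y n) → exp x ≃ exp y
  exp-cong-pointwise e = pointwise⇒≃ λ n → cong (λ q → expSum q n) (e n)

  exp-+ : ∀ x y → exp x *ᴿ exp y ≃ exp (x +ᴿ y)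
  exp-+ x y = close⇒≃ λ {ε} 0<ε →
    let A , 0<A , bx = bounded x
        C , 0<C , by = bounded y
        B = A + C
        0≤B : 0ℚ ℚ.≤ B
        0≤B = +-nonNeg (ℚ.<⇒≤ 0<A) (ℚ.<⇒≤ 0<C)
        A≤B : A ℚ.≤ B
        A≤B = p≤p+q (ℚ.<⇒≤ 0<C)
        C≤B : C ℚ.≤ B
        C≤B = subst (C ℚ.≤_) (ℚ.+-comm C A) (p≤p+q (ℚ.<⇒≤ 0<A))
        0<B+B : 0ℚ ℚ.< B + B
        0<B+B = ℚ.<-≤-trans 0<A (ℚ.≤-trans A≤B (p≤p+q 0≤B))
        N , small = ExpTail.t→0 0<B+B (halfPos 0<ε)
    in ExpTail.K 0<B+B ℕ.⊔ N , λ {n} le → begin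
      abs (expSum (seq x n) n * expSum (seq y n) n - expSum (seq x n + seq y n) n)
        ≤⟨ expSum-+-error 0<B+B 0≤B (ℚ.≤-trans (bx n) A≤B) (ℚ.≤-trans (by n) C≤B) (ℕ.m⊔n≤o⇒m≤o (ExpTail.K 0<B+B) N le) ⟩
      expTerm (B + B) n + expTerm (B + B) n
        ≤⟨ ℚ.+-mono-≤ (small (ℕ.m⊔n≤o⇒n≤o _ N le)) (small (ℕ.m⊔n≤o⇒n≤o _ N le)) ⟩
      ½ * ε + ½ * ε
        ≡⟨ half+half ε ⟩
      ε ∎

  exp-0 : exp 0ᴿ ≃ 1ᴿ
  exp-0 = eventually⇒≤ᴿ (1 , λ le → ℚ.≤-reflexive (expSum-0 le)) , eventually⇒≤ᴿ (1 , λ le → ℚ.≤-reflexive (sym (expSum-0 le)))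
    where
    expTerm-0 : ∀ k → expTerm 0ℚ (suc k) ≡ 0ℚ
    expTerm-0 k = trans (cong (expTerm 0ℚ k *_) (ℚ.*-zeroˡ (recip k))) (ℚ.*-zeroʳ (expTerm 0ℚ k))
    expSum-0 : ∀ {n} → 1 ≤ n → expSum 0ℚ n ≡ 1ℚ
    expSum-0 {suc zero}    _ = refl
    expSum-0 {suc (suc n)} _ = trans (cong₂ _+_ (expSum-0 {suc n} (ℕ.s≤s ℕ.z≤n)) (expTerm-0 n)) (ℚ.+-identityʳ 1ℚ)

  exp-nonNeg : ∀ x → 0ᴿ ≤ᴿ exp x
  exp-nonNeg x = ≤ᴿ-trans (squareᴿ-nonNeg (exp (fromℚ ½ *ᴿ x))) (proj₁ (≃-trans (exp-+ (fromℚ ½ *ᴿ x) (fromℚ ½ *ᴿ x))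
    (exp-cong-pointwise (λ n → half+half (seq x n)))))

  exp≤quadratic : ∀ {x δ} → 0ℚ ℚ.< δ → δ ℚ.≤ 1ℚ → x ≤ᴿ fromℚ δ → (-ᴿ x) ≤ᴿ fromℚ δ →
    exp x ≤ᴿ 1ᴿ +ᴿ x +ᴿ fromℚ (½ + δ) *ᴿ (x *ᴿ x)
  exp≤quadratic {x} {δ} 0<δ δ≤1 x≤ -x≤ =
    let M , p = within x≤ 0<δ
        N , q = within -x≤ 0<δ
    in eventually⇒≤ᴿ (M ℕ.⊔ N ℕ.⊔ 3 , λ le →
      let le′ = ℕ.m⊔n≤o⇒m≤o (M ℕ.⊔ N) 3 le
      in expSum≤ (∣p∣≤ (p (ℕ.m⊔n≤o⇒m≤o M N le′)) (q (ℕ.m⊔n≤o⇒n≤o M N le′))) δ≤1 (ℕ.m⊔n≤o⇒n≤o (M ℕ.⊔ N) 3 le))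

  2+square≤cosh : ∀ x → fromℕ 2 +ᴿ x *ᴿ x ≤ᴿ exp x +ᴿ exp (-ᴿ x)
  2+square≤cosh x = eventually⇒≤ᴿ (3 , λ {n} le → EvenPart.sum≥ (seq x n) le)

  cosh≤exp : ∀ x → exp x +ᴿ exp (-ᴿ x) ≤ᴿ fromℕ 2 *ᴿ exp (fromℚ ½ *ᴿ (x *ᴿ x))
  cosh≤exp x = eventually⇒≤ᴿ (3 , λ {n} le → EvenPart.sum≤ (seq x n) {½} (from-yes (+ 1 / 3 ℚ.≤? ½))
    (*-nonNeg (recip≥0 35) (square-nonNeg (seq x n))) le)

  -- κ bounds x² only in the limit, whereas comparing truncations needs a bound for each late
  -- approximant; half of κ is given up for that.
  cosh<exp : ∀ x {c κ} → + 1 / 3 ℚ.≤ c → 0ℚ ℚ.< κ → 1ℚ - fromℕℚ 2 * c ℚ.≤ + 1 / 36 * (½ * κ) → fromℚ κ ≤ᴿ x *ᴿ x →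
    exp x +ᴿ exp (-ᴿ x) ≤ᴿ fromℕ 2 *ᴿ exp (fromℚ c *ᴿ (x *ᴿ x))
  cosh<exp x {c} {κ} ⅓≤c 0<κ small κ≤ =
    let N , p = within κ≤ (halfPos 0<κ)
    in eventually⇒≤ᴿ (N ℕ.⊔ 3 , λ {n} le → EvenPart.sum≤ (seq x n) {c} ⅓≤c
      (ℚ.≤-trans small (ℚ.*-monoˡ-≤-nonNeg (+ 1 / 36) (begin
        ½ * κ                                   ≡⟨ +-*-Solver.solve 1 (λ k → con ½ :* k := k :+ :- (con ½ :* k)) refl κ ⟩
        κ - ½ * κ                               ≤⟨ ℚ.+-monoˡ-≤ (- (½ * κ)) (p (ℕ.m⊔n≤o⇒m≤o N 3 le)) ⟩
        seq x n * seq x n + ½ * κ - ½ * κ       ≡⟨ solve 2 (λ a b → a :+ b :- b := a) refl (seq x n * seq x n) (½ * κ) ⟩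
        seq x n * seq x n                       ∎)))
      (ℕ.m⊔n≤o⇒n≤o N 3 le))
    where open +-*-Solver

-- Total order, and inequalities for the exponential.

module Classical (em : ExcludedMiddle 0ℓ) where

  module _ where
    open ℚ.≤-Reasoning
    open +-*-Solver

    -- Both sequences are compared at one index, after which each moves by at most ε / 4. If x
    -- exceeds y there by ε / 2, then y ≤ x from that index on, against the assumption; otherwise x
    -- ≤ y + ε from that index on.
    ≤ᴿ-total : ∀ x y → x ≤ᴿ y ⊎ y ≤ᴿ x
    ≤ᴿ-total x y with em {y ≤ᴿ x}
    ... | yes y≤x = inj₂ y≤x
    ... | no  y≰x = inj₁ (mk≤ᴿ approx)
      where
      approx : ∀ {ε} → 0ℚ ℚ.< ε → ∃ λ N → ∀ {n} → N ≤ n → seq x n ℚ.≤ seq y n + ε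
      approx {ε} 0<ε with cauchy x (halfPos (halfPos 0<ε)) | cauchy y (halfPos (halfPos 0<ε))
      ... | M , p | N , q with ℚ.≤-total (seq x (M ℕ.⊔ N)) (seq y (M ℕ.⊔ N) + ½ * ε)
      ... | inj₁ le = M ℕ.⊔ N , λ {n} N≤n → begin
          seq x n                               ≤⟨ abs-≤ (p (ℕ.m⊔n≤o⇒m≤o M N N≤n) (ℕ.m≤m⊔n M N)) ⟩
          seq x (M ℕ.⊔ N) + δ                   ≤⟨ ℚ.+-monoˡ-≤ δ le ⟩
          seq y (M ℕ.⊔ N) + ½ * ε + δ           ≤⟨ ℚ.+-monoˡ-≤ δ (ℚ.+-monoˡ-≤ (½ * ε) (abs-≤ {seq y (M ℕ.⊔ N)} {seq y n} (q (ℕ.m≤n⊔m M N) (ℕ.m⊔n≤o⇒n≤o M N N≤n)))) ⟩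
          seq y n + δ + ½ * ε + δ               ≡⟨ solve 2 (λ y ε → y :+ con ½ :* (con ½ :* ε) :+ con ½ :* ε :+ con ½ :* (con ½ :* ε) := y :+ ε) refl (seq y n) ε ⟩
          seq y n + ε                           ∎
          where δ = ½ * (½ * ε)
      ... | inj₂ ge = contradiction (eventually⇒≤ᴿ (M ℕ.⊔ N , λ {n} N≤n → begin
          seq y n                               ≤⟨ abs-≤ (q (ℕ.m⊔n≤o⇒n≤o M N N≤n) (ℕ.m≤n⊔m M N)) ⟩
          seq y (M ℕ.⊔ N) + δ                   ≡⟨ solve 2 (λ y ε → y :+ con ½ :* (con ½ :* ε) := y :+ con ½ :* ε :- con ½ :* (con ½ :* ε)) refl (seq y (M ℕ.⊔ N)) ε ⟩
          seq y (M ℕ.⊔ N) + ½ * ε - δ           ≤⟨ ℚ.+-monoˡ-≤ (- δ) ge ⟩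
          seq x (M ℕ.⊔ N) - δ                   ≤⟨ ℚ.+-monoˡ-≤ (- δ) (abs-≤ {seq x (M ℕ.⊔ N)} {seq x n} (p (ℕ.m≤m⊔n M N) (ℕ.m⊔n≤o⇒m≤o M N N≤n))) ⟩
          seq x n + δ - δ                       ≡⟨ solve 2 (λ y δ → y :+ δ :- δ := y) refl (seq x n) δ ⟩
          seq x n                               ∎)) y≰x
          where δ = ½ * (½ * ε)

  open ≤ᴿ-Reasoning
  open ℝ-Solver

  1+x≤exp : ∀ x → 1ᴿ +ᴿ x ≤ᴿ exp x
  1+x≤exp x with ≤ᴿ-total x (fromℚ (- 1ℚ))
  ... | inj₁ x≤-1 = begin
    1ᴿ +ᴿ x                  ≤⟨ +ᴿ-mono-≤ ≤ᴿ-refl x≤-1 ⟩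
    1ᴿ +ᴿ fromℚ (- 1ℚ)       ≤⟨ pointwise⇒≤ᴿ (λ _ → ℚ.≤-refl {0ℚ}) ⟩
    0ᴿ                       ≤⟨ exp-nonNeg x ⟩
    exp x                    ∎
  ... | inj₂ -1≤x =
    let N , p = within -1≤x (ℚ.positive⁻¹ ½)
    in eventually⇒≤ᴿ (N ℕ.⊔ 3 , λ {n} le → 1+q≤expSum (lower (seq x n) (p (ℕ.m⊔n≤o⇒m≤o N 3 le))) (ℕ.m⊔n≤o⇒n≤o N 3 le))
    where
    module ℚS = +-*-Solver
    lower : ∀ q → - 1ℚ ℚ.≤ q + ½ → - (+ 3 / 2) ℚ.≤ q
    lower q h = subst (- (+ 3 / 2) ℚ.≤_) (ℚS.solve 1 (λ q → q ℚS.:+ ℚS.con ½ ℚS.:+ ℚS.con (- ½) ℚS.:= q) refl q) (ℚ.+-monoˡ-≤ (- ½) h)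

  exp-mono : ∀ {x y} → x ≤ᴿ y → exp x ≤ᴿ exp y
  exp-mono {x} {y} x≤y = begin
    exp x                              ≃⟨ solve 1 (λ e → e := e :* (con 1ℚ :+ con 0ℚ)) ≃-refl (exp x) ⟩
    exp x *ᴿ (1ᴿ +ᴿ 0ᴿ)                ≤⟨ *ᴿ-monoˡ-≤ (exp-nonNeg x) (≤ᴿ-trans (+ᴿ-mono-≤ ≤ᴿ-refl (≤⇒0≤- x≤y)) (1+x≤exp (y -ᴿ x))) ⟩
    exp x *ᴿ exp (y -ᴿ x)              ≃⟨ exp-+ x (y -ᴿ x) ⟩
    exp (x +ᴿ (y -ᴿ x))                ≃⟨ exp-cong-pointwise (λ n → ℚS.solve 2 (λ x y → x ℚS.:+ (y ℚS.:- x) ℚS.:= y) refl (seq x n) (seq y n)) ⟩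
    exp y                              ∎
    where module ℚS = +-*-Solver

  -- The diagonal definition evaluates partial sums along one particular sequence, so respect for
  -- `≃` is not visible from it. It follows from monotonicity, which rests on 1 + x ≤ exp x.
  exp-cong : ∀ {x y} → x ≃ y → exp x ≃ exp y
  exp-cong (x≤y , y≤x) = exp-mono x≤y , exp-mono y≤x

  exp-neg : ∀ x → exp x *ᴿ exp (-ᴿ x) ≃ 1ᴿ
  exp-neg x = ≃-trans (exp-+ x (-ᴿ x)) (≃-trans (exp-cong (solve 1 (λ x → x :- x := con 0ℚ) ≃-refl x)) exp-0)

  -- For a centred variable the linear term averages to zero, which leaves a Gaussian bound with a
  -- crude constant. For ∣x∣ ≤ 1 the constant 2 dominates the 3/2 of the quadratic bound; outside, x
  -- ≤ 2 x² for x ≥ 1 and 1 ≤ x + 1 + 2 x² for x ≤ -1.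
  exp≤x+exp : ∀ x → exp x ≤ᴿ x +ᴿ exp (fromℕ 2 *ᴿ (x *ᴿ x))
  exp≤x+exp x with ≤ᴿ-total x 1ᴿ | ≤ᴿ-total (fromℚ (- 1ℚ)) x
  ... | inj₁ x≤1 | inj₁ -1≤x = begin
    exp x
      ≤⟨ exp≤quadratic (ℚ.positive⁻¹ 1ℚ) ℚ.≤-refl x≤1 (≤ᴿ-trans (-ᴿ-anti-≤ -1≤x) (pointwise⇒≤ᴿ λ _ → ℚ.≤-refl {1ℚ})) ⟩
    1ᴿ +ᴿ x +ᴿ fromℚ (½ + 1ℚ) *ᴿ (x *ᴿ x)
      ≤⟨ +ᴿ-mono-≤ ≤ᴿ-refl (*ᴿ-monoʳ-≤ (squareᴿ-nonNeg x) (fromℚ-mono (from-yes (½ + 1ℚ ℚ.≤? fromℕℚ 2)))) ⟩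
    1ᴿ +ᴿ x +ᴿ fromℕ 2 *ᴿ (x *ᴿ x)
      ≃⟨ solve 2 (λ x z → con 1ℚ :+ x :+ z := x :+ (con 1ℚ :+ z)) ≃-refl x (fromℕ 2 *ᴿ (x *ᴿ x)) ⟩
    x +ᴿ (1ᴿ +ᴿ fromℕ 2 *ᴿ (x *ᴿ x))
      ≤⟨ +ᴿ-mono-≤ ≤ᴿ-refl (1+x≤exp (fromℕ 2 *ᴿ (x *ᴿ x))) ⟩
    x +ᴿ exp (fromℕ 2 *ᴿ (x *ᴿ x)) ∎
  ... | inj₂ 1≤x | _ = begin
    exp x                             ≤⟨ exp-mono x≤2x² ⟩
    exp (fromℕ 2 *ᴿ (x *ᴿ x))         ≃⟨ solve 1 (λ z → z := con 0ℚ :+ z) ≃-refl (exp (fromℕ 2 *ᴿ (x *ᴿ x))) ⟩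
    0ᴿ +ᴿ exp (fromℕ 2 *ᴿ (x *ᴿ x))   ≤⟨ +ᴿ-mono-≤ 0≤x ≤ᴿ-refl ⟩
    x +ᴿ exp (fromℕ 2 *ᴿ (x *ᴿ x))    ∎
    where
    0≤x : 0ᴿ ≤ᴿ x
    0≤x = ≤ᴿ-trans (fromℚ-mono (from-yes (0ℚ ℚ.≤? 1ℚ))) 1≤x
    x≤2x² : x ≤ᴿ fromℕ 2 *ᴿ (x *ᴿ x)
    x≤2x² = 0≤-⇒≤ (begin
      0ᴿ                                   ≃⟨ solve 0 (con 0ℚ := con 0ℚ :+ con 0ℚ) ≃-refl ⟩
      0ᴿ +ᴿ 0ᴿ                             ≤⟨ +ᴿ-mono-≤ (squareᴿ-nonNeg x) (*ᴿ-nonNeg 0≤x (≤⇒0≤- 1≤x)) ⟩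
      x *ᴿ x +ᴿ x *ᴿ (x -ᴿ 1ᴿ)             ≃⟨ solve 1 (λ x → x :* x :+ x :* (x :- con 1ℚ) := con (fromℕℚ 2) :* (x :* x) :- x) ≃-refl x ⟩
      fromℕ 2 *ᴿ (x *ᴿ x) -ᴿ x             ∎)
  ... | inj₁ _ | inj₂ x≤-1 = begin
    exp x                                  ≤⟨ exp-mono (≤ᴿ-trans x≤-1 (fromℚ-mono (from-yes (- 1ℚ ℚ.≤? 0ℚ)))) ⟩
    exp 0ᴿ                                 ≃⟨ exp-0 ⟩
    1ᴿ                                     ≤⟨ 0≤-⇒≤ 0≤ ⟩
    x +ᴿ (1ᴿ +ᴿ fromℕ 2 *ᴿ (x *ᴿ x))       ≤⟨ +ᴿ-mono-≤ ≤ᴿ-refl (1+x≤exp (fromℕ 2 *ᴿ (x *ᴿ x))) ⟩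
    x +ᴿ exp (fromℕ 2 *ᴿ (x *ᴿ x))         ∎
    where
    0≤ : 0ᴿ ≤ᴿ x +ᴿ (1ᴿ +ᴿ fromℕ 2 *ᴿ (x *ᴿ x)) -ᴿ 1ᴿ
    0≤ = begin
      0ᴿ                                   ≃⟨ solve 0 (con 0ℚ := con 0ℚ :+ con 0ℚ) ≃-refl ⟩
      0ᴿ +ᴿ 0ᴿ                             ≤⟨ +ᴿ-mono-≤ (squareᴿ-nonNeg x) (*ᴿ-nonNeg (≤⇒0≤- (≤ᴿ-trans x≤-1 (fromℚ-mono (from-yes (- 1ℚ ℚ.≤? 0ℚ))))) (≤⇒0≤- x≤-1)) ⟩
      x *ᴿ x +ᴿ (0ᴿ -ᴿ x) *ᴿ (fromℚ (- 1ℚ) -ᴿ x)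
                                           ≃⟨ solve 1 (λ x → x :* x :+ (con 0ℚ :- x) :* (con (- 1ℚ) :- x) := x :+ (con 1ℚ :+ con (fromℕℚ 2) :* (x :* x)) :- con 1ℚ) ≃-refl x ⟩
      x +ᴿ (1ᴿ +ᴿ fromℕ 2 *ᴿ (x *ᴿ x)) -ᴿ 1ᴿ ∎

-- Suprema and infima, by bisection

module Completeness (em : ExcludedMiddle 0ℓ) where
  open Classical em

  module Bisection (P : ℝ → Set) (x₀ : ℝ) (Px₀ : P x₀) (b : ℝ) (x≤b : ∀ x → P x → x ≤ᴿ b) where
    open ℚ.≤-Reasoning
    open +-*-Solver

    IsLower IsUpper : ℚ → Set
    IsLower q = ∃ λ x → P x × fromℚ q ≤ᴿ x
    IsUpper q = ∀ x → P x → x ≤ᴿ fromℚ q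

    record Bracket : Set where
      field
        lo up : ℚ
        lower : IsLower lo
        upper : IsUpper up

    open Bracket

    L U : ℚ
    L = proj₁ (bounded x₀)
    U = proj₁ (bounded b)

    initial : Bracket
    initial = record
      { lo    = - L
      ; up    = U
      ; lower = x₀ , Px₀ , pointwise⇒≤ᴿ (λ n → subst (- L ℚ.≤_) (solve 1 (λ x → :- (:- x) := x) refl (seq x₀ n))
                  (ℚ.neg-antimono-≤ (ℚ.≤-trans (p≤∣p∣ (- seq x₀ n)) (ℚ.≤-trans (ℚ.≤-reflexive (ℚ.∣-p∣≡∣p∣ (seq x₀ n))) (proj₂ (proj₂ (bounded x₀)) n)))))
      ; upper = λ x Px → ≤ᴿ-trans (x≤b x Px) (pointwise⇒≤ᴿ λ n → ℚ.≤-trans (p≤∣p∣ (seq b n)) (proj₂ (proj₂ (bounded b)) n))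
      }

    middle : Bracket → ℚ
    middle B = ½ * (lo B + up B)

    -- When no member of P reaches the middle, totality of the order turns the middle into an upper
    -- bound.
    halve : (B : Bracket) → Dec (IsLower (middle B)) → Bracket
    halve B (yes l) = record { lo = middle B ; up = up B ; lower = l ; upper = upper B }
    halve B (no ¬l) = record { lo = lo B ; up = middle B ; lower = lower B ; upper = upper′ }
      where
      upper′ : IsUpper (middle B)
      upper′ x Px with ≤ᴿ-total x (fromℚ (middle B))
      ... | inj₁ x≤m = x≤m
      ... | inj₂ m≤x = contradiction (x , Px , m≤x) ¬l

    width : Bracket → ℚ
    width B = up B - lo B

    halve-width : ∀ B d → width (halve B d) ≡ ½ * width B
    halve-width B (yes _) = solve 2 (λ l u → u :- con ½ :* (l :+ u) := con ½ :* (u :- l)) refl (lo B) (up B)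
    halve-width B (no _)  = solve 2 (λ l u → con ½ :* (l :+ u) :- l := con ½ :* (u :- l)) refl (lo B) (up B)

    bracket : ℕ → Bracket
    bracket zero    = initial
    bracket (suc n) = halve (bracket n) em

    ℓ u g : ℕ → ℚ
    ℓ = lo ∘ bracket
    u = up ∘ bracket
    g = width ∘ bracket

    g-nonNeg : ∀ n → 0ℚ ℚ.≤ g n
    g-nonNeg zero    = subst (0ℚ ℚ.≤_) (solve 2 (λ l u → u :+ l := u :- (:- l)) refl L U)
      (+-nonNeg (ℚ.<⇒≤ (proj₁ (proj₂ (bounded b)))) (ℚ.<⇒≤ (proj₁ (proj₂ (bounded x₀)))))
    g-nonNeg (suc n) = subst (0ℚ ℚ.≤_) (sym (halve-width (bracket n) em)) (*-nonNeg (recip≥0 1) (g-nonNeg n))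

    -- The width is in fact g 0 / 2ⁿ. The weaker decay g 0 / (n + 1) is enough for the Archimedean
    -- argument and follows from (n + 2) / 2 ≤ n + 1.
    g-decay : ∀ n → g n * fromℕℚ (suc n) ℚ.≤ g 0
    g-decay zero    = ℚ.≤-reflexive (ℚ.*-identityʳ (g 0))
    g-decay (suc n) = begin
      g (suc n) * fromℕℚ (2 ℕ.+ n)          ≡⟨ cong₂ _*_ (halve-width (bracket n) em) (fromℕℚ-+ 1 (suc n)) ⟩
      ½ * g n * (1ℚ + N)                    ≤⟨ ℚ.*-monoˡ-≤-nonNeg (½ * g n) {{nonNegative (*-nonNeg (recip≥0 1) (g-nonNeg n))}}
                                                 (ℚ.+-monoˡ-≤ N (fromℕℚ-mono {1} {suc n} (ℕ.s≤s ℕ.z≤n))) ⟩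
      ½ * g n * (N + N)                     ≡⟨ solve 2 (λ g N → con ½ :* g :* (N :+ N) := g :* N) refl (g n) N ⟩
      g n * N                               ≤⟨ g-decay n ⟩
      g 0                                   ∎
      where N = fromℕℚ (suc n)

    g→0 : ∀ {ε} → 0ℚ ℚ.< ε → ∃ λ N → g N ℚ.≤ ε
    g→0 {ε} 0<ε with shrink 0<ε (ℚ.positive⁻¹ 1ℚ)
    ... | ε⁻¹ , 0<ε⁻¹ , eq with archimedean (ε⁻¹ * g 0)
    ... | N , le = N , ℚ.*-cancelʳ-≤-pos (fromℕℚ (suc N)) {{fromℕℚ-suc-pos N}} (begin
      g N * fromℕℚ (suc N)      ≤⟨ g-decay N ⟩
      g 0                       ≡⟨ sym (ℚ.*-identityˡ (g 0)) ⟩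
      1ℚ * g 0                  ≡⟨ cong (_* g 0) (sym eq) ⟩
      ε * ε⁻¹ * g 0             ≡⟨ ℚ.*-assoc ε ε⁻¹ (g 0) ⟩
      ε * (ε⁻¹ * g 0)           ≤⟨ ℚ.*-monoˡ-≤-nonNeg ε {{nonNegative (ℚ.<⇒≤ 0<ε)}} (ℚ.≤-trans le (fromℕℚ-mono (ℕ.n≤1+n N))) ⟩
      ε * fromℕℚ (suc N)        ∎)

    ℓ≤u : ∀ n → ℓ n ℚ.≤ u n
    ℓ≤u n = subst₂ ℚ._≤_ (ℚ.+-identityʳ (ℓ n)) (solve 2 (λ l u → l :+ (u :- l) := u) refl (ℓ n) (u n)) (ℚ.+-monoʳ-≤ (ℓ n) (g-nonNeg n))

    half-double : ∀ x → ½ * (x + x) ≡ x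
    half-double = solve 1 (λ x → con ½ :* (x :+ x) := x) refl

    halve-nested : ∀ B d → lo B ℚ.≤ up B → lo B ℚ.≤ lo (halve B d) × up (halve B d) ℚ.≤ up B
    halve-nested B (yes _) l≤u = subst (ℚ._≤ middle B) (half-double (lo B)) (ℚ.*-monoˡ-≤-nonNeg ½ (ℚ.+-monoʳ-≤ (lo B) l≤u)) , ℚ.≤-refl
    halve-nested B (no _)  l≤u = ℚ.≤-refl , subst (middle B ℚ.≤_) (half-double (up B)) (ℚ.*-monoˡ-≤-nonNeg ½ (ℚ.+-monoˡ-≤ (up B) l≤u))

    nested : ∀ {m n} → m ℕ.≤′ n → ℓ m ℚ.≤ ℓ n × u n ℚ.≤ u m
    nested ℕ.≤′-refl           = ℚ.≤-refl , ℚ.≤-refl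
    nested (ℕ.≤′-step {n} m≤n) =
      let p , q = nested m≤n
          p′ , q′ = halve-nested (bracket n) em (ℓ≤u n)
      in ℚ.≤-trans p p′ , ℚ.≤-trans q′ q

    u-diff : ∀ {N m n} → N ≤ m → N ≤ n → u m - u n ℚ.≤ g N
    u-diff {N} {m} {n} N≤m N≤n = ℚ.+-mono-≤ (proj₂ (nested (ℕ.≤⇒≤′ N≤m)))
      (ℚ.neg-antimono-≤ (ℚ.≤-trans (proj₁ (nested (ℕ.≤⇒≤′ N≤n))) (ℓ≤u n)))

    u-cauchy : IsCauchy u
    u-cauchy {ε} 0<ε = let N , gN≤ε = g→0 0<ε in
      N , λ {m} {n} N≤m N≤n → ∣p∣≤ (ℚ.≤-trans (u-diff N≤m N≤n) gN≤ε)
        (ℚ.≤-trans (ℚ.≤-reflexive (solve 2 (λ a b → :- (a :- b) := b :- a) refl (u m) (u n))) (ℚ.≤-trans (u-diff N≤n N≤m) gN≤ε))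

    supremum : ℝ
    supremum = mkℝ u u-cauchy

    supremum-upper : ∀ x → P x → x ≤ᴿ supremum
    supremum-upper x Px = mk≤ᴿ λ {ε} 0<ε →
      let N , p = u-cauchy (halfPos 0<ε)
          M , q = within (upper (bracket N) x Px) (halfPos 0<ε)
      in M ℕ.⊔ N , λ {n} le → begin
        seq x n                       ≤⟨ q (ℕ.m⊔n≤o⇒m≤o M N le) ⟩
        u N + ½ * ε                   ≤⟨ ℚ.+-monoˡ-≤ (½ * ε) (abs-≤ {u N} {u n} (p ℕ.≤-refl (ℕ.m⊔n≤o⇒n≤o M N le))) ⟩
        u n + ½ * ε + ½ * ε           ≡⟨ trans (ℚ.+-assoc (u n) (½ * ε) (½ * ε)) (cong (λ z → u n + z) (half+half ε)) ⟩
        u n + ε                       ∎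

    supremum-least : ∀ y → (∀ x → P x → x ≤ᴿ y) → supremum ≤ᴿ y
    supremum-least y h = mk≤ᴿ λ {ε} 0<ε →
      let N , gN≤ε   = g→0 (halfPos 0<ε)
          x , Px , p = lower (bracket N)
          M , q      = within (≤ᴿ-trans p (h x Px)) (halfPos 0<ε)
      in M ℕ.⊔ N , λ {n} le → begin
        u n                           ≤⟨ proj₂ (nested (ℕ.≤⇒≤′ (ℕ.m⊔n≤o⇒n≤o M N le))) ⟩
        u N                           ≡⟨ solve 2 (λ l u → u := l :+ (u :- l)) refl (ℓ N) (u N) ⟩
        ℓ N + g N                     ≤⟨ ℚ.+-mono-≤ (q (ℕ.m⊔n≤o⇒m≤o M N le)) gN≤ε ⟩
        seq y n + ½ * ε + ½ * ε       ≡⟨ trans (ℚ.+-assoc (seq y n) (½ * ε) (½ * ε)) (cong (λ z → seq y n + z) (half+half ε)) ⟩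
        seq y n + ε                   ∎

  abstract
    supremum-exists : ∀ {P} → ∃ P → ∀ b → (∀ x → P x → x ≤ᴿ b) → ∃ (IsSupremum P)
    supremum-exists {P} (x₀ , Px₀) b h = supremum , supremum-upper , supremum-least
      where open Bisection P x₀ Px₀ b h

  -- The infimum is the supremum of the lower bounds. Members of P come within ε of it, since
  -- otherwise `s +ᴿ fromℚ ε` would be a lower bound above it.
  infimum-exists : ∀ {P} → ∃ P → ∀ b → (∀ x → P x → b ≤ᴿ x) →
    ∃ λ s → b ≤ᴿ s × (∀ x → P x → s ≤ᴿ x) × (∀ {ε} → 0ℚ ℚ.< ε → ∃ λ x → P x × x ≤ᴿ s +ᴿ fromℚ ε)
  infimum-exists {P} (x₀ , Px₀) b h
    with supremum-exists {λ l → ∀ x → P x → l ≤ᴿ x} (b , h) x₀ (λ l lb → lb x₀ Px₀)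
  ... | s , upper , least = s , upper b h , (λ x Px → least x (λ l lb → lb x Px)) , approx
    where
    open +-*-Solver
    not-lower : ∀ {ε} → 0ℚ ℚ.< ε → ¬ (s +ᴿ fromℚ ε ≤ᴿ s)
    not-lower {ε} 0<ε s+ε≤s =
      let N , q = within s+ε≤s (halfPos 0<ε)
      in ℚ.<-irrefl refl (ℚ.<-≤-trans (halfPos 0<ε) (subst₂ ℚ._≤_
        (solve 2 (λ s ε → s :+ ε :- (s :+ con ½ :* ε) := con ½ :* ε) refl (seq s N) ε) (ℚ.+-inverseʳ (seq s N + ½ * ε))
        (ℚ.+-monoˡ-≤ (- (seq s N + ½ * ε)) (q ℕ.≤-refl))))
    approx : ∀ {ε} → 0ℚ ℚ.< ε → ∃ λ x → P x × x ≤ᴿ s +ᴿ fromℚ ε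
    approx {ε} 0<ε with em {∃ λ x → P x × x ≤ᴿ s +ᴿ fromℚ ε}
    ... | yes p = p
    ... | no ¬p = contradiction (upper (s +ᴿ fromℚ ε) lower) (not-lower 0<ε)
      where
      lower : ∀ x → P x → s +ᴿ fromℚ ε ≤ᴿ x
      lower x Px with ≤ᴿ-total (s +ᴿ fromℚ ε) x
      ... | inj₁ le = le
      ... | inj₂ ge = contradiction (x , Px , ge) ¬p

-- Finite averages

inverse : ∀ m .{{_ : ℕ.NonZero m}} → ℚ
inverse m = + 1 / m

opaque
  avg : ∀ {m} .{{_ : ℕ.NonZero m}} → (Fin m → ℝ) → ℝ
  avg {m} f = fromℚ (inverse m) *ᴿ sumᴿ f

module _ where
  open ℚ.≤-Reasoning
  open +-*-Solver

  inverse-nonNeg : ∀ m .{{_ : ℕ.NonZero m}} → 0ℚ ℚ.≤ inverse m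
  inverse-nonNeg (suc m) = recip≥0 m

  inverse-fromℕℚ : ∀ m .{{_ : ℕ.NonZero m}} → inverse m * fromℕℚ m ≡ 1ℚ
  inverse-fromℕℚ (suc m) = recip-fromℕ m

  fromℕℚ-* : ∀ m n → fromℕℚ (m ℕ.* n) ≡ fromℕℚ m * fromℕℚ n
  fromℕℚ-* zero    n = sym (ℚ.*-zeroˡ (fromℕℚ n))
  fromℕℚ-* (suc m) n = begin-equality
    fromℕℚ (n ℕ.+ m ℕ.* n)                ≡⟨ trans (fromℕℚ-+ n (m ℕ.* n)) (cong (λ z → fromℕℚ n + z) (fromℕℚ-* m n)) ⟩
    fromℕℚ n + fromℕℚ m * fromℕℚ n        ≡⟨ solve 2 (λ m n → n :+ m :* n := (con 1ℚ :+ m) :* n) refl (fromℕℚ m) (fromℕℚ n) ⟩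
    (1ℚ + fromℕℚ m) * fromℕℚ n            ≡⟨ cong (_* fromℕℚ n) (sym (fromℕℚ-+ 1 m)) ⟩
    fromℕℚ (suc m) * fromℕℚ n             ∎

  inverse-* : ∀ m n .{{_ : ℕ.NonZero m}} .{{_ : ℕ.NonZero n}} .{{_ : ℕ.NonZero (m ℕ.* n)}} →
    inverse (m ℕ.* n) ≡ inverse m * inverse n
  inverse-* m n = begin-equality
    i                                       ≡⟨ solve 1 (λ i → i := i :* (con 1ℚ :* con 1ℚ)) refl i ⟩
    i * (1ℚ * 1ℚ)                           ≡⟨ sym (cong₂ (λ y z → i * (y * z)) (inverse-fromℕℚ m) (inverse-fromℕℚ n)) ⟩
    i * ((j * M) * (k * N))                 ≡⟨ solve 5 (λ i j k M N → i :* ((j :* M) :* (k :* N)) := i :* (M :* N) :* (j :* k)) refl i j k M N ⟩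
    i * (M * N) * (j * k)                   ≡⟨ cong (_* (j * k)) (trans (cong (i *_) (sym (fromℕℚ-* m n))) (inverse-fromℕℚ (m ℕ.* n))) ⟩
    1ℚ * (j * k)                            ≡⟨ ℚ.*-identityˡ (j * k) ⟩
    j * k                                   ∎
    where
    i = inverse (m ℕ.* n)
    j = inverse m
    k = inverse n
    M = fromℕℚ m
    N = fromℕℚ n

module _ where
  open ≤ᴿ-Reasoning
  open ℝ-Solver

  sumᴿ-mono : ∀ {m} {f g : Fin m → ℝ} → (∀ i → f i ≤ᴿ g i) → sumᴿ f ≤ᴿ sumᴿ g
  sumᴿ-mono {zero}  h = ≤ᴿ-refl
  sumᴿ-mono {suc m} h = +ᴿ-mono-≤ (h zero) (sumᴿ-mono (h ∘ suc))

  sumᴿ-cong : ∀ {m} {f g : Fin m → ℝ} → (∀ i → f i ≃ g i) → sumᴿ f ≃ sumᴿ g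
  sumᴿ-cong h = sumᴿ-mono (proj₁ ∘ h) , sumᴿ-mono (proj₂ ∘ h)

  sumᴿ-+ : ∀ {m} (f g : Fin m → ℝ) → sumᴿ (λ i → f i +ᴿ g i) ≃ sumᴿ f +ᴿ sumᴿ g
  sumᴿ-+ {zero}  f g = solve 0 (con 0ℚ := con 0ℚ :+ con 0ℚ) ≃-refl
  sumᴿ-+ {suc m} f g = ≃-trans (+ᴿ-cong ≃-refl (sumᴿ-+ (f ∘ suc) (g ∘ suc)))
    (solve 4 (λ a b c d → (a :+ b) :+ (c :+ d) := (a :+ c) :+ (b :+ d)) ≃-refl (f zero) (g zero) (sumᴿ (f ∘ suc)) (sumᴿ (g ∘ suc)))

  sumᴿ-*ˡ : ∀ {m} c (f : Fin m → ℝ) → sumᴿ (λ i → c *ᴿ f i) ≃ c *ᴿ sumᴿ f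
  sumᴿ-*ˡ {zero}  c f = solve 1 (λ c → con 0ℚ := c :* con 0ℚ) ≃-refl c
  sumᴿ-*ˡ {suc m} c f = ≃-trans (+ᴿ-cong ≃-refl (sumᴿ-*ˡ c (f ∘ suc)))
    (solve 3 (λ c a b → c :* a :+ c :* b := c :* (a :+ b)) ≃-refl c (f zero) (sumᴿ (f ∘ suc)))

  sumᴿ-const : ∀ m c → sumᴿ {m} (λ _ → c) ≃ fromℕ m *ᴿ c
  sumᴿ-const zero    c = solve 1 (λ c → con 0ℚ := con 0ℚ :* c) ≃-refl c
  sumᴿ-const (suc m) c = ≃-trans (+ᴿ-cong ≃-refl (sumᴿ-const m c))
    (≃-trans (solve 2 (λ m c → c :+ m :* c := (con 1ℚ :+ m) :* c) ≃-refl (fromℕ m) c)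
      (*ᴿ-cong (pointwise⇒≃ λ _ → sym (fromℕℚ-+ 1 m)) ≃-refl))

  sumᴿ-↑ : ∀ m n (f : Fin (m ℕ.+ n) → ℝ) → sumᴿ f ≃ sumᴿ (λ i → f (i Fin.↑ˡ n)) +ᴿ sumᴿ (λ j → f (m Fin.↑ʳ j))
  sumᴿ-↑ zero    n f = solve 1 (λ s → s := con 0ℚ :+ s) ≃-refl (sumᴿ f)
  sumᴿ-↑ (suc m) n f = ≃-trans (+ᴿ-cong ≃-refl (sumᴿ-↑ m n (f ∘ suc)))
    (solve 3 (λ a b c → a :+ (b :+ c) := (a :+ b) :+ c) ≃-refl (f zero) (sumᴿ (λ i → f (suc i Fin.↑ˡ n))) (sumᴿ (λ j → f (suc m Fin.↑ʳ j))))

  remQuot-↑ˡ : ∀ m n (j : Fin n) → Fin.remQuot {suc m} n (j Fin.↑ˡ (m ℕ.* n)) ≡ (zero , j)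
  remQuot-↑ˡ m n j rewrite Fin.splitAt-↑ˡ n j (m ℕ.* n) = refl

  remQuot-↑ʳ : ∀ m n (k : Fin (m ℕ.* n)) →
    Fin.remQuot {suc m} n (n Fin.↑ʳ k) ≡ (suc (proj₁ (Fin.remQuot {m} n k)) , proj₂ (Fin.remQuot {m} n k))
  remQuot-↑ʳ m n k rewrite Fin.splitAt-↑ʳ n (m ℕ.* n) k = refl

  ≡⇒≃ : ∀ {x y} → x ≡ y → x ≃ y
  ≡⇒≃ refl = ≃-refl

  sumᴿ-× : ∀ m n (f : Fin m × Fin n → ℝ) → sumᴿ (λ k → f (Fin.remQuot {m} n k)) ≃ sumᴿ (λ i → sumᴿ (λ j → f (i , j)))
  sumᴿ-× zero    n f = ≃-refl
  sumᴿ-× (suc m) n f = ≃-trans (sumᴿ-↑ n (m ℕ.* n) (λ k → f (Fin.remQuot {suc m} n k)))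
    (+ᴿ-cong (sumᴿ-cong (λ j → ≡⇒≃ (cong f (remQuot-↑ˡ m n j))))
      (≃-trans (sumᴿ-cong (λ k → ≡⇒≃ (cong f (remQuot-↑ʳ m n k)))) (sumᴿ-× m n (λ (i , j) → f (suc i , j)))))

  module _ {m} .{{_ : ℕ.NonZero m}} where
    opaque
      unfolding avg

      avg≡ : (f : Fin m → ℝ) → avg f ≡ fromℚ (inverse m) *ᴿ sumᴿ f
      avg≡ f = refl

      avg-mono : {f g : Fin m → ℝ} → (∀ i → f i ≤ᴿ g i) → avg f ≤ᴿ avg g
      avg-mono h = *ᴿ-monoˡ-≤ (fromℚ-mono (inverse-nonNeg m)) (sumᴿ-mono h)

      avg-+ : (f g : Fin m → ℝ) → avg (λ i → f i +ᴿ g i) ≃ avg f +ᴿ avg g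
      avg-+ f g = ≃-trans (*ᴿ-congˡ (fromℚ (inverse m)) (sumᴿ-+ f g))
        (solve 3 (λ r a b → r :* (a :+ b) := r :* a :+ r :* b) ≃-refl (fromℚ (inverse m)) (sumᴿ f) (sumᴿ g))

      avg-*ˡ : ∀ c (f : Fin m → ℝ) → avg (λ i → c *ᴿ f i) ≃ c *ᴿ avg f
      avg-*ˡ c f = ≃-trans (*ᴿ-congˡ (fromℚ (inverse m)) (sumᴿ-*ˡ c f))
        (solve 3 (λ r c a → r :* (c :* a) := c :* (r :* a)) ≃-refl (fromℚ (inverse m)) c (sumᴿ f))

      avg-const : ∀ c → avg {m} (λ _ → c) ≃ c
      avg-const c = ≃-trans (*ᴿ-congˡ (fromℚ (inverse m)) (sumᴿ-const m c))
        (≃-trans (solve 3 (λ r n c → r :* (n :* c) := r :* n :* c) ≃-refl (fromℚ (inverse m)) (fromℕ m) c)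
          (≃-trans (*ᴿ-cong (pointwise⇒≃ λ _ → inverse-fromℕℚ m) ≃-refl) (solve 1 (λ c → con 1ℚ :* c := c) ≃-refl c)))

    avg-cong : {f g : Fin m → ℝ} → (∀ i → f i ≃ g i) → avg f ≃ avg g
    avg-cong h = avg-mono (proj₁ ∘ h) , avg-mono (proj₂ ∘ h)

    avg-≤const : {f : Fin m → ℝ} → ∀ c → (∀ i → f i ≤ᴿ c) → avg f ≤ᴿ c
    avg-≤const c h = ≤ᴿ-trans (avg-mono h) (proj₁ (avg-const c))

    avg-const≤ : {f : Fin m → ℝ} → ∀ c → (∀ i → c ≤ᴿ f i) → c ≤ᴿ avg f
    avg-const≤ c h = ≤ᴿ-trans (proj₂ (avg-const c)) (avg-mono h)

    avg-centered : (f : Fin m → ℝ) → avg (λ i → f i -ᴿ avg f) ≃ 0ᴿ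
    avg-centered f = ≃-trans (avg-+ f (λ _ → -ᴿ avg f)) (≃-trans (+ᴿ-cong ≃-refl (avg-const (-ᴿ avg f)))
      (solve 1 (λ a → a :- a := con 0ℚ) ≃-refl (avg f)))

  opaque
    unfolding avg

    avg-× : ∀ {m n} .{{_ : ℕ.NonZero m}} .{{_ : ℕ.NonZero n}} .{{_ : ℕ.NonZero (m ℕ.* n)}} (f : Fin m × Fin n → ℝ) →
      avg (λ k → f (Fin.remQuot {m} n k)) ≃ avg (λ i → avg (λ j → f (i , j)))
    avg-× {m} {n} f = ≃-trans (*ᴿ-cong (pointwise⇒≃ λ _ → inverse-* m n) (sumᴿ-× m n f))
      (≃-trans (solve 3 (λ i j s → i :* j :* s := i :* (j :* s)) ≃-refl (fromℚ (inverse m)) (fromℚ (inverse n)) (sumᴿ (λ i → sumᴿ (λ j → f (i , j)))))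
        (*ᴿ-congˡ (fromℚ (inverse m)) (≃-sym (sumᴿ-*ˡ (fromℚ (inverse n)) (λ i → sumᴿ (λ j → f (i , j)))))))

-- Subgaussian families

centered : ∀ {m} .{{_ : ℕ.NonZero m}} → (Fin m → ℝ) → Fin m → ℝ
centered X i = X i -ᴿ avg X

variance : ∀ {m} .{{_ : ℕ.NonZero m}} → (Fin m → ℝ) → ℝ
variance X = avg (λ i → centered X i *ᴿ centered X i)

mgf : ∀ {m} .{{_ : ℕ.NonZero m}} → (Fin m → ℝ) → ℝ → ℝ
mgf X t = avg (λ i → exp (t *ᴿ centered X i))

Subgaussian : ∀ {m} .{{_ : ℕ.NonZero m}} → (Fin m → ℝ) → ℝ → Set
Subgaussian X s = 0ᴿ ≤ᴿ s × (∀ t → mgf X t ≤ᴿ exp (s *ᴿ (t *ᴿ t) *ᴿ fromℚ ½))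

HasRange : ∀ {m} → (Fin m → ℝ) → ℝ → Set
HasRange X D = ∀ i j → X i ≤ᴿ X j +ᴿ D

-- Variance proxies: a crude one, the least one, and the variance below them.

module SubgaussianBounds (em : ExcludedMiddle 0ℓ) where
  open Classical em
  open Completeness em
  open ≤ᴿ-Reasoning
  open ℝ-Solver

  *ᴿ-cancel-≤ : ∀ {p q x y} → 0ℚ ℚ.≤ q → p * q ≡ 1ℚ → fromℚ p *ᴿ x ≤ᴿ fromℚ p *ᴿ y → x ≤ᴿ y
  *ᴿ-cancel-≤ {p} {q} {x} {y} 0≤q e h = begin
    x                             ≃⟨ ≃-sym (unit x) ⟩
    fromℚ q *ᴿ (fromℚ p *ᴿ x)     ≤⟨ *ᴿ-monoˡ-≤ (fromℚ-mono 0≤q) h ⟩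
    fromℚ q *ᴿ (fromℚ p *ᴿ y)     ≃⟨ unit y ⟩
    y                             ∎
    where
    unit : ∀ z → fromℚ q *ᴿ (fromℚ p *ᴿ z) ≃ z
    unit z = ≃-trans (solve 3 (λ p q z → q :* (p :* z) := p :* q :* z) ≃-refl (fromℚ p) (fromℚ q) z)
      (≃-trans (*ᴿ-cong (pointwise⇒≃ λ _ → e) ≃-refl) (solve 1 (λ z → con 1ℚ :* z := z) ≃-refl z))

  halfSquare-nonNeg : ∀ t → 0ᴿ ≤ᴿ t *ᴿ t *ᴿ fromℚ ½
  halfSquare-nonNeg t = *ᴿ-nonNeg (squareᴿ-nonNeg t) (fromℚ-mono (recip≥0 1))

  -- exp (- ε t² / 2) ≥ 1 - ε t² / 2 bounds exp (s t² / 2) from below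
  -- in terms of exp ((s + ε) t² / 2).
  exp-absorb : ∀ {M} s t ε → 0ᴿ ≤ᴿ M → M ≤ᴿ exp ((s +ᴿ ε) *ᴿ (t *ᴿ t) *ᴿ fromℚ ½) →
    M ≤ᴿ exp (s *ᴿ (t *ᴿ t) *ᴿ fromℚ ½) +ᴿ ε *ᴿ (M *ᴿ (t *ᴿ t *ᴿ fromℚ ½))
  exp-absorb {M} s t ε 0≤M M≤ = rearrange M _ ε _ (begin
    M *ᴿ (1ᴿ +ᴿ (-ᴿ (ε *ᴿ (t *ᴿ t *ᴿ fromℚ ½))))
      ≤⟨ *ᴿ-monoˡ-≤ 0≤M (1+x≤exp (-ᴿ (ε *ᴿ (t *ᴿ t *ᴿ fromℚ ½)))) ⟩
    M *ᴿ exp (-ᴿ (ε *ᴿ (t *ᴿ t *ᴿ fromℚ ½)))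
      ≤⟨ *ᴿ-monoʳ-≤ (exp-nonNeg (-ᴿ (ε *ᴿ (t *ᴿ t *ᴿ fromℚ ½)))) M≤ ⟩
    exp ((s +ᴿ ε) *ᴿ (t *ᴿ t) *ᴿ fromℚ ½) *ᴿ exp (-ᴿ (ε *ᴿ (t *ᴿ t *ᴿ fromℚ ½)))
      ≃⟨ exp-+ ((s +ᴿ ε) *ᴿ (t *ᴿ t) *ᴿ fromℚ ½) (-ᴿ (ε *ᴿ (t *ᴿ t *ᴿ fromℚ ½))) ⟩
    exp ((s +ᴿ ε) *ᴿ (t *ᴿ t) *ᴿ fromℚ ½ +ᴿ (-ᴿ (ε *ᴿ (t *ᴿ t *ᴿ fromℚ ½))))
      ≃⟨ exp-cong (solve 4 (λ s t ε r → (s :+ ε) :* (t :* t) :* r :+ :- (ε :* (t :* t :* r)) := s :* (t :* t) :* r) ≃-refl s t ε (fromℚ ½)) ⟩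
    exp (s *ᴿ (t *ᴿ t) *ᴿ fromℚ ½) ∎)
    where
    rearrange : ∀ M e ε q → M *ᴿ (1ᴿ +ᴿ (-ᴿ (ε *ᴿ q))) ≤ᴿ e → M ≤ᴿ e +ᴿ ε *ᴿ (M *ᴿ q)
    rearrange M e ε q h = begin
      M                                                   ≃⟨ solve 3 (λ M ε q → M := M :* (con 1ℚ :+ (:- (ε :* q))) :+ ε :* (M :* q)) ≃-refl M ε q ⟩
      M *ᴿ (1ᴿ +ᴿ (-ᴿ (ε *ᴿ q))) +ᴿ ε *ᴿ (M *ᴿ q)         ≤⟨ +ᴿ-mono-≤ h ≤ᴿ-refl ⟩
      e +ᴿ ε *ᴿ (M *ᴿ q)                                  ∎

  -- (2 + t² V) exp (- s t² / 2) ≤ 2, with the exponential bounded below by 1 - s t² / 2; then t → 0.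
  ≤-of-second-order : ∀ {V s} → 0ᴿ ≤ᴿ s → 0ᴿ ≤ᴿ V → (∀ t → fromℕ 2 +ᴿ t *ᴿ t *ᴿ V ≤ᴿ fromℕ 2 *ᴿ exp (s *ᴿ (t *ᴿ t) *ᴿ fromℚ ½)) → V ≤ᴿ s
  ≤-of-second-order {V} {s} 0≤s 0≤V h = ≤ᴿ-of-approx (V *ᴿ s *ᴿ fromℚ ½) approx
    where
      0≤Vs : 0ᴿ ≤ᴿ V *ᴿ s *ᴿ fromℚ ½
      0≤Vs = *ᴿ-nonNeg (*ᴿ-nonNeg 0≤V 0≤s) (fromℚ-mono (recip≥0 1))

      multiplied : ∀ a w → 0ᴿ ≤ᴿ a → fromℕ 2 +ᴿ a ≤ᴿ fromℕ 2 *ᴿ exp w → (fromℕ 2 +ᴿ a) *ᴿ (1ᴿ +ᴿ (-ᴿ w)) ≤ᴿ fromℕ 2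
      multiplied a w 0≤a le = begin
        (fromℕ 2 +ᴿ a) *ᴿ (1ᴿ +ᴿ (-ᴿ w))          ≤⟨ *ᴿ-monoˡ-≤ (≤ᴿ-trans (proj₁ (solve 0 (con 0ℚ := con 0ℚ :+ con 0ℚ) ≃-refl))
                                                       (+ᴿ-mono-≤ (fromℚ-mono (fromℕℚ-nonNeg 2)) 0≤a)) (1+x≤exp (-ᴿ w)) ⟩
        (fromℕ 2 +ᴿ a) *ᴿ exp (-ᴿ w)              ≤⟨ *ᴿ-monoʳ-≤ (exp-nonNeg (-ᴿ w)) le ⟩
        fromℕ 2 *ᴿ exp w *ᴿ exp (-ᴿ w)            ≃⟨ solve 3 (λ a b c → a :* b :* c := a :* (b :* c)) ≃-refl (fromℕ 2) (exp w) (exp (-ᴿ w)) ⟩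
        fromℕ 2 *ᴿ (exp w *ᴿ exp (-ᴿ w))          ≃⟨ *ᴿ-congˡ (fromℕ 2) (exp-neg w) ⟩
        fromℕ 2 *ᴿ 1ᴿ                             ≃⟨ solve 1 (λ a → a :* con 1ℚ := a) ≃-refl (fromℕ 2) ⟩
        fromℕ 2                                   ∎

      scaled : ∀ t → t *ᴿ t *ᴿ V ≤ᴿ t *ᴿ t *ᴿ (s +ᴿ t *ᴿ t *ᴿ (V *ᴿ s *ᴿ fromℚ ½))
      scaled t = 0≤-⇒≤ (begin
        0ᴿ
          ≤⟨ ≤⇒0≤- (multiplied (t *ᴿ t *ᴿ V) (s *ᴿ (t *ᴿ t) *ᴿ fromℚ ½) (*ᴿ-nonNeg (squareᴿ-nonNeg t) 0≤V) (h t)) ⟩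
        fromℕ 2 -ᴿ (fromℕ 2 +ᴿ t *ᴿ t *ᴿ V) *ᴿ (1ᴿ +ᴿ (-ᴿ (s *ᴿ (t *ᴿ t) *ᴿ fromℚ ½)))
          ≃⟨ solve 3 (λ t V s → con (fromℕℚ 2) :- (con (fromℕℚ 2) :+ t :* t :* V) :* (con 1ℚ :+ (:- (s :* (t :* t) :* con ½)))
               := t :* t :* (s :+ t :* t :* (V :* s :* con ½)) :- t :* t :* V) ≃-refl t V s ⟩
        t *ᴿ t *ᴿ (s +ᴿ t *ᴿ t *ᴿ (V *ᴿ s *ᴿ fromℚ ½)) -ᴿ t *ᴿ t *ᴿ V ∎)

      approx : ∀ {ε} → 0ℚ ℚ.< ε → V ≤ᴿ s +ᴿ fromℚ ε *ᴿ (V *ᴿ s *ᴿ fromℚ ½)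
      approx {ε} 0<ε =
        -- The choice t = τ = ε / (1 + ε) gives τ² ≤ (1 + ε) τ = ε and avoids a square root of ε.
        let τ , 0<τ , eτ = shrink 0<1+ε 0<ε
            r , 0<r , er = shrink 0<τ (ℚ.positive⁻¹ 1ℚ)
        in ≤ᴿ-trans (*ᴿ-cancel-≤ {τ * τ} {r * r} {V} {s +ᴿ fromℚ (τ * τ) *ᴿ (V *ᴿ s *ᴿ fromℚ ½)} (square-nonNeg r) (inverse² τ r er)
             (≤ᴿ-trans (pointwise⇒≤ᴿ λ _ → ℚ.≤-refl) (≤ᴿ-trans (scaled (fromℚ τ)) (pointwise⇒≤ᴿ λ _ → ℚ.≤-refl))))
             (+ᴿ-mono-≤ ≤ᴿ-refl (*ᴿ-monoʳ-≤ 0≤Vs (pointwise⇒≤ᴿ λ _ → τ²≤ε τ 0<τ eτ)))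
        where
        module ℚS = +-*-Solver
        0<1+ε : 0ℚ ℚ.< 1ℚ + ε
        0<1+ε = ℚ.<-trans 0<ε (subst (ℚ._< 1ℚ + ε) (ℚ.+-identityˡ ε) (ℚ.+-monoˡ-< ε (ℚ.positive⁻¹ 1ℚ)))
        inverse² : ∀ τ r → τ * r ≡ 1ℚ → (τ * τ) * (r * r) ≡ 1ℚ
        inverse² τ r e = trans (ℚS.solve 2 (λ τ r → (τ ℚS.:* τ) ℚS.:* (r ℚS.:* r) ℚS.:= (τ ℚS.:* r) ℚS.:* (τ ℚS.:* r)) refl τ r)
          (trans (cong₂ _*_ e e) (ℚ.*-identityˡ 1ℚ))
        τ²≤ε : ∀ τ → 0ℚ ℚ.< τ → (1ℚ + ε) * τ ≡ ε → τ * τ ℚ.≤ ε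
        τ²≤ε τ 0<τ e = ℚ.≤-trans (ℚ.*-monoʳ-≤-nonNeg τ {{nonNegative 0≤τ}} τ≤1+ε) (ℚ.≤-reflexive e)
          where
          0≤τ = ℚ.<⇒≤ 0<τ
          τ≤1+ε : τ ℚ.≤ 1ℚ + ε
          τ≤1+ε = ℚ.≤-trans (p≤p+q (+-nonNeg (*-nonNeg (ℚ.<⇒≤ 0<ε) 0≤τ) (recip≥0 0)))
            (ℚ.≤-reflexive (trans (ℚS.solve 2 (λ τ ε → τ ℚS.:+ (ε ℚS.:* τ ℚS.:+ ℚS.con 1ℚ) ℚS.:= ℚS.con 1ℚ ℚS.:+ (ℚS.con 1ℚ ℚS.:+ ε) ℚS.:* τ) refl τ ε)
              (cong (λ z → 1ℚ + z) e)))

  module _ {m} .{{_ : ℕ.NonZero m}} (X : Fin m → ℝ) where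
    variance-nonNeg : 0ᴿ ≤ᴿ variance X
    variance-nonNeg = avg-const≤ 0ᴿ (λ i → squareᴿ-nonNeg (centered X i))

    Subgaussian-mono : ∀ {s s′} → s ≤ᴿ s′ → Subgaussian X s → Subgaussian X s′
    Subgaussian-mono {s} {s′} s≤s′ (0≤s , h) = ≤ᴿ-trans 0≤s s≤s′ , λ t → ≤ᴿ-trans (h t) (exp-mono (begin
      s *ᴿ (t *ᴿ t) *ᴿ fromℚ ½      ≃⟨ solve 3 (λ s t r → s :* (t :* t) :* r := s :* (t :* t :* r)) ≃-refl s t (fromℚ ½) ⟩
      s *ᴿ (t *ᴿ t *ᴿ fromℚ ½)      ≤⟨ *ᴿ-monoʳ-≤ (halfSquare-nonNeg t) s≤s′ ⟩
      s′ *ᴿ (t *ᴿ t *ᴿ fromℚ ½)     ≃⟨ solve 3 (λ s t r → s :* (t :* t :* r) := s :* (t :* t) :* r) ≃-refl s′ t (fromℚ ½) ⟩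
      s′ *ᴿ (t *ᴿ t) *ᴿ fromℚ ½     ∎))

    mgf-cong : ∀ {t u} → t ≃ u → mgf X t ≃ mgf X u
    mgf-cong e = avg-cong (λ i → exp-cong (*ᴿ-cong e ≃-refl))

    centered≤ : ∀ {D} → HasRange X D → ∀ i → centered X i ≤ᴿ D
    centered≤ {D} range i = 0≤-⇒≤ (begin
      0ᴿ                              ≤⟨ ≤⇒0≤- (≤ᴿ-trans (avg-const≤ (X i) (range i)) (proj₁ (≃-trans (avg-+ X (λ _ → D)) (+ᴿ-cong ≃-refl (avg-const D))))) ⟩
      avg X +ᴿ D -ᴿ X i               ≃⟨ solve 3 (λ a d x → a :+ d :- x := d :- (x :- a)) ≃-refl (avg X) D (X i) ⟩
      D -ᴿ centered X i                        ∎)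

    -centered≤ : ∀ {D} → HasRange X D → ∀ i → (-ᴿ centered X i) ≤ᴿ D
    -centered≤ {D} range i = 0≤-⇒≤ (begin
      0ᴿ                              ≤⟨ ≤⇒0≤- (avg-≤const (X i +ᴿ D) (λ j → range j i)) ⟩
      X i +ᴿ D -ᴿ avg X               ≃⟨ solve 3 (λ a d x → x :+ d :- a := d :- (:- (x :- a))) ≃-refl (avg X) D (X i) ⟩
      D -ᴿ (-ᴿ centered X i)                   ∎)

    -- Centred values Y lie in [-D, D], so the exponent 2 (t Y)² in `exp≤x+exp` is at most 4 D² t² /
    -- 2. The constant is far from sharp; its purpose is to make the set of proxies nonempty.
    Subgaussian-of-range : ∀ {D} → HasRange X D → Subgaussian X (fromℕ 4 *ᴿ (D *ᴿ D))
    Subgaussian-of-range {D} range = *ᴿ-nonNeg (fromℚ-mono (fromℕℚ-nonNeg 4)) (squareᴿ-nonNeg D) , λ t → begin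
      mgf X t
        ≤⟨ avg-mono (λ i → ≤ᴿ-trans (exp≤x+exp (t *ᴿ centered X i)) (+ᴿ-mono-≤ ≤ᴿ-refl (exp-mono (bound t i)))) ⟩
      avg (λ i → t *ᴿ centered X i +ᴿ exp (s *ᴿ (t *ᴿ t) *ᴿ fromℚ ½))
        ≃⟨ ≃-trans (avg-+ (λ i → t *ᴿ centered X i) (λ _ → exp (s *ᴿ (t *ᴿ t) *ᴿ fromℚ ½)))
             (+ᴿ-cong (≃-trans (avg-*ˡ t (centered X)) (*ᴿ-congˡ t (avg-centered X))) (avg-const (exp (s *ᴿ (t *ᴿ t) *ᴿ fromℚ ½)))) ⟩
      t *ᴿ 0ᴿ +ᴿ exp (s *ᴿ (t *ᴿ t) *ᴿ fromℚ ½)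
        ≃⟨ solve 2 (λ t e → t :* con 0ℚ :+ e := e) ≃-refl t (exp (s *ᴿ (t *ᴿ t) *ᴿ fromℚ ½)) ⟩
      exp (s *ᴿ (t *ᴿ t) *ᴿ fromℚ ½) ∎
      where
      s = fromℕ 4 *ᴿ (D *ᴿ D)
      bound : ∀ t i → fromℕ 2 *ᴿ (t *ᴿ centered X i *ᴿ (t *ᴿ centered X i)) ≤ᴿ s *ᴿ (t *ᴿ t) *ᴿ fromℚ ½
      bound t i = 0≤-⇒≤ (begin
        0ᴿ
          ≤⟨ *ᴿ-nonNeg (*ᴿ-nonNeg (fromℚ-mono (fromℕℚ-nonNeg 2)) (squareᴿ-nonNeg t)) (*ᴿ-nonNeg (≤⇒0≤- (centered≤ range i)) (≤⇒0≤- (-centered≤ range i))) ⟩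
        fromℕ 2 *ᴿ (t *ᴿ t) *ᴿ ((D -ᴿ centered X i) *ᴿ (D -ᴿ (-ᴿ centered X i)))
          ≃⟨ solve 3 (λ t y d → con (fromℕℚ 2) :* (t :* t) :* ((d :- y) :* (d :- (:- y)))
               := con (fromℕℚ 4) :* (d :* d) :* (t :* t) :* con ½ :- con (fromℕℚ 2) :* (t :* y :* (t :* y))) ≃-refl t (centered X i) D ⟩
        s *ᴿ (t *ᴿ t) *ᴿ fromℚ ½ -ᴿ fromℕ 2 *ᴿ (t *ᴿ centered X i *ᴿ (t *ᴿ centered X i)) ∎)

    mgf-nonNeg : ∀ t → 0ᴿ ≤ᴿ mgf X t
    mgf-nonNeg t = avg-const≤ 0ᴿ (λ i → exp-nonNeg (t *ᴿ centered X i))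

    -- The infimum s is attained: s + ε is a proxy for every ε > 0, and `exp-absorb` turns its bound
    -- into the bound for s up to an error linear in ε.
    optimal-exists : ∃ (Subgaussian X) → ∃ (IsLeast (Subgaussian X))
    optimal-exists sg with infimum-exists sg 0ᴿ (λ s → proj₁)
    ... | s , 0≤s , s-lower , approx = s , (0≤s , λ t → ≤ᴿ-of-approx (mgf X t *ᴿ (t *ᴿ t *ᴿ fromℚ ½)) (closed t)) , s-lower
      where
      closed : ∀ t {ε} → 0ℚ ℚ.< ε → mgf X t ≤ᴿ exp (s *ᴿ (t *ᴿ t) *ᴿ fromℚ ½) +ᴿ fromℚ ε *ᴿ (mgf X t *ᴿ (t *ᴿ t *ᴿ fromℚ ½))
      closed t {ε} 0<ε with approx 0<ε
      ... | s′ , sg′ , s′≤ = exp-absorb s t (fromℚ ε) (mgf-nonNeg t) (proj₂ (Subgaussian-mono s′≤ sg′) t)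

    -- Adding the bounds at t and -t removes the odd part, and cosh x ≥ 1 + x² / 2 holds for every
    -- x, so the estimate is free of remainder terms.
    second-order : ∀ {s} → Subgaussian X s → ∀ t → fromℕ 2 +ᴿ t *ᴿ t *ᴿ variance X ≤ᴿ fromℕ 2 *ᴿ exp (s *ᴿ (t *ᴿ t) *ᴿ fromℚ ½)
    second-order {s} (0≤s , h) t = begin
      fromℕ 2 +ᴿ t *ᴿ t *ᴿ variance X
        ≃⟨ ≃-sym (≃-trans (avg-+ (λ _ → fromℕ 2) (λ i → t *ᴿ t *ᴿ (centered X i *ᴿ centered X i)))
             (+ᴿ-cong (avg-const (fromℕ 2)) (avg-*ˡ (t *ᴿ t) (λ i → centered X i *ᴿ centered X i)))) ⟩
      avg (λ i → fromℕ 2 +ᴿ t *ᴿ t *ᴿ (centered X i *ᴿ centered X i))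
        ≤⟨ avg-mono (λ i → pair t (centered X i)) ⟩
      avg (λ i → exp (t *ᴿ centered X i) +ᴿ exp ((-ᴿ t) *ᴿ centered X i))
        ≃⟨ avg-+ (λ i → exp (t *ᴿ centered X i)) (λ i → exp ((-ᴿ t) *ᴿ centered X i)) ⟩
      mgf X t +ᴿ mgf X (-ᴿ t)
        ≤⟨ +ᴿ-mono-≤ (h t) (h (-ᴿ t)) ⟩
      exp (s *ᴿ (t *ᴿ t) *ᴿ fromℚ ½) +ᴿ exp (s *ᴿ ((-ᴿ t) *ᴿ (-ᴿ t)) *ᴿ fromℚ ½)
        ≃⟨ +ᴿ-cong ≃-refl (exp-cong (solve 3 (λ s t r → s :* (:- t :* :- t) :* r := s :* (t :* t) :* r) ≃-refl s t (fromℚ ½))) ⟩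
      exp (s *ᴿ (t *ᴿ t) *ᴿ fromℚ ½) +ᴿ exp (s *ᴿ (t *ᴿ t) *ᴿ fromℚ ½)
        ≃⟨ solve 1 (λ e → e :+ e := con (fromℕℚ 2) :* e) ≃-refl (exp (s *ᴿ (t *ᴿ t) *ᴿ fromℚ ½)) ⟩
      fromℕ 2 *ᴿ exp (s *ᴿ (t *ᴿ t) *ᴿ fromℚ ½) ∎
      where
      pair : ∀ t y → fromℕ 2 +ᴿ t *ᴿ t *ᴿ (y *ᴿ y) ≤ᴿ exp (t *ᴿ y) +ᴿ exp ((-ᴿ t) *ᴿ y)
      pair t y = begin
        fromℕ 2 +ᴿ t *ᴿ t *ᴿ (y *ᴿ y)            ≃⟨ solve 2 (λ t y → con (fromℕℚ 2) :+ t :* t :* (y :* y) := con (fromℕℚ 2) :+ t :* y :* (t :* y)) ≃-refl t y ⟩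
        fromℕ 2 +ᴿ t *ᴿ y *ᴿ (t *ᴿ y)            ≤⟨ 2+square≤cosh (t *ᴿ y) ⟩
        exp (t *ᴿ y) +ᴿ exp (-ᴿ (t *ᴿ y))        ≤⟨ +ᴿ-mono-≤ ≤ᴿ-refl (exp-mono (proj₁ (solve 2 (λ t y → :- (t :* y) := :- t :* y) ≃-refl t y))) ⟩
        exp (t *ᴿ y) +ᴿ exp ((-ᴿ t) *ᴿ y)        ∎

    variance≤ : ∀ {s} → Subgaussian X s → variance X ≤ᴿ s
    variance≤ {s} sg = ≤-of-second-order (proj₁ sg) variance-nonNeg (second-order sg)

-- Hoeffding's lemma by doubling the argument of the moment generating function.

module Hoeffding (em : ExcludedMiddle 0ℓ) where
  open Classical em
  open SubgaussianBounds em
  open ≤ᴿ-Reasoning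
  open ℝ-Solver

  argmin : ∀ {m} (X : Fin (suc m) → ℝ) → ∃ λ i → ∀ j → X i ≤ᴿ X j
  argmin {zero}  X = zero , λ { zero → ≤ᴿ-refl }
  argmin {suc m} X with argmin (X ∘ suc)
  ... | i , h with ≤ᴿ-total (X zero) (X (suc i))
  ... | inj₁ le = zero , λ { zero → ≤ᴿ-refl ; (suc j) → ≤ᴿ-trans le (h j) }
  ... | inj₂ ge = suc i , λ { zero → ge ; (suc j) → h j }

  -- A value within ½ of zero, scaled by 2 y and exponentiated, lies between exp y and exp (- y).
  exp-between : ∀ y d → d ≤ᴿ fromℚ ½ → (-ᴿ d) ≤ᴿ fromℚ ½ →
    exp (fromℕ 2 *ᴿ y *ᴿ d) *ᴿ exp (fromℕ 2 *ᴿ y *ᴿ d) +ᴿ 1ᴿ ≤ᴿ (exp y +ᴿ exp (-ᴿ y)) *ᴿ exp (fromℕ 2 *ᴿ y *ᴿ d)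
  exp-between y d d≤½ -d≤½ = ≤ᴿ-trans (+ᴿ-mono-≤ ≤ᴿ-refl (proj₂ (exp-neg y))) (product-form (exp y) (exp (-ᴿ y)) (exp (fromℕ 2 *ᴿ y *ᴿ d)) sign)
    where
    product-form : ∀ a b z → 0ᴿ ≤ᴿ (a -ᴿ z) *ᴿ (z -ᴿ b) → z *ᴿ z +ᴿ a *ᴿ b ≤ᴿ (a +ᴿ b) *ᴿ z
    product-form a b z h = 0≤-⇒≤ (≤ᴿ-trans h (proj₁ (solve 3 (λ a b z → (a :- z) :* (z :- b) := (a :+ b) :* z :- (z :* z :+ a :* b)) ≃-refl a b z)))

    upper : ∀ y d → 0ᴿ ≤ᴿ y → d ≤ᴿ fromℚ ½ → fromℕ 2 *ᴿ y *ᴿ d ≤ᴿ y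
    upper y d 0≤y d≤½ = ≤ᴿ-trans (*ᴿ-monoˡ-≤ (*ᴿ-nonNeg (fromℚ-mono (fromℕℚ-nonNeg 2)) 0≤y) d≤½)
      (proj₁ (solve 1 (λ y → con (fromℕℚ 2) :* y :* con ½ := y) ≃-refl y))

    lower : ∀ y d → 0ᴿ ≤ᴿ y → (-ᴿ d) ≤ᴿ fromℚ ½ → (-ᴿ y) ≤ᴿ fromℕ 2 *ᴿ y *ᴿ d
    lower y d 0≤y -d≤½ = ≤ᴿ-trans (-ᴿ-anti-≤ (upper y (-ᴿ d) 0≤y -d≤½)) (proj₁ (solve 2 (λ y d → :- (con (fromℕℚ 2) :* y :* (:- d)) := con (fromℕℚ 2) :* y :* d) ≃-refl y d))

    negate : ∀ y → (-ᴿ (-ᴿ y)) ≃ y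
    negate = solve 1 (λ y → :- (:- y) := y) ≃-refl

    flip : ∀ y d → fromℕ 2 *ᴿ (-ᴿ y) *ᴿ (-ᴿ d) ≃ fromℕ 2 *ᴿ y *ᴿ d
    flip = solve 2 (λ y d → con (fromℕℚ 2) :* (:- y) :* (:- d) := con (fromℕℚ 2) :* y :* d) ≃-refl

    -flip : ∀ a b z → 0ᴿ ≤ᴿ (z -ᴿ a) *ᴿ (b -ᴿ z) → 0ᴿ ≤ᴿ (a -ᴿ z) *ᴿ (z -ᴿ b)
    -flip a b z h = ≤ᴿ-trans h (proj₁ (solve 3 (λ a b z → (z :- a) :* (b :- z) := (a :- z) :* (z :- b)) ≃-refl a b z))

    sign : 0ᴿ ≤ᴿ (exp y -ᴿ exp (fromℕ 2 *ᴿ y *ᴿ d)) *ᴿ (exp (fromℕ 2 *ᴿ y *ᴿ d) -ᴿ exp (-ᴿ y))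
    sign with ≤ᴿ-total 0ᴿ y
    ... | inj₁ 0≤y = *ᴿ-nonNeg (≤⇒0≤- (exp-mono (upper y d 0≤y d≤½))) (≤⇒0≤- (exp-mono (lower y d 0≤y -d≤½)))
    ... | inj₂ y≤0 = -flip (exp y) (exp (-ᴿ y)) (exp (fromℕ 2 *ᴿ y *ᴿ d))
      (*ᴿ-nonNeg (≤⇒0≤- (exp-mono (≤ᴿ-trans (proj₂ (negate y)) (≤ᴿ-trans (lower (-ᴿ y) (-ᴿ d) 0≤-y (≤ᴿ-trans (proj₁ (negate d)) d≤½)) (proj₁ (flip y d))))))
                 (≤⇒0≤- (exp-mono (≤ᴿ-trans (proj₂ (flip y d)) (upper (-ᴿ y) (-ᴿ d) 0≤-y -d≤½)))))
      where
      0≤-y : 0ᴿ ≤ᴿ -ᴿ y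
      0≤-y = ≤ᴿ-trans (proj₁ (solve 0 (con 0ℚ := :- con 0ℚ) ≃-refl)) (-ᴿ-anti-≤ y≤0)

  shift : ∀ y c μ → exp (fromℕ 2 *ᴿ y *ᴿ c) ≃ exp (fromℕ 2 *ᴿ y *ᴿ μ) *ᴿ exp (fromℕ 2 *ᴿ y *ᴿ (c -ᴿ μ))
  shift y c μ = ≃-trans (exp-cong (solve 3 (λ y c μ → con (fromℕℚ 2) :* y :* c := con (fromℕℚ 2) :* y :* μ :+ con (fromℕℚ 2) :* y :* (c :- μ)) ≃-refl y c μ))
    (≃-sym (exp-+ (fromℕ 2 *ᴿ y *ᴿ μ) (fromℕ 2 *ᴿ y *ᴿ (c -ᴿ μ))))

  shift² : ∀ y c μ → exp (fromℕ 4 *ᴿ y *ᴿ c) ≃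
    exp (fromℕ 2 *ᴿ y *ᴿ μ) *ᴿ exp (fromℕ 2 *ᴿ y *ᴿ μ) *ᴿ (exp (fromℕ 2 *ᴿ y *ᴿ (c -ᴿ μ)) *ᴿ exp (fromℕ 2 *ᴿ y *ᴿ (c -ᴿ μ)))
  shift² y c μ = ≃-trans (exp-cong (solve 2 (λ y c → con (fromℕℚ 4) :* y :* c := con (fromℕℚ 2) :* y :* c :+ con (fromℕℚ 2) :* y :* c) ≃-refl y c))
    (≃-trans (≃-sym (exp-+ (fromℕ 2 *ᴿ y *ᴿ c) (fromℕ 2 *ᴿ y *ᴿ c)))
    (≃-trans (*ᴿ-cong (shift y c μ) (shift y c μ))
      (solve 2 (λ e z → e :* z :* (e :* z) := e :* e :* (z :* z)) ≃-refl (exp (fromℕ 2 *ᴿ y *ᴿ μ)) (exp (fromℕ 2 *ᴿ y *ᴿ (c -ᴿ μ))))))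

  -- For e = 1 this is 4 z₂ ≤ 4 c z - 4 ≤ (c z)², the last step because (c z - 2)² ≥ 0. In the
  -- application z and z₂ are the first two moments of a shifted variable, and e undoes the shift.
  square-bound : ∀ e c z z₂ → z₂ +ᴿ 1ᴿ ≤ᴿ c *ᴿ z → fromℕ 4 *ᴿ (e *ᴿ e *ᴿ z₂) ≤ᴿ c *ᴿ (e *ᴿ z) *ᴿ (c *ᴿ (e *ᴿ z))
  square-bound e c z z₂ h = 0≤-⇒≤ (begin
    0ᴿ
      ≃⟨ solve 0 (con 0ℚ := con 0ℚ :+ con 0ℚ) ≃-refl ⟩
    0ᴿ +ᴿ 0ᴿ
      ≤⟨ +ᴿ-mono-≤ (squareᴿ-nonNeg (e *ᴿ (c *ᴿ z -ᴿ fromℕ 2))) (*ᴿ-nonNeg (*ᴿ-nonNeg (fromℚ-mono (fromℕℚ-nonNeg 4)) (squareᴿ-nonNeg e)) (≤⇒0≤- h)) ⟩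
    e *ᴿ (c *ᴿ z -ᴿ fromℕ 2) *ᴿ (e *ᴿ (c *ᴿ z -ᴿ fromℕ 2)) +ᴿ fromℕ 4 *ᴿ (e *ᴿ e) *ᴿ (c *ᴿ z -ᴿ (z₂ +ᴿ 1ᴿ))
      ≃⟨ solve 4 (λ e c z z₂ → e :* (c :* z :- con (fromℕℚ 2)) :* (e :* (c :* z :- con (fromℕℚ 2))) :+ con (fromℕℚ 4) :* (e :* e) :* (c :* z :- (z₂ :+ con 1ℚ))
           := c :* (e :* z) :* (c :* (e :* z)) :- con (fromℕℚ 4) :* (e :* e :* z₂)) ≃-refl e c z z₂ ⟩
    c *ᴿ (e *ᴿ z) *ᴿ (c *ᴿ (e *ᴿ z)) -ᴿ fromℕ 4 *ᴿ (e *ᴿ e *ᴿ z₂) ∎)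

  -- The reverse Cauchy-Schwarz (Kantorovich) inequality for Z = exp (2 y (X - μ)), whose
  -- values lie between exp y and exp (- y): there Z² + 1 ≤ (exp y + exp (- y)) Z.
  mgf-double-around : ∀ {m} .{{_ : ℕ.NonZero m}} (X : Fin m → ℝ) y μ →
    (∀ i → centered X i -ᴿ μ ≤ᴿ fromℚ ½) → (∀ i → (-ᴿ (centered X i -ᴿ μ)) ≤ᴿ fromℚ ½) →
    fromℕ 4 *ᴿ mgf X (fromℕ 4 *ᴿ y) ≤ᴿ (exp y +ᴿ exp (-ᴿ y)) *ᴿ mgf X (fromℕ 2 *ᴿ y) *ᴿ ((exp y +ᴿ exp (-ᴿ y)) *ᴿ mgf X (fromℕ 2 *ᴿ y))
  mgf-double-around X y μ upper lower = begin
    fromℕ 4 *ᴿ mgf X (fromℕ 4 *ᴿ y)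
      ≃⟨ *ᴿ-congˡ (fromℕ 4) (≃-trans (avg-cong (λ i → shift² y (centered X i) μ))
           (avg-*ˡ (exp (fromℕ 2 *ᴿ y *ᴿ μ) *ᴿ exp (fromℕ 2 *ᴿ y *ᴿ μ)) (λ i → exp (fromℕ 2 *ᴿ y *ᴿ (centered X i -ᴿ μ)) *ᴿ exp (fromℕ 2 *ᴿ y *ᴿ (centered X i -ᴿ μ))))) ⟩
    fromℕ 4 *ᴿ (exp (fromℕ 2 *ᴿ y *ᴿ μ) *ᴿ exp (fromℕ 2 *ᴿ y *ᴿ μ) *ᴿ avg (λ i → exp (fromℕ 2 *ᴿ y *ᴿ (centered X i -ᴿ μ)) *ᴿ exp (fromℕ 2 *ᴿ y *ᴿ (centered X i -ᴿ μ))))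
      ≤⟨ square-bound _ (exp y +ᴿ exp (-ᴿ y)) _ _ second-moment ⟩
    (exp y +ᴿ exp (-ᴿ y)) *ᴿ (exp (fromℕ 2 *ᴿ y *ᴿ μ) *ᴿ avg (λ i → exp (fromℕ 2 *ᴿ y *ᴿ (centered X i -ᴿ μ))))
      *ᴿ ((exp y +ᴿ exp (-ᴿ y)) *ᴿ (exp (fromℕ 2 *ᴿ y *ᴿ μ) *ᴿ avg (λ i → exp (fromℕ 2 *ᴿ y *ᴿ (centered X i -ᴿ μ)))))
      ≃⟨ *ᴿ-cong (*ᴿ-congˡ (exp y +ᴿ exp (-ᴿ y)) (≃-sym mgf≃)) (*ᴿ-congˡ (exp y +ᴿ exp (-ᴿ y)) (≃-sym mgf≃)) ⟩
    (exp y +ᴿ exp (-ᴿ y)) *ᴿ mgf X (fromℕ 2 *ᴿ y) *ᴿ ((exp y +ᴿ exp (-ᴿ y)) *ᴿ mgf X (fromℕ 2 *ᴿ y)) ∎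
    where
    mgf≃ : mgf X (fromℕ 2 *ᴿ y) ≃ exp (fromℕ 2 *ᴿ y *ᴿ μ) *ᴿ avg (λ i → exp (fromℕ 2 *ᴿ y *ᴿ (centered X i -ᴿ μ)))
    mgf≃ = ≃-trans (avg-cong (λ i → shift y (centered X i) μ)) (avg-*ˡ (exp (fromℕ 2 *ᴿ y *ᴿ μ)) (λ i → exp (fromℕ 2 *ᴿ y *ᴿ (centered X i -ᴿ μ))))

    second-moment : avg (λ i → exp (fromℕ 2 *ᴿ y *ᴿ (centered X i -ᴿ μ)) *ᴿ exp (fromℕ 2 *ᴿ y *ᴿ (centered X i -ᴿ μ))) +ᴿ 1ᴿ
      ≤ᴿ (exp y +ᴿ exp (-ᴿ y)) *ᴿ avg (λ i → exp (fromℕ 2 *ᴿ y *ᴿ (centered X i -ᴿ μ)))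
    second-moment = ≤ᴿ-trans (proj₂ (≃-trans (avg-+ (λ i → exp (fromℕ 2 *ᴿ y *ᴿ (centered X i -ᴿ μ)) *ᴿ exp (fromℕ 2 *ᴿ y *ᴿ (centered X i -ᴿ μ))) (λ _ → 1ᴿ)) (+ᴿ-cong ≃-refl (avg-const 1ᴿ))))
      (≤ᴿ-trans (avg-mono (λ i → exp-between y (centered X i -ᴿ μ) (upper i) (lower i)))
        (proj₁ (avg-*ˡ (exp y +ᴿ exp (-ᴿ y)) (λ i → exp (fromℕ 2 *ᴿ y *ᴿ (centered X i -ᴿ μ))))))

  mgf-double : ∀ {m} .{{_ : ℕ.NonZero m}} (X : Fin m → ℝ) → HasRange X 1ᴿ → ∀ y →
    fromℕ 4 *ᴿ mgf X (fromℕ 4 *ᴿ y) ≤ᴿ (exp y +ᴿ exp (-ᴿ y)) *ᴿ mgf X (fromℕ 2 *ᴿ y) *ᴿ ((exp y +ᴿ exp (-ᴿ y)) *ᴿ mgf X (fromℕ 2 *ᴿ y))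
  mgf-double {suc m} X range y with argmin X
  -- The centre is the least centred value plus ½, the middle of an interval of length 1 that
  -- contains all of them.
  ... | i₀ , min = mgf-double-around X y (centered X i₀ +ᴿ fromℚ ½) (λ i → upper (X i) (X i₀) (avg X) (range i i₀)) (λ i → lower (X i) (X i₀) (avg X) (min i))
    where
    upper : ∀ x x₀ a → x ≤ᴿ x₀ +ᴿ 1ᴿ → (x -ᴿ a) -ᴿ (x₀ -ᴿ a +ᴿ fromℚ ½) ≤ᴿ fromℚ ½
    upper x x₀ a h = 0≤-⇒≤ (≤ᴿ-trans (≤⇒0≤- h)
      (proj₁ (solve 3 (λ x x₀ a → x₀ :+ con 1ℚ :- x := con ½ :- ((x :- a) :- (x₀ :- a :+ con ½))) ≃-refl x x₀ a)))
    lower : ∀ x x₀ a → x₀ ≤ᴿ x → (-ᴿ ((x -ᴿ a) -ᴿ (x₀ -ᴿ a +ᴿ fromℚ ½))) ≤ᴿ fromℚ ½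
    lower x x₀ a h = 0≤-⇒≤ (≤ᴿ-trans (≤⇒0≤- h)
      (proj₁ (solve 3 (λ x x₀ a → x :- x₀ := con ½ :- (:- ((x :- a) :- (x₀ :- a :+ con ½)))) ≃-refl x x₀ a)))

  -- cosh² y times the square of the bound at 2 y is at most exp (2 c y² + 4 σ y²), which is the
  -- Gaussian bound at t = 4 y with proxy c / 4 + σ / 2. The constant c stays free: ½ serves every
  -- y, and smaller values serve y away from 0.
  mgf-double-exp : ∀ {m} .{{_ : ℕ.NonZero m}} (X : Fin m → ℝ) → HasRange X 1ᴿ → ∀ {σ} c y → Subgaussian X σ →
    exp y +ᴿ exp (-ᴿ y) ≤ᴿ fromℕ 2 *ᴿ exp (c *ᴿ (y *ᴿ y)) →
    mgf X (fromℕ 4 *ᴿ y) ≤ᴿ exp ((fromℚ (+ 1 / 4) *ᴿ c +ᴿ fromℚ ½ *ᴿ σ) *ᴿ ((fromℕ 4 *ᴿ y) *ᴿ (fromℕ 4 *ᴿ y)) *ᴿ fromℚ ½)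
  mgf-double-exp X range {σ} c y sg cosh≤ = *ᴿ-cancel-≤ (recip≥0 3) refl (begin
    fromℕ 4 *ᴿ mgf X (fromℕ 4 *ᴿ y)
      ≤⟨ mgf-double X range y ⟩
    (exp y +ᴿ exp (-ᴿ y)) *ᴿ mgf X (fromℕ 2 *ᴿ y) *ᴿ ((exp y +ᴿ exp (-ᴿ y)) *ᴿ mgf X (fromℕ 2 *ᴿ y))
      ≤⟨ *ᴿ-mono-≤ (*ᴿ-nonNeg 0≤cosh (mgf-nonNeg X (fromℕ 2 *ᴿ y))) (*ᴿ-nonNeg (*ᴿ-nonNeg (fromℚ-mono (fromℕℚ-nonNeg 2)) (exp-nonNeg _)) (exp-nonNeg _)) step step ⟩
    (fromℕ 2 *ᴿ exp (c *ᴿ (y *ᴿ y)) *ᴿ exp (σ *ᴿ ((fromℕ 2 *ᴿ y) *ᴿ (fromℕ 2 *ᴿ y)) *ᴿ fromℚ ½))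
      *ᴿ (fromℕ 2 *ᴿ exp (c *ᴿ (y *ᴿ y)) *ᴿ exp (σ *ᴿ ((fromℕ 2 *ᴿ y) *ᴿ (fromℕ 2 *ᴿ y)) *ᴿ fromℚ ½))
      ≃⟨ combine (c *ᴿ (y *ᴿ y)) (σ *ᴿ ((fromℕ 2 *ᴿ y) *ᴿ (fromℕ 2 *ᴿ y)) *ᴿ fromℚ ½) ⟩
    fromℕ 4 *ᴿ exp (c *ᴿ (y *ᴿ y) +ᴿ c *ᴿ (y *ᴿ y) +ᴿ (σ *ᴿ ((fromℕ 2 *ᴿ y) *ᴿ (fromℕ 2 *ᴿ y)) *ᴿ fromℚ ½ +ᴿ σ *ᴿ ((fromℕ 2 *ᴿ y) *ᴿ (fromℕ 2 *ᴿ y)) *ᴿ fromℚ ½))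
      ≃⟨ *ᴿ-congˡ (fromℕ 4) (exp-cong (solve 3 (λ c σ y →
           c :* (y :* y) :+ c :* (y :* y) :+ (σ :* ((con (fromℕℚ 2) :* y) :* (con (fromℕℚ 2) :* y)) :* con ½ :+ σ :* ((con (fromℕℚ 2) :* y) :* (con (fromℕℚ 2) :* y)) :* con ½)
           := (con (+ 1 / 4) :* c :+ con ½ :* σ) :* ((con (fromℕℚ 4) :* y) :* (con (fromℕℚ 4) :* y)) :* con ½) ≃-refl c σ y)) ⟩
    fromℕ 4 *ᴿ exp ((fromℚ (+ 1 / 4) *ᴿ c +ᴿ fromℚ ½ *ᴿ σ) *ᴿ ((fromℕ 4 *ᴿ y) *ᴿ (fromℕ 4 *ᴿ y)) *ᴿ fromℚ ½) ∎)
    where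
    0≤cosh : 0ᴿ ≤ᴿ exp y +ᴿ exp (-ᴿ y)
    0≤cosh = ≤ᴿ-trans (proj₁ (solve 0 (con 0ℚ := con 0ℚ :+ con 0ℚ) ≃-refl)) (+ᴿ-mono-≤ (exp-nonNeg y) (exp-nonNeg (-ᴿ y)))
    step : (exp y +ᴿ exp (-ᴿ y)) *ᴿ mgf X (fromℕ 2 *ᴿ y) ≤ᴿ fromℕ 2 *ᴿ exp (c *ᴿ (y *ᴿ y)) *ᴿ exp (σ *ᴿ ((fromℕ 2 *ᴿ y) *ᴿ (fromℕ 2 *ᴿ y)) *ᴿ fromℚ ½)
    step = *ᴿ-mono-≤ (mgf-nonNeg X (fromℕ 2 *ᴿ y)) (≤ᴿ-trans 0≤cosh cosh≤) cosh≤ (proj₂ sg (fromℕ 2 *ᴿ y))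
    combine : ∀ a b → (fromℕ 2 *ᴿ exp a *ᴿ exp b) *ᴿ (fromℕ 2 *ᴿ exp a *ᴿ exp b) ≃ fromℕ 4 *ᴿ exp (a +ᴿ a +ᴿ (b +ᴿ b))
    combine a b = ≃-trans (solve 2 (λ a b → (con (fromℕℚ 2) :* a :* b) :* (con (fromℕℚ 2) :* a :* b) := con (fromℕℚ 4) :* ((a :* a) :* (b :* b))) ≃-refl (exp a) (exp b))
      (*ᴿ-congˡ (fromℕ 4) (≃-trans (*ᴿ-cong (exp-+ a a) (exp-+ b b)) (exp-+ (a +ᴿ a) (b +ᴿ b))))

  quarter : ∀ t → fromℕ 4 *ᴿ (fromℚ (+ 1 / 4) *ᴿ t) ≃ t
  quarter = solve 1 (λ t → con (fromℕℚ 4) :* (con (+ 1 / 4) :* t) := t) ≃-refl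

  mgf-bound-at : ∀ {m} .{{_ : ℕ.NonZero m}} (X : Fin m → ℝ) {t u} s → t ≃ u →
    mgf X t ≤ᴿ exp (s *ᴿ (t *ᴿ t) *ᴿ fromℚ ½) → mgf X u ≤ᴿ exp (s *ᴿ (u *ᴿ u) *ᴿ fromℚ ½)
  mgf-bound-at X s e h = ≤ᴿ-trans (proj₂ (mgf-cong X e)) (≤ᴿ-trans h (proj₁ (exp-cong (*ᴿ-cong (*ᴿ-congˡ s (*ᴿ-cong e e)) ≃-refl))))

  halved-nonNeg : ∀ {p s} → 0ℚ ℚ.≤ p → 0ᴿ ≤ᴿ s → 0ᴿ ≤ᴿ fromℚ (+ 1 / 4) *ᴿ fromℚ p +ᴿ fromℚ ½ *ᴿ s
  halved-nonNeg {p} {s} 0≤p 0≤s = ≤ᴿ-trans (proj₁ (solve 0 (con 0ℚ := con 0ℚ :+ con 0ℚ) ≃-refl))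
    (+ᴿ-mono-≤ (*ᴿ-nonNeg (fromℚ-mono (recip≥0 3)) (fromℚ-mono 0≤p)) (*ᴿ-nonNeg (fromℚ-mono (recip≥0 1)) 0≤s))

  Subgaussian-halve : ∀ {m} .{{_ : ℕ.NonZero m}} (X : Fin m → ℝ) → HasRange X 1ᴿ → ∀ s → Subgaussian X s →
    Subgaussian X (fromℚ (+ 1 / 4) *ᴿ fromℚ ½ +ᴿ fromℚ ½ *ᴿ s)
  Subgaussian-halve X range s sg = halved-nonNeg (recip≥0 1) (proj₁ sg) , λ t →
    mgf-bound-at X (fromℚ (+ 1 / 4) *ᴿ fromℚ ½ +ᴿ fromℚ ½ *ᴿ s) (quarter t)
      (mgf-double-exp X range (fromℚ ½) (fromℚ (+ 1 / 4) *ᴿ t) sg (cosh≤exp (fromℚ (+ 1 / 4) *ᴿ t)))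

  ≤¼-of-halved : ∀ s → s ≤ᴿ fromℚ (+ 1 / 4) *ᴿ fromℚ ½ +ᴿ fromℚ ½ *ᴿ s → s ≤ᴿ fromℚ (+ 1 / 4)
  ≤¼-of-halved s h = 0≤-⇒≤ (begin
    0ᴿ                                                                         ≤⟨ *ᴿ-nonNeg (fromℚ-mono (fromℕℚ-nonNeg 2)) (≤⇒0≤- h) ⟩
    fromℕ 2 *ᴿ (fromℚ (+ 1 / 4) *ᴿ fromℚ ½ +ᴿ fromℚ ½ *ᴿ s -ᴿ s)               ≃⟨ solve 1 (λ s → con (fromℕℚ 2) :* (con (+ 1 / 4) :* con ½ :+ con ½ :* s :- s) := con (+ 1 / 4) :- s) ≃-refl s ⟩
    fromℚ (+ 1 / 4) -ᴿ s                                                       ∎)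

  hoeffding : ∀ {m} .{{_ : ℕ.NonZero m}} (X : Fin m → ℝ) → HasRange X 1ᴿ → Subgaussian X (fromℚ (+ 1 / 4))
  hoeffding X range = conclude (optimal-exists X (fromℕ 4 *ᴿ (1ᴿ *ᴿ 1ᴿ) , Subgaussian-of-range X range))
    where
    conclude : ∃ (IsLeast (Subgaussian X)) → Subgaussian X (fromℚ (+ 1 / 4))
    conclude (s , sg , least) = Subgaussian-mono X (≤¼-of-halved s (least (fromℚ (+ 1 / 4) *ᴿ fromℚ ½ +ᴿ fromℚ ½ *ᴿ s) (Subgaussian-halve X range s sg))) sg

-- A uniform gain below 1/4 on three points.

module ThreePoints (em : ExcludedMiddle 0ℓ) where
  open Classical em
  open SubgaussianBounds em
  open Hoeffding em
  open ≤ᴿ-Reasoning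
  open ℝ-Solver

  -- The linear term averages out and the quadratic one yields the variance, so for ∣t∣ ≤ δ the
  -- variance itself acts as a proxy up to the factor 1 + 2 δ.
  mgf-small : ∀ {m} .{{_ : ℕ.NonZero m}} (X : Fin m → ℝ) → HasRange X 1ᴿ → ∀ {t δ} → 0ℚ ℚ.< δ → δ ℚ.≤ 1ℚ → t ≤ᴿ fromℚ δ → (-ᴿ t) ≤ᴿ fromℚ δ →
    mgf X t ≤ᴿ exp (fromℚ (½ + δ) *ᴿ (t *ᴿ t) *ᴿ variance X)
  mgf-small X range {t} {δ} 0<δ δ≤1 t≤ -t≤ = begin
    mgf X t
      ≤⟨ avg-mono (λ i → exp≤quadratic 0<δ δ≤1 (product≤ t (centered X i) t≤ -t≤ (centered≤ X range i) (-centered≤ X range i))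
           (≤ᴿ-trans (proj₁ (solve 2 (λ t y → :- (t :* y) := t :* (:- y)) ≃-refl t (centered X i)))
             (product≤ t (-ᴿ centered X i) t≤ -t≤ (-centered≤ X range i) (≤ᴿ-trans (proj₁ (solve 1 (λ y → :- (:- y) := y) ≃-refl (centered X i))) (centered≤ X range i))))) ⟩
    avg (λ i → 1ᴿ +ᴿ t *ᴿ centered X i +ᴿ fromℚ (½ + δ) *ᴿ (t *ᴿ centered X i *ᴿ (t *ᴿ centered X i)))
      ≃⟨ avg-cong (λ i → solve 3 (λ t y d → con 1ℚ :+ t :* y :+ d :* (t :* y :* (t :* y)) := con 1ℚ :+ t :* y :+ d :* (t :* t) :* (y :* y)) ≃-refl t (centered X i) (fromℚ (½ + δ))) ⟩
    avg (λ i → 1ᴿ +ᴿ t *ᴿ centered X i +ᴿ fromℚ (½ + δ) *ᴿ (t *ᴿ t) *ᴿ (centered X i *ᴿ centered X i))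
      ≃⟨ ≃-trans (avg-+ (λ i → 1ᴿ +ᴿ t *ᴿ centered X i) (λ i → fromℚ (½ + δ) *ᴿ (t *ᴿ t) *ᴿ (centered X i *ᴿ centered X i)))
           (+ᴿ-cong (≃-trans (avg-+ (λ _ → 1ᴿ) (λ i → t *ᴿ centered X i)) (+ᴿ-cong (avg-const 1ᴿ) (≃-trans (avg-*ˡ t (centered X)) (*ᴿ-congˡ t (avg-centered X)))))
             (avg-*ˡ (fromℚ (½ + δ) *ᴿ (t *ᴿ t)) (λ i → centered X i *ᴿ centered X i))) ⟩
    1ᴿ +ᴿ t *ᴿ 0ᴿ +ᴿ fromℚ (½ + δ) *ᴿ (t *ᴿ t) *ᴿ variance X
      ≃⟨ solve 2 (λ t w → con 1ℚ :+ t :* con 0ℚ :+ w := con 1ℚ :+ w) ≃-refl t (fromℚ (½ + δ) *ᴿ (t *ᴿ t) *ᴿ variance X) ⟩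
    1ᴿ +ᴿ fromℚ (½ + δ) *ᴿ (t *ᴿ t) *ᴿ variance X
      ≤⟨ 1+x≤exp (fromℚ (½ + δ) *ᴿ (t *ᴿ t) *ᴿ variance X) ⟩
    exp (fromℚ (½ + δ) *ᴿ (t *ᴿ t) *ᴿ variance X) ∎
    where
    -- The average of (δ - t)(1 + y) and (δ + t)(1 - y), both nonnegative, is δ - t y.
    product≤ : ∀ t y → t ≤ᴿ fromℚ δ → (-ᴿ t) ≤ᴿ fromℚ δ → y ≤ᴿ 1ᴿ → (-ᴿ y) ≤ᴿ 1ᴿ → t *ᴿ y ≤ᴿ fromℚ δ
    product≤ t y t≤ -t≤ y≤ -y≤ = 0≤-⇒≤ (begin
      0ᴿ
        ≃⟨ solve 0 (con 0ℚ := con ½ :* (con 0ℚ :+ con 0ℚ)) ≃-refl ⟩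
      fromℚ ½ *ᴿ (0ᴿ +ᴿ 0ᴿ)
        ≤⟨ *ᴿ-monoˡ-≤ (fromℚ-mono (recip≥0 1)) (+ᴿ-mono-≤ (*ᴿ-nonNeg (≤⇒0≤- t≤) (≤⇒0≤- -y≤)) (*ᴿ-nonNeg (≤⇒0≤- -t≤) (≤⇒0≤- y≤))) ⟩
      fromℚ ½ *ᴿ ((fromℚ δ -ᴿ t) *ᴿ (1ᴿ -ᴿ (-ᴿ y)) +ᴿ (fromℚ δ -ᴿ (-ᴿ t)) *ᴿ (1ᴿ -ᴿ y))
        ≃⟨ solve 3 (λ d t y → con ½ :* ((d :- t) :* (con 1ℚ :- (:- y)) :+ (d :- (:- t)) :* (con 1ℚ :- y)) := d :- t :* y) ≃-refl (fromℚ δ) t y ⟩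
      fromℚ δ -ᴿ t *ᴿ y ∎)

  -- With p = x₀ - μ etc. in [0, 1], (2/9) (1 - p² - q² - r² + pq + pr + qr) is the slack.
  variance-of-three : ∀ x₀ x₁ x₂ μ → (∀ {x} → x ≡ x₀ ⊎ x ≡ x₁ ⊎ x ≡ x₂ → μ ≤ᴿ x × x ≤ᴿ μ +ᴿ 1ᴿ) →
    let a = fromℚ (+ 1 / 3) *ᴿ (x₀ +ᴿ (x₁ +ᴿ (x₂ +ᴿ 0ᴿ))) in
    fromℚ (+ 1 / 3) *ᴿ ((x₀ -ᴿ a) *ᴿ (x₀ -ᴿ a) +ᴿ ((x₁ -ᴿ a) *ᴿ (x₁ -ᴿ a) +ᴿ ((x₂ -ᴿ a) *ᴿ (x₂ -ᴿ a) +ᴿ 0ᴿ))) ≤ᴿ fromℚ (+ 2 / 9)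
  variance-of-three x₀ x₁ x₂ μ within = 0≤-⇒≤ (≤ᴿ-trans slack (proj₁ (solve 4 (λ x y z m →
      let a = con (+ 1 / 3) :* (x :+ (y :+ (z :+ con 0ℚ)))
          p = x :- m
          q = y :- m
          r = z :- m
          p′ = m :+ con 1ℚ :- x
          q′ = m :+ con 1ℚ :- y
          r′ = m :+ con 1ℚ :- z
      in con (+ 2 / 9) :* (p :* q :* r :+ p′ :* q′ :* r′ :+ (p :* p′ :+ q :* q′ :+ r :* r′))
        := con (+ 2 / 9) :- con (+ 1 / 3) :* ((x :- a) :* (x :- a) :+ ((y :- a) :* (y :- a) :+ ((z :- a) :* (z :- a) :+ con 0ℚ)))) ≃-refl x₀ x₁ x₂ μ)))
    where
    lo : ∀ {x} → x ≡ x₀ ⊎ x ≡ x₁ ⊎ x ≡ x₂ → 0ᴿ ≤ᴿ x -ᴿ μ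
    lo i = ≤⇒0≤- (proj₁ (within i))
    hi : ∀ {x} → x ≡ x₀ ⊎ x ≡ x₁ ⊎ x ≡ x₂ → 0ᴿ ≤ᴿ μ +ᴿ 1ᴿ -ᴿ x
    hi i = ≤⇒0≤- (proj₂ (within i))
    i₀ = inj₁ refl
    i₁ = inj₂ (inj₁ refl)
    i₂ = inj₂ (inj₂ refl)
    +-nonNegᴿ : ∀ {x y} → 0ᴿ ≤ᴿ x → 0ᴿ ≤ᴿ y → 0ᴿ ≤ᴿ x +ᴿ y
    +-nonNegᴿ p q = ≤ᴿ-trans (proj₁ (solve 0 (con 0ℚ := con 0ℚ :+ con 0ℚ) ≃-refl)) (+ᴿ-mono-≤ p q)
    -- Nonnegativity of the slack is certified by products of nonnegative factors. With p′ = 1 - p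
    -- and so on, p q r + p′ q′ r′ = 1 - p - q - r + p q + p r + q r, and p p′ + q q′ + r r′ trades
    -- the linear terms for - p² - q² - r².
    slack : 0ᴿ ≤ᴿ fromℚ (+ 2 / 9) *ᴿ ((x₀ -ᴿ μ) *ᴿ (x₁ -ᴿ μ) *ᴿ (x₂ -ᴿ μ) +ᴿ (μ +ᴿ 1ᴿ -ᴿ x₀) *ᴿ (μ +ᴿ 1ᴿ -ᴿ x₁) *ᴿ (μ +ᴿ 1ᴿ -ᴿ x₂)
      +ᴿ ((x₀ -ᴿ μ) *ᴿ (μ +ᴿ 1ᴿ -ᴿ x₀) +ᴿ (x₁ -ᴿ μ) *ᴿ (μ +ᴿ 1ᴿ -ᴿ x₁) +ᴿ (x₂ -ᴿ μ) *ᴿ (μ +ᴿ 1ᴿ -ᴿ x₂)))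
    slack = *ᴿ-nonNeg (fromℚ-mono (ℚ.nonNegative⁻¹ (+ 2 / 9)))
      (+-nonNegᴿ (+-nonNegᴿ (*ᴿ-nonNeg (*ᴿ-nonNeg (lo i₀) (lo i₁)) (lo i₂)) (*ᴿ-nonNeg (*ᴿ-nonNeg (hi i₀) (hi i₁)) (hi i₂)))
        (+-nonNegᴿ (+-nonNegᴿ (*ᴿ-nonNeg (lo i₀) (hi i₀)) (*ᴿ-nonNeg (lo i₁) (hi i₁))) (*ᴿ-nonNeg (lo i₂) (hi i₂))))

  variance-three : ∀ (X : Fin 3 → ℝ) → HasRange X 1ᴿ → variance X ≤ᴿ fromℚ (+ 2 / 9)
  variance-three X range = subst (_≤ᴿ fromℚ (+ 2 / 9)) (sym (avg≡ (λ i → centered X i *ᴿ centered X i)))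
    (subst (λ a → fromℚ (+ 1 / 3) *ᴿ sumᴿ (λ i → (X i -ᴿ a) *ᴿ (X i -ᴿ a)) ≤ᴿ fromℚ (+ 2 / 9)) (sym (avg≡ X)) (around (argmin X)))
    where
    around : (∃ λ i → ∀ j → X i ≤ᴿ X j) → fromℚ (+ 1 / 3) *ᴿ sumᴿ (λ i → (X i -ᴿ fromℚ (inverse 3) *ᴿ sumᴿ X) *ᴿ (X i -ᴿ fromℚ (inverse 3) *ᴿ sumᴿ X)) ≤ᴿ fromℚ (+ 2 / 9)
    around (i , min) = variance-of-three (X zero) (X (suc zero)) (X (suc (suc zero))) (X i)
      λ { (inj₁ refl) → min zero , range zero i
        ; (inj₂ (inj₁ refl)) → min (suc zero) , range (suc zero) i
        ; (inj₂ (inj₂ refl)) → min (suc (suc zero)) , range (suc (suc zero)) i }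

  -- For ∣t∣ ≤ δ the variance bound 2/9 < 1/4 decides; for ∣t∣ ≥ δ the
  -- doubling step gains a factor 1 - η in the bound on cosh (t / 4).
  δ η c σ₃ : ℚ
  δ  = + 1 / 32
  η  = + 1 / 36 * (½ * (+ 1 / 16384))
  c  = ½ * (1ℚ - η)
  σ₃ = + 1 / 4 * c + ½ * (+ 1 / 4)

  -- `σ₃` in the unevaluated shape that `mgf-double-exp` delivers.
  σ₃ᴿ : ℝ
  σ₃ᴿ = fromℚ (+ 1 / 4) *ᴿ fromℚ c +ᴿ fromℚ ½ *ᴿ fromℚ (+ 1 / 4)

  -- With y = t / 4 the assumption gives y² ≥ (δ / 4)² = 1/16384, the κ of `cosh<exp`. There 1 - 2 c
  -- may be at most κ / 72 = `η`, and one doubling from Hoeffding's 1/4 yields c / 4 + 1/8 = 1/4 - η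
  -- / 8.
  three-points-large : ∀ (X : Fin 3 → ℝ) → HasRange X 1ᴿ → ∀ t → 0ᴿ ≤ᴿ t *ᴿ t -ᴿ fromℚ δ *ᴿ fromℚ δ → mgf X t ≤ᴿ exp (σ₃ᴿ *ᴿ (t *ᴿ t) *ᴿ fromℚ ½)
  three-points-large X range t δ²≤t² = mgf-bound-at X σ₃ᴿ (quarter t)
    (mgf-double-exp X range (fromℚ c) (fromℚ (+ 1 / 4) *ᴿ t) (hoeffding X range)
      (cosh<exp (fromℚ (+ 1 / 4) *ᴿ t) (from-yes (+ 1 / 3 ℚ.≤? c)) (ℚ.positive⁻¹ (+ 1 / 16384))
        (from-yes (1ℚ - fromℕℚ 2 * c ℚ.≤? η)) (large t δ²≤t²)))
    where
    large : ∀ t → 0ᴿ ≤ᴿ t *ᴿ t -ᴿ fromℚ δ *ᴿ fromℚ δ → fromℚ (+ 1 / 16384) ≤ᴿ fromℚ (+ 1 / 4) *ᴿ t *ᴿ (fromℚ (+ 1 / 4) *ᴿ t)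
    large t h = 0≤-⇒≤ (≤ᴿ-trans (*ᴿ-nonNeg (fromℚ-mono (recip≥0 15)) h)
      (proj₁ (solve 1 (λ t → con (+ 1 / 16) :* (t :* t :- con δ :* con δ) := con (+ 1 / 4) :* t :* (con (+ 1 / 4) :* t) :- con (+ 1 / 16384)) ≃-refl t)))

  -- The variance bound leaves room: (½ + δ) 2/9 = 17/144, against ½ `σ₃`, which is just below
  -- 18/144.
  three-points-small : ∀ (X : Fin 3 → ℝ) → HasRange X 1ᴿ → ∀ t → t ≤ᴿ fromℚ δ → (-ᴿ t) ≤ᴿ fromℚ δ → mgf X t ≤ᴿ exp (σ₃ᴿ *ᴿ (t *ᴿ t) *ᴿ fromℚ ½)
  three-points-small X range t t≤ -t≤ = ≤ᴿ-trans (mgf-small X range (ℚ.positive⁻¹ δ) (from-yes (δ ℚ.≤? 1ℚ)) t≤ -t≤) (exp-mono (begin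
    fromℚ (½ + δ) *ᴿ (t *ᴿ t) *ᴿ variance X
      ≤⟨ *ᴿ-monoˡ-≤ (*ᴿ-nonNeg (fromℚ-mono (from-yes (0ℚ ℚ.≤? ½ + δ))) (squareᴿ-nonNeg t)) (variance-three X range) ⟩
    fromℚ (½ + δ) *ᴿ (t *ᴿ t) *ᴿ fromℚ (+ 2 / 9)
      ≃⟨ solve 1 (λ t → con (½ + δ) :* (t :* t) :* con (+ 2 / 9) := con ((½ + δ) * (+ 2 / 9)) :* (t :* t)) ≃-refl t ⟩
    fromℚ ((½ + δ) * (+ 2 / 9)) *ᴿ (t *ᴿ t)
      ≤⟨ *ᴿ-monoʳ-≤ (squareᴿ-nonNeg t) (fromℚ-mono (from-yes ((½ + δ) * (+ 2 / 9) ℚ.≤? ½ * σ₃))) ⟩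
    fromℚ (½ * σ₃) *ᴿ (t *ᴿ t)
      ≃⟨ solve 1 (λ t → con (½ * σ₃) :* (t :* t) := (con (+ 1 / 4) :* con c :+ con ½ :* con (+ 1 / 4)) :* (t :* t) :* con ½) ≃-refl t ⟩
    σ₃ᴿ *ᴿ (t *ᴿ t) *ᴿ fromℚ ½ ∎))

  three-points : ∀ (X : Fin 3 → ℝ) → HasRange X 1ᴿ → Subgaussian X (fromℚ σ₃)
  three-points X range = Subgaussian-mono X (pointwise⇒≤ᴿ λ _ → ℚ.≤-refl)
    (halved-nonNeg (from-yes (0ℚ ℚ.≤? c)) (fromℚ-mono (recip≥0 3)) , bound)
    where
    square-diff : ∀ t d → (t -ᴿ d) *ᴿ (t -ᴿ (-ᴿ d)) ≃ t *ᴿ t -ᴿ d *ᴿ d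
    square-diff = solve 2 (λ t d → (t :- d) :* (t :- (:- d)) := t :* t :- d :* d) ≃-refl
    square-diff′ : ∀ t d → (d -ᴿ t) *ᴿ ((-ᴿ d) -ᴿ t) ≃ t *ᴿ t -ᴿ d *ᴿ d
    square-diff′ = solve 2 (λ t d → (d :- t) :* (:- d :- t) := t :* t :- d :* d) ≃-refl
    -δ≤δ : (-ᴿ fromℚ δ) ≤ᴿ fromℚ δ
    -δ≤δ = pointwise⇒≤ᴿ λ _ → from-yes (- δ ℚ.≤? δ)
    bound : ∀ t → mgf X t ≤ᴿ exp (σ₃ᴿ *ᴿ (t *ᴿ t) *ᴿ fromℚ ½)
    bound t = cases (≤ᴿ-total t (fromℚ δ)) (≤ᴿ-total (-ᴿ fromℚ δ) t)
      where
      cases : t ≤ᴿ fromℚ δ ⊎ fromℚ δ ≤ᴿ t → (-ᴿ fromℚ δ) ≤ᴿ t ⊎ t ≤ᴿ (-ᴿ fromℚ δ) → mgf X t ≤ᴿ exp (σ₃ᴿ *ᴿ (t *ᴿ t) *ᴿ fromℚ ½)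
      cases (inj₂ δ≤t) _ = three-points-large X range t
        (≤ᴿ-trans (*ᴿ-nonNeg (≤⇒0≤- δ≤t) (≤⇒0≤- (≤ᴿ-trans -δ≤δ δ≤t))) (proj₁ (square-diff t (fromℚ δ))))
      cases (inj₁ t≤δ) (inj₂ t≤-δ) = three-points-large X range t
        (≤ᴿ-trans (*ᴿ-nonNeg (≤⇒0≤- t≤δ) (≤⇒0≤- t≤-δ)) (proj₁ (square-diff′ t (fromℚ δ))))
      cases (inj₁ t≤δ) (inj₁ -δ≤t) = three-points-small X range t t≤δ
        (≤ᴿ-trans (-ᴿ-anti-≤ -δ≤t) (proj₁ (solve 1 (λ d → :- (:- d) := d) ≃-refl (fromℚ δ))))

-- Subadditivity of variance proxies on product sets.

module Products (em : ExcludedMiddle 0ℓ) where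
  open Classical em
  open ≤ᴿ-Reasoning
  open ℝ-Solver

  -- X - E X splits into M i - E M and X (i , j) - M i, where M averages over j. The bound b holds
  -- on every fibre, so the estimate of the inner average is uniform in i and leaves the outer
  -- average as a factor.
  Subgaussian-× : ∀ {m n} .{{_ : ℕ.NonZero m}} .{{_ : ℕ.NonZero n}} .{{_ : ℕ.NonZero (m ℕ.* n)}} (X : Fin m × Fin n → ℝ) {a b} →
    Subgaussian (λ i → avg (λ j → X (i , j))) a → (∀ i → Subgaussian (λ j → X (i , j)) b) →
    0ᴿ ≤ᴿ b → Subgaussian (λ k → X (Fin.remQuot {m} n k)) (a +ᴿ b)
  Subgaussian-× {m} {n} X {a} {b} (0≤a , hM) hX 0≤b =
    ≤ᴿ-trans (proj₁ (solve 0 (con 0ℚ := con 0ℚ :+ con 0ℚ) ≃-refl)) (+ᴿ-mono-≤ 0≤a 0≤b) , bound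
    where
    M : Fin m → ℝ
    M i = avg (λ j → X (i , j))

    split : ∀ t x e μ e′ → e ≃ e′ → exp (t *ᴿ (x -ᴿ e)) ≃ exp (t *ᴿ (μ -ᴿ e′)) *ᴿ exp (t *ᴿ (x -ᴿ μ))
    split t x e μ e′ e≃e′ = ≃-trans (exp-cong (≃-trans (*ᴿ-congˡ t (+ᴿ-cong ≃-refl (-ᴿ-cong e≃e′)))
        (solve 4 (λ t x e μ → t :* (x :- e) := t :* (μ :- e) :+ t :* (x :- μ)) ≃-refl t x e′ μ)))
      (≃-sym (exp-+ (t *ᴿ (μ -ᴿ e′)) (t *ᴿ (x -ᴿ μ))))

    merge : ∀ t → exp (b *ᴿ (t *ᴿ t) *ᴿ fromℚ ½) *ᴿ exp (a *ᴿ (t *ᴿ t) *ᴿ fromℚ ½) ≃ exp ((a +ᴿ b) *ᴿ (t *ᴿ t) *ᴿ fromℚ ½)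
    merge t = ≃-trans (exp-+ (b *ᴿ (t *ᴿ t) *ᴿ fromℚ ½) (a *ᴿ (t *ᴿ t) *ᴿ fromℚ ½))
      (exp-cong (solve 4 (λ a b t r → b :* (t :* t) :* r :+ a :* (t :* t) :* r := (a :+ b) :* (t :* t) :* r) ≃-refl a b t (fromℚ ½)))

    bound : ∀ t → mgf (λ k → X (Fin.remQuot {m} n k)) t ≤ᴿ exp ((a +ᴿ b) *ᴿ (t *ᴿ t) *ᴿ fromℚ ½)
    bound t = begin
      mgf (λ k → X (Fin.remQuot {m} n k)) t
        ≃⟨ avg-× (λ p → exp (t *ᴿ (X p -ᴿ avg (λ k → X (Fin.remQuot {m} n k))))) ⟩
      avg (λ i → avg (λ j → exp (t *ᴿ (X (i , j) -ᴿ avg (λ k → X (Fin.remQuot {m} n k))))))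
        ≃⟨ avg-cong (λ i → ≃-trans (avg-cong (λ j → split t (X (i , j)) (avg (λ k → X (Fin.remQuot {m} n k))) (M i) (avg M) (avg-× X)))
             (avg-*ˡ (exp (t *ᴿ centered M i)) (λ j → exp (t *ᴿ (X (i , j) -ᴿ M i))))) ⟩
      avg (λ i → exp (t *ᴿ centered M i) *ᴿ mgf (λ j → X (i , j)) t)
        ≤⟨ avg-mono (λ i → *ᴿ-monoˡ-≤ (exp-nonNeg (t *ᴿ centered M i)) (proj₂ (hX i) t)) ⟩
      avg (λ i → exp (t *ᴿ centered M i) *ᴿ exp (b *ᴿ (t *ᴿ t) *ᴿ fromℚ ½))
        ≃⟨ avg-cong (λ i → *ᴿ-comm (exp (t *ᴿ centered M i)) (exp (b *ᴿ (t *ᴿ t) *ᴿ fromℚ ½))) ⟩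
      avg (λ i → exp (b *ᴿ (t *ᴿ t) *ᴿ fromℚ ½) *ᴿ exp (t *ᴿ centered M i))
        ≃⟨ avg-*ˡ (exp (b *ᴿ (t *ᴿ t) *ᴿ fromℚ ½)) (λ i → exp (t *ᴿ centered M i)) ⟩
      exp (b *ᴿ (t *ᴿ t) *ᴿ fromℚ ½) *ᴿ mgf M t
        ≤⟨ *ᴿ-monoˡ-≤ (exp-nonNeg (b *ᴿ (t *ᴿ t) *ᴿ fromℚ ½)) (hM t) ⟩
      exp (b *ᴿ (t *ᴿ t) *ᴿ fromℚ ½) *ᴿ exp (a *ᴿ (t *ᴿ t) *ᴿ fromℚ ½)
        ≃⟨ merge t ⟩
      exp ((a +ᴿ b) *ᴿ (t *ᴿ t) *ᴿ fromℚ ½) ∎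

-- Moments of a bilinear statistic of a uniform permutation

avgPermutations : ∀ n → (Permutation′ n → ℝ) → ℝ
avgPermutations n F = avg {{n !≢0}} (λ k → F (nthPermutation n k))

pairing : ∀ {n} → (Fin n → ℝ) → (Fin n → ℝ) → Permutation′ n → ℝ
pairing a b π = sumᴿ (λ i → a i *ᴿ b (π ⟨$⟩ʳ i))

sumSquares : ∀ {n} → (Fin n → ℝ) → ℝ
sumSquares a = sumᴿ (λ i → a i *ᴿ a i)

module _ where
  open ℚ.≤-Reasoning
  open +-*-Solver

  -- Partial fractions: 1 / d - m / (d (d + m)) = 1 / (d + m) at d = k + 1. The case m = 1 enters
  -- through `recip₀-shift`, the case m = 2 through `recip₂-shift`.
  recip-shift : ∀ k m → recip k * fromℕℚ (suc k) ≡ 1ℚ → (recip k - fromℕℚ m * (recip k * recip (m ℕ.+ k))) ≡ recip (m ℕ.+ k)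
  recip-shift k m e = begin-equality
    r - M * (r * s)                  ≡⟨ cong (λ z → z - M * (r * s)) (sym (trans (cong (r *_) (recip-fromℕ (m ℕ.+ k))) (ℚ.*-identityʳ r))) ⟩
    r * (s * fromℕℚ (suc (m ℕ.+ k))) - M * (r * s)
                                     ≡⟨ cong (λ z → r * (s * z) - M * (r * s)) (trans (cong fromℕℚ (sym (ℕ.+-suc m k))) (fromℕℚ-+ m (suc k))) ⟩
    r * (s * (M + N)) - M * (r * s)  ≡⟨ solve 4 (λ r s M N → r :* (s :* (M :+ N)) :- M :* (r :* s) := r :* N :* s) refl r s M N ⟩
    r * N * s                        ≡⟨ trans (cong (_* s) e) (ℚ.*-identityˡ s) ⟩
    s                                ∎
    where
    r = recip k
    s = recip (m ℕ.+ k)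
    M = fromℕℚ m
    N = fromℕℚ (suc k)

-- 1/n, except that recip₀ 0 is 0
recip₀ : ℕ → ℚ
recip₀ zero    = 0ℚ
recip₀ (suc n) = recip n

module _ where
  open ≤ᴿ-Reasoning
  open ℝ-Solver

  -- An index below (n + 1)! encodes the image of the first element and an index below n!, so the
  -- uniform average splits accordingly.
  avgPermutations-suc : ∀ n (F : Permutation′ (suc n) → ℝ) →
    avgPermutations (suc n) F ≃ avg (λ j → avgPermutations n (λ ρ → F (insert zero j ρ)))
  avgPermutations-suc n F = avg-× {suc n} {n !} {{_}} {{n !≢0}} {{suc n !≢0}} (λ (j , k) → F (insert zero j (nthPermutation n k)))

  pairing-insert : ∀ {n} (a b : Fin (suc n) → ℝ) j ρ →
    pairing a b (insert zero j ρ) ≃ a zero *ᴿ b j +ᴿ pairing (a ∘ suc) (b ∘ Fin.punchIn j) ρ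
  pairing-insert a b j ρ = +ᴿ-cong ≃-refl (sumᴿ-cong (λ i → *ᴿ-congˡ (a (suc i)) (≡⇒≃ (cong b (insert-punchIn zero j ρ i)))))

  sumᴿ-punchIn : ∀ {n} (b : Fin (suc n) → ℝ) j → sumᴿ (b ∘ Fin.punchIn j) ≃ sumᴿ b -ᴿ b j
  sumᴿ-punchIn b j = ≃-trans (solve 2 (λ s x → s := x :+ s :- x) ≃-refl (sumᴿ (b ∘ Fin.punchIn j)) (b j))
    (+ᴿ-cong (≃-sym (Sum.sum-remove (CommutativeRing.+-commutativeMonoid ℝ-commutativeRing) {i = j} b)) ≃-refl)

  avg-affine : ∀ {m} .{{_ : ℕ.NonZero m}} (b : Fin m → ℝ) β γ → avg (λ j → β *ᴿ b j +ᴿ γ) ≃ β *ᴿ avg b +ᴿ γ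
  avg-affine b β γ = ≃-trans (avg-+ (λ j → β *ᴿ b j) (λ _ → γ)) (+ᴿ-cong (avg-*ˡ β b) (avg-const γ))

  avg-quadratic : ∀ {m} .{{_ : ℕ.NonZero m}} (b : Fin m → ℝ) α β γ →
    avg (λ j → α *ᴿ (b j *ᴿ b j) +ᴿ (β *ᴿ b j +ᴿ γ)) ≃ α *ᴿ avg (λ j → b j *ᴿ b j) +ᴿ (β *ᴿ avg b +ᴿ γ)
  avg-quadratic b α β γ = ≃-trans (avg-+ (λ j → α *ᴿ (b j *ᴿ b j)) (λ j → β *ᴿ b j +ᴿ γ)) (+ᴿ-cong (avg-*ˡ α (λ j → b j *ᴿ b j)) (avg-affine b β γ))

  avg-pairing-insert : ∀ n (a b : Fin (suc n) → ℝ) j →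
    avgPermutations n (λ ρ → pairing a b (insert zero j ρ)) ≃ a zero *ᴿ b j +ᴿ avgPermutations n (pairing (a ∘ suc) (b ∘ Fin.punchIn j))
  avg-pairing-insert n a b j = ≃-trans (avg-cong {{n !≢0}} (λ k → pairing-insert a b j (nthPermutation n k)))
    (≃-trans (avg-+ {{n !≢0}} (λ _ → a zero *ᴿ b j) (λ k → pairing (a ∘ suc) (b ∘ Fin.punchIn j) (nthPermutation n k)))
      (+ᴿ-cong (avg-const {{n !≢0}} (a zero *ᴿ b j)) ≃-refl))

  -- The factor `sumᴿ a` is kept so that n = 0 is covered: there `recip₀` takes its default 0, but
  -- the sum is empty.
  recip₀-shift : ∀ n (a : Fin n → ℝ) → (fromℚ (recip₀ n) -ᴿ fromℚ (recip₀ n) *ᴿ fromℚ (recip n)) *ᴿ sumᴿ a ≃ fromℚ (recip n) *ᴿ sumᴿ a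
  recip₀-shift zero    a = solve 1 (λ s → (con 0ℚ :- con 0ℚ :* s) :* con 0ℚ := s :* con 0ℚ) ≃-refl (fromℚ (recip 0))
  recip₀-shift (suc n) a = *ᴿ-cong (pointwise⇒≃ λ _ → trans (cong (λ z → recip n - z) (sym (ℚ.*-identityˡ (recip n * recip (suc n))))) (recip-shift n 1 (recip-fromℕ n))) ≃-refl

  -- Given that the first element goes to j, the mean is affine in `b j`: by induction it involves
  -- the remaining values of b only through their sum `sumᴿ b -ᴿ b j`. Averaging over j then
  -- replaces `b j` by the mean of b.
  avgPermutations-pairing : ∀ n (a b : Fin n → ℝ) → avgPermutations n (pairing a b) ≃ fromℚ (recip₀ n) *ᴿ (sumᴿ a *ᴿ sumᴿ b)
  avgPermutations-pairing zero    a b = ≃-trans (avg-const 0ᴿ) (solve 0 (con 0ℚ := con 0ℚ :* (con 0ℚ :* con 0ℚ)) ≃-refl)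
  avgPermutations-pairing (suc n) a b = ≃-trans (avgPermutations-suc n (pairing a b))
    (≃-trans (avg-cong (λ j → ≃-trans (avg-pairing-insert n a b j)
        (≃-trans (+ᴿ-cong ≃-refl (≃-trans (avgPermutations-pairing n (a ∘ suc) (b ∘ Fin.punchIn j))
            (*ᴿ-congˡ (fromℚ (recip₀ n)) (*ᴿ-congˡ (sumᴿ (a ∘ suc)) (sumᴿ-punchIn b j)))))
          (solve 5 (λ x y r A B → x :* y :+ r :* (A :* (B :- y)) := (x :- r :* A) :* y :+ r :* A :* B) ≃-refl
            (a zero) (b j) (fromℚ (recip₀ n)) (sumᴿ (a ∘ suc)) (sumᴿ b)))))
    (≃-trans (avg-affine b (a zero -ᴿ fromℚ (recip₀ n) *ᴿ sumᴿ (a ∘ suc)) (fromℚ (recip₀ n) *ᴿ sumᴿ (a ∘ suc) *ᴿ sumᴿ b))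
    (≃-trans (+ᴿ-cong (*ᴿ-congˡ (a zero -ᴿ fromℚ (recip₀ n) *ᴿ sumᴿ (a ∘ suc)) (≡⇒≃ (avg≡ b))) ≃-refl)
      (collect (a zero) (sumᴿ (a ∘ suc)) (sumᴿ b) (fromℚ (recip₀ n)) (fromℚ (recip n)) (recip₀-shift n (a ∘ suc))))))
    where
    collect : ∀ x A B r s → (r -ᴿ r *ᴿ s) *ᴿ A ≃ s *ᴿ A → (x -ᴿ r *ᴿ A) *ᴿ (s *ᴿ B) +ᴿ r *ᴿ A *ᴿ B ≃ s *ᴿ ((x +ᴿ A) *ᴿ B)
    collect x A B r s e = ≃-trans (solve 5 (λ x A B r s → (x :- r :* A) :* (s :* B) :+ r :* A :* B := s :* x :* B :+ (r :- r :* s) :* A :* B) ≃-refl x A B r s)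
      (≃-trans (+ᴿ-cong ≃-refl (*ᴿ-cong e ≃-refl)) (solve 4 (λ x A B s → s :* x :* B :+ s :* A :* B := s :* ((x :+ A) :* B)) ≃-refl x A B s))

  sumSquares-punchIn : ∀ {n} (b : Fin (suc n) → ℝ) j → sumSquares (b ∘ Fin.punchIn j) ≃ sumSquares b -ᴿ b j *ᴿ b j
  sumSquares-punchIn b j = sumᴿ-punchIn (λ i → b i *ᴿ b i) j

  -- 1 / (n (n - 1)) for n ≥ 2, and 0 below
  recip₂ : ℕ → ℚ
  recip₂ n = recip₀ n * recip₀ (ℕ.pred n)

  -- The sum of a i a j over ordered pairs i ≠ j.
  offDiagonal : ∀ {n} → (Fin n → ℝ) → ℝ
  offDiagonal a = sumᴿ a *ᴿ sumᴿ a -ᴿ sumSquares a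

  -- For n ≤ 1, where `recip₂` takes its default 0, both sides vanish with `offDiagonal a`.
  recip₂-shift : ∀ n (a : Fin n → ℝ) →
    (fromℚ (recip₂ n) -ᴿ fromℕ 2 *ᴿ (fromℚ (recip₂ n) *ᴿ fromℚ (recip n))) *ᴿ offDiagonal a ≃ fromℚ (recip n) *ᴿ fromℚ (recip₀ n) *ᴿ offDiagonal a
  recip₂-shift zero a = solve 1 (λ s → (con 0ℚ :- con (fromℕℚ 2) :* (con 0ℚ :* s)) :* (con 0ℚ :* con 0ℚ :- con 0ℚ) := s :* con 0ℚ :* (con 0ℚ :* con 0ℚ :- con 0ℚ)) ≃-refl (fromℚ (recip 0))
  recip₂-shift (suc zero) a = ≃-trans (*ᴿ-congˡ (fromℚ (recip₂ 1) -ᴿ fromℕ 2 *ᴿ (fromℚ (recip₂ 1) *ᴿ fromℚ (recip 1))) D≃0)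
    (≃-trans (solve 2 (λ x y → x :* con 0ℚ := y :* con 0ℚ) ≃-refl (fromℚ (recip₂ 1) -ᴿ fromℕ 2 *ᴿ (fromℚ (recip₂ 1) *ᴿ fromℚ (recip 1))) (fromℚ (recip 1) *ᴿ fromℚ (recip 0)))
      (*ᴿ-congˡ (fromℚ (recip 1) *ᴿ fromℚ (recip 0)) (≃-sym D≃0)))
    where
    D≃0 : offDiagonal a ≃ 0ᴿ
    D≃0 = solve 1 (λ x → (x :+ con 0ℚ) :* (x :+ con 0ℚ) :- (x :* x :+ con 0ℚ) := con 0ℚ) ≃-refl (a zero)
  recip₂-shift (suc (suc k)) a = *ᴿ-cong (pointwise⇒≃ λ _ → coefficient (recip (suc k)) (recip k) (recip (2 ℕ.+ k)) (recip-shift k 2 (recip-fromℕ k))) ≃-refl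
    where
    module ℚS = +-*-Solver
    coefficient : ∀ r q s → q - fromℕℚ 2 * (q * s) ≡ s → r * q - fromℕℚ 2 * (r * q * s) ≡ s * r
    coefficient r q s e = trans (ℚS.solve 3 (λ r q s → r ℚS.:* q ℚS.:- ℚS.con (fromℕℚ 2) ℚS.:* (r ℚS.:* q ℚS.:* s) ℚS.:= (q ℚS.:- ℚS.con (fromℕℚ 2) ℚS.:* (q ℚS.:* s)) ℚS.:* r) refl r q s) (cong (_* r) e)

  avg-square-insert : ∀ n (a b : Fin (suc n) → ℝ) j →
    avgPermutations n (λ ρ → pairing a b (insert zero j ρ) *ᴿ pairing a b (insert zero j ρ)) ≃
      a zero *ᴿ b j *ᴿ (a zero *ᴿ b j) +ᴿ (fromℕ 2 *ᴿ (a zero *ᴿ b j) *ᴿ avgPermutations n (pairing (a ∘ suc) (b ∘ Fin.punchIn j))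
        +ᴿ avgPermutations n (λ ρ → pairing (a ∘ suc) (b ∘ Fin.punchIn j) ρ *ᴿ pairing (a ∘ suc) (b ∘ Fin.punchIn j) ρ))
  avg-square-insert n a b j = ≃-trans (avg-cong {{n !≢0}} (λ k → ≃-trans (*ᴿ-cong (pairing-insert a b j (nthPermutation n k)) (pairing-insert a b j (nthPermutation n k)))
      (solve 2 (λ u p → (u :+ p) :* (u :+ p) := u :* u :+ (con (fromℕℚ 2) :* u :* p :+ p :* p)) ≃-refl (a zero *ᴿ b j) (pairing (a ∘ suc) (b ∘ Fin.punchIn j) (nthPermutation n k)))))
    (≃-trans (avg-+ {{n !≢0}} (λ _ → a zero *ᴿ b j *ᴿ (a zero *ᴿ b j)) (λ k → fromℕ 2 *ᴿ (a zero *ᴿ b j) *ᴿ P k +ᴿ P k *ᴿ P k))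
    (+ᴿ-cong (avg-const {{n !≢0}} (a zero *ᴿ b j *ᴿ (a zero *ᴿ b j)))
      (≃-trans (avg-+ {{n !≢0}} (λ k → fromℕ 2 *ᴿ (a zero *ᴿ b j) *ᴿ P k) (λ k → P k *ᴿ P k))
        (+ᴿ-cong (avg-*ˡ {{n !≢0}} (fromℕ 2 *ᴿ (a zero *ᴿ b j)) P) ≃-refl))))
    where
    P : Fin (n !) → ℝ
    P k = pairing (a ∘ suc) (b ∘ Fin.punchIn j) (nthPermutation n k)

  -- The two terms reflect that each image is uniform and that the images of two distinct elements
  -- are uniform over n (n - 1) ordered pairs. The proof recurses on the first image j: the
  -- conditional second moment is a quadratic polynomial in `b j`, and its average over j involves
  -- only the sums of b and of its squares.
  avgPermutations-pairing² : ∀ n (a b : Fin n → ℝ) → avgPermutations n (λ π → pairing a b π *ᴿ pairing a b π) ≃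
    fromℚ (recip₀ n) *ᴿ (sumSquares a *ᴿ sumSquares b) +ᴿ fromℚ (recip₂ n) *ᴿ (offDiagonal a *ᴿ offDiagonal b)
  avgPermutations-pairing² zero    a b = ≃-trans (avg-const (0ᴿ *ᴿ 0ᴿ))
    (solve 0 (con 0ℚ :* con 0ℚ := con 0ℚ :* (con 0ℚ :* con 0ℚ) :+ con 0ℚ :* ((con 0ℚ :* con 0ℚ :- con 0ℚ) :* (con 0ℚ :* con 0ℚ :- con 0ℚ))) ≃-refl)
  avgPermutations-pairing² (suc n) a b = ≃-trans (avgPermutations-suc n (λ π → pairing a b π *ᴿ pairing a b π))
    (≃-trans (avg-cong (λ j → ≃-trans (avg-square-insert n a b j) (≃-trans (+ᴿ-cong ≃-refl (+ᴿ-cong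
        (*ᴿ-congˡ (fromℕ 2 *ᴿ (a zero *ᴿ b j)) (≃-trans (avgPermutations-pairing n (a ∘ suc) (b ∘ Fin.punchIn j))
          (*ᴿ-congˡ (fromℚ (recip₀ n)) (*ᴿ-congˡ (sumᴿ (a ∘ suc)) (sumᴿ-punchIn b j)))))
        (≃-trans (avgPermutations-pairing² n (a ∘ suc) (b ∘ Fin.punchIn j))
          (+ᴿ-cong (*ᴿ-congˡ (fromℚ (recip₀ n)) (*ᴿ-congˡ (sumSquares (a ∘ suc)) (sumSquares-punchIn b j)))
            (*ᴿ-congˡ (fromℚ (recip₂ n)) (*ᴿ-congˡ (offDiagonal (a ∘ suc))
              (+ᴿ-cong (*ᴿ-cong (sumᴿ-punchIn b j) (sumᴿ-punchIn b j)) (-ᴿ-cong (sumSquares-punchIn b j)))))))))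
      (quadratic (a zero) (b j) (sumᴿ (a ∘ suc)) (sumᴿ b) (sumSquares (a ∘ suc)) (sumSquares b) (fromℚ (recip₀ n)) (fromℚ (recip₂ n)) (offDiagonal (a ∘ suc))))))
    (≃-trans (avg-quadratic b _ _ _)
    (≃-trans (+ᴿ-cong (*ᴿ-congˡ _ (≡⇒≃ (avg≡ (λ j → b j *ᴿ b j)))) (+ᴿ-cong (*ᴿ-congˡ _ (≡⇒≃ (avg≡ b))) ≃-refl))
    (≃-trans (collect (a zero) (sumᴿ (a ∘ suc)) (sumᴿ b) (sumSquares (a ∘ suc)) (sumSquares b) (fromℚ (recip₀ n)) (fromℚ (recip₂ n)) (fromℚ (recip n)) (offDiagonal (a ∘ suc))
        (recip₀-shift n (λ i → a (suc i) *ᴿ a (suc i))) (recip₂-shift n (a ∘ suc)))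
    (≃-trans (final (a zero) (sumᴿ (a ∘ suc)) (sumᴿ b) (sumSquares (a ∘ suc)) (sumSquares b) (fromℚ (recip n)) (fromℚ (recip₀ n)))
      (+ᴿ-cong ≃-refl (*ᴿ-cong (pointwise⇒≃ λ _ → refl) ≃-refl)))))))
    where
    -- Coefficients of the conditional second moment in y = b j, with x = a 0. A, A₂ and D are the
    -- sum, the sum of squares and the off-diagonal sum of the rest of a; B and B₂ belong to all of
    -- b; r and c stand for `recip₀ n` and `recip₂ n`.
    α β γ : (x A B A₂ B₂ r c D : ℝ) → ℝ
    α x A B A₂ B₂ r c D = x *ᴿ x -ᴿ fromℕ 2 *ᴿ x *ᴿ r *ᴿ A -ᴿ r *ᴿ A₂ +ᴿ fromℕ 2 *ᴿ c *ᴿ D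
    β x A B A₂ B₂ r c D = fromℕ 2 *ᴿ x *ᴿ r *ᴿ A *ᴿ B -ᴿ fromℕ 2 *ᴿ c *ᴿ D *ᴿ B
    γ x A B A₂ B₂ r c D = r *ᴿ A₂ *ᴿ B₂ +ᴿ c *ᴿ D *ᴿ (B *ᴿ B -ᴿ B₂)

    quadratic : ∀ x y A B A₂ B₂ r c D →
      x *ᴿ y *ᴿ (x *ᴿ y) +ᴿ (fromℕ 2 *ᴿ (x *ᴿ y) *ᴿ (r *ᴿ (A *ᴿ (B -ᴿ y)))
        +ᴿ (r *ᴿ (A₂ *ᴿ (B₂ -ᴿ y *ᴿ y)) +ᴿ c *ᴿ (D *ᴿ ((B -ᴿ y) *ᴿ (B -ᴿ y) -ᴿ (B₂ -ᴿ y *ᴿ y))))) ≃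
      α x A B A₂ B₂ r c D *ᴿ (y *ᴿ y) +ᴿ (β x A B A₂ B₂ r c D *ᴿ y +ᴿ γ x A B A₂ B₂ r c D)
    quadratic = solve 9 (λ x y A B A₂ B₂ r c D →
      x :* y :* (x :* y) :+ (con (fromℕℚ 2) :* (x :* y) :* (r :* (A :* (B :- y)))
        :+ (r :* (A₂ :* (B₂ :- y :* y)) :+ c :* (D :* ((B :- y) :* (B :- y) :- (B₂ :- y :* y)))))
      := (x :* x :- con (fromℕℚ 2) :* x :* r :* A :- r :* A₂ :+ con (fromℕℚ 2) :* c :* D) :* (y :* y)
        :+ ((con (fromℕℚ 2) :* x :* r :* A :* B :- con (fromℕℚ 2) :* c :* D :* B) :* y :+ (r :* A₂ :* B₂ :+ c :* D :* (B :* B :- B₂)))) ≃-refl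

    collect : ∀ x A B A₂ B₂ r c s D → (r -ᴿ r *ᴿ s) *ᴿ A₂ ≃ s *ᴿ A₂ → (c -ᴿ fromℕ 2 *ᴿ (c *ᴿ s)) *ᴿ D ≃ s *ᴿ r *ᴿ D →
      α x A B A₂ B₂ r c D *ᴿ (s *ᴿ B₂) +ᴿ (β x A B A₂ B₂ r c D *ᴿ (s *ᴿ B) +ᴿ γ x A B A₂ B₂ r c D) ≃
      s *ᴿ x *ᴿ x *ᴿ B₂ +ᴿ fromℕ 2 *ᴿ x *ᴿ r *ᴿ s *ᴿ A *ᴿ (B *ᴿ B -ᴿ B₂) +ᴿ s *ᴿ A₂ *ᴿ B₂ +ᴿ s *ᴿ r *ᴿ D *ᴿ (B *ᴿ B -ᴿ B₂)
    collect x A B A₂ B₂ r c s D e f = ≃-trans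
      (solve 9 (λ x A B A₂ B₂ r c s D →
        (x :* x :- con (fromℕℚ 2) :* x :* r :* A :- r :* A₂ :+ con (fromℕℚ 2) :* c :* D) :* (s :* B₂)
          :+ ((con (fromℕℚ 2) :* x :* r :* A :* B :- con (fromℕℚ 2) :* c :* D :* B) :* (s :* B) :+ (r :* A₂ :* B₂ :+ c :* D :* (B :* B :- B₂)))
        := s :* x :* x :* B₂ :+ con (fromℕℚ 2) :* x :* r :* s :* A :* (B :* B :- B₂) :+ (r :- r :* s) :* A₂ :* B₂ :+ (c :- con (fromℕℚ 2) :* (c :* s)) :* D :* (B :* B :- B₂))
        ≃-refl x A B A₂ B₂ r c s D)
      (+ᴿ-cong (+ᴿ-cong ≃-refl (*ᴿ-cong e ≃-refl)) (*ᴿ-cong f ≃-refl))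

    final : ∀ x A B A₂ B₂ s r →
      s *ᴿ x *ᴿ x *ᴿ B₂ +ᴿ fromℕ 2 *ᴿ x *ᴿ r *ᴿ s *ᴿ A *ᴿ (B *ᴿ B -ᴿ B₂) +ᴿ s *ᴿ A₂ *ᴿ B₂ +ᴿ s *ᴿ r *ᴿ (A *ᴿ A -ᴿ A₂) *ᴿ (B *ᴿ B -ᴿ B₂) ≃
      s *ᴿ ((x *ᴿ x +ᴿ A₂) *ᴿ B₂) +ᴿ (s *ᴿ r) *ᴿ (((x +ᴿ A) *ᴿ (x +ᴿ A) -ᴿ (x *ᴿ x +ᴿ A₂)) *ᴿ (B *ᴿ B -ᴿ B₂))
    final = solve 7 (λ x A B A₂ B₂ s r →
      s :* x :* x :* B₂ :+ con (fromℕℚ 2) :* x :* r :* s :* A :* (B :* B :- B₂) :+ s :* A₂ :* B₂ :+ s :* r :* (A :* A :- A₂) :* (B :* B :- B₂)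
      := s :* ((x :* x :+ A₂) :* B₂) :+ (s :* r) :* (((x :+ A) :* (x :+ A) :- (x :* x :+ A₂)) :* (B :* B :- B₂))) ≃-refl

-- The statistic ½ Σ εᵢ ε_{π i} with alternating signs

sgn : ∀ {n} → Fin n → ℝ
sgn zero    = 1ᴿ
sgn (suc i) = -ᴿ sgn i

statistic : ∀ {n} → Permutation′ n → ℝ
statistic π = fromℚ ½ *ᴿ pairing sgn sgn π

module _ where
  open ≤ᴿ-Reasoning
  open ℝ-Solver

  sgn² : ∀ {n} (i : Fin n) → sgn i *ᴿ sgn i ≃ 1ᴿ
  sgn² zero    = solve 0 (con 1ℚ :* con 1ℚ := con 1ℚ) ≃-refl
  sgn² (suc i) = ≃-trans (solve 1 (λ x → :- x :* :- x := x :* x) ≃-refl (sgn i)) (sgn² i)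

  sumSquares-sgn : ∀ n → sumSquares (sgn {n}) ≃ fromℕ n
  sumSquares-sgn n = ≃-trans (sumᴿ-cong (sgn² {n})) (≃-trans (sumᴿ-const n 1ᴿ) (solve 1 (λ x → x :* con 1ℚ := x) ≃-refl (fromℕ n)))

  sumᴿ-neg : ∀ {n} (f : Fin n → ℝ) → sumᴿ (λ i → -ᴿ f i) ≃ -ᴿ sumᴿ f
  sumᴿ-neg f = ≃-trans (sumᴿ-cong (λ i → solve 1 (λ x → :- x := con (- 1ℚ) :* x) ≃-refl (f i)))
    (≃-trans (sumᴿ-*ˡ (fromℚ (- 1ℚ)) f) (solve 1 (λ x → con (- 1ℚ) :* x := :- x) ≃-refl (sumᴿ f)))

  sum-sgn : ∀ n → sumᴿ (sgn {n}) ≃ fromℚ 0ℚ ⊎ sumᴿ (sgn {n}) ≃ fromℚ 1ℚ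
  sum-sgn zero    = inj₁ ≃-refl
  sum-sgn (suc n) with sum-sgn n
  ... | inj₁ e = inj₂ (≃-trans (+ᴿ-cong ≃-refl (≃-trans (sumᴿ-neg (sgn {n})) (-ᴿ-cong e))) (solve 0 (con 1ℚ :+ :- con 0ℚ := con 1ℚ) ≃-refl))
  ... | inj₂ e = inj₁ (≃-trans (+ᴿ-cong ≃-refl (≃-trans (sumᴿ-neg (sgn {n})) (-ᴿ-cong e))) (solve 0 (con 1ℚ :+ :- con 1ℚ := con 0ℚ) ≃-refl))

  variance-formula : ∀ {m} .{{_ : ℕ.NonZero m}} (X : Fin m → ℝ) → variance X ≃ avg (λ i → X i *ᴿ X i) -ᴿ avg X *ᴿ avg X
  variance-formula X = expand (avg X) ≃-refl
    where
    expand : ∀ a → avg X ≃ a → avg (λ i → (X i -ᴿ a) *ᴿ (X i -ᴿ a)) ≃ avg (λ i → X i *ᴿ X i) -ᴿ a *ᴿ a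
    expand a e = ≃-trans (avg-cong (λ i → solve 2 (λ x a → (x :- a) :* (x :- a) := x :* x :+ (:- (con (fromℕℚ 2) :* a) :* x :+ a :* a)) ≃-refl (X i) a))
      (≃-trans (avg-+ (λ i → X i *ᴿ X i) (λ i → (-ᴿ (fromℕ 2 *ᴿ a)) *ᴿ X i +ᴿ a *ᴿ a))
      (≃-trans (+ᴿ-cong ≃-refl (≃-trans (avg-affine X (-ᴿ (fromℕ 2 *ᴿ a)) (a *ᴿ a)) (+ᴿ-cong (*ᴿ-congˡ (-ᴿ (fromℕ 2 *ᴿ a)) e) ≃-refl)))
        (solve 2 (λ m a → m :+ (:- (con (fromℕℚ 2) :* a) :* a :+ a :* a) := m :- a :* a) ≃-refl (avg (λ i → X i *ᴿ X i)) a)))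

  avg-scaled² : ∀ {m} .{{_ : ℕ.NonZero m}} (p : Fin m → ℝ) → avg (λ k → fromℚ ½ *ᴿ p k *ᴿ (fromℚ ½ *ᴿ p k)) ≃ fromℚ (+ 1 / 4) *ᴿ avg (λ k → p k *ᴿ p k)
  avg-scaled² p = ≃-trans (avg-cong (λ k → solve 1 (λ p → con ½ :* p :* (con ½ :* p) := con (+ 1 / 4) :* (p :* p)) ≃-refl (p k))) (avg-*ˡ (fromℚ (+ 1 / 4)) (λ k → p k *ᴿ p k))

  -- Second moment minus squared mean of the pairing at a = b = `sgn`, where s is the sum of the
  -- signs and n the sum of their squares. The outer 1/4 comes from the factor ½ of `statistic`.
  statisticVariance : ℕ → ℚ → ℚ
  statisticVariance n s = + 1 / 4 * (recip₀ n * (fromℕℚ n * fromℕℚ n) + recip₂ n * ((s * s - fromℕℚ n) * (s * s - fromℕℚ n)) - recip₀ n * (s * s) * (recip₀ n * (s * s)))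

  variance-statistic : ∀ n {s} → sumᴿ (sgn {n}) ≃ fromℚ s → variance {{n !≢0}} (λ k → statistic (nthPermutation n k)) ≃ fromℚ (statisticVariance n s)
  variance-statistic n {s} A≃s = ≃-trans (variance-formula {{n !≢0}} (λ k → statistic (nthPermutation n k)))
    (≃-trans (+ᴿ-cong
        (≃-trans (avg-scaled² {{n !≢0}} p) (*ᴿ-congˡ (fromℚ (+ 1 / 4)) (≃-trans (avgPermutations-pairing² n sgn sgn)
          (+ᴿ-cong (*ᴿ-congˡ (fromℚ (recip₀ n)) (*ᴿ-cong (sumSquares-sgn n) (sumSquares-sgn n))) (*ᴿ-congˡ (fromℚ (recip₂ n)) (*ᴿ-cong D≃ D≃))))))
        (-ᴿ-cong (*ᴿ-cong mean≃ mean≃)))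
    (≃-trans (combine (fromℚ (recip₀ n) *ᴿ (fromℕ n *ᴿ fromℕ n)) (fromℚ (recip₂ n) *ᴿ ((fromℚ s *ᴿ fromℚ s -ᴿ fromℕ n) *ᴿ (fromℚ s *ᴿ fromℚ s -ᴿ fromℕ n))) (fromℚ (recip₀ n) *ᴿ (fromℚ s *ᴿ fromℚ s)))
      (pointwise⇒≃ λ _ → refl)))
    where
    p : Fin (n !) → ℝ
    p k = pairing sgn sgn (nthPermutation n k)
    D≃ : offDiagonal (sgn {n}) ≃ fromℚ s *ᴿ fromℚ s -ᴿ fromℕ n
    D≃ = +ᴿ-cong (*ᴿ-cong A≃s A≃s) (-ᴿ-cong (sumSquares-sgn n))
    mean≃ : avg {{n !≢0}} (λ k → statistic (nthPermutation n k)) ≃ fromℚ ½ *ᴿ (fromℚ (recip₀ n) *ᴿ (fromℚ s *ᴿ fromℚ s))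
    mean≃ = ≃-trans (avg-*ˡ {{n !≢0}} (fromℚ ½) p) (*ᴿ-congˡ (fromℚ ½) (≃-trans (avgPermutations-pairing n sgn sgn) (*ᴿ-congˡ (fromℚ (recip₀ n)) (*ᴿ-cong A≃s A≃s))))
    combine : ∀ x y z → fromℚ (+ 1 / 4) *ᴿ (x +ᴿ y) -ᴿ fromℚ ½ *ᴿ z *ᴿ (fromℚ ½ *ᴿ z) ≃ fromℚ (+ 1 / 4) *ᴿ (x +ᴿ y -ᴿ z *ᴿ z)
    combine = solve 3 (λ x y z → con (+ 1 / 4) :* (x :+ y) :- con ½ :* z :* (con ½ :* z) := con (+ 1 / 4) :* (x :+ y :- z :* z)) ≃-refl

module _ where
  open ℚ.≤-Reasoning
  open +-*-Solver

  p<p+q : ∀ p {q} → 0ℚ ℚ.< q → p ℚ.< p + q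
  p<p+q p {q} 0<q = subst (ℚ._< p + q) (ℚ.+-identityʳ p) (ℚ.+-monoʳ-< p 0<q)

  recip>0 : ∀ k → 0ℚ ℚ.< recip k
  recip>0 k = ℚ.positive⁻¹ (recip k) {{ℚ.normalize-pos 1 (suc k)}}

  fromℕℚ-/4 : ∀ n → + n / 4 ≡ + 1 / 4 * fromℕℚ n
  fromℕℚ-/4 n = ℚ.toℚᵘ-injective (R.begin
    ℚ.toℚᵘ (+ n / 4)                                R.≈⟨ ℚ.toℚᵘ-fromℚᵘ (ℚᵘ.mkℚᵘ (+ n) 3) ⟩
    ℚᵘ.mkℚᵘ (+ n) 3                                 R.≈⟨ ℚᵘ.*≡* (cong (ℤ._* + 4) (sym (ℤ.*-identityˡ (+ n)))) ⟩
    ℚᵘ.mkℚᵘ (+ 1) 3 ℚᵘ.* ℚᵘ.mkℚᵘ (+ n) 0            R.≈⟨ ℚᵘ.*-cong (ℚᵘ.≃-refl {ℚᵘ.mkℚᵘ (+ 1) 3}) (ℚᵘ.≃-sym (toℚᵘ-fromℕℚ n)) ⟩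
    ℚ.toℚᵘ (+ 1 / 4) ℚᵘ.* ℚ.toℚᵘ (fromℕℚ n)         R.≈⟨ ℚᵘ.≃-sym (ℚ.toℚᵘ-homo-* (+ 1 / 4) (fromℕℚ n)) ⟩
    ℚ.toℚᵘ (+ 1 / 4 * fromℕℚ n)                     R.∎)
    where module R = ℚᵘ.≃-Reasoning

  quarter-mono-< : ∀ {p q} → p ℚ.< q → + 1 / 4 * p ℚ.< + 1 / 4 * q
  quarter-mono-< = ℚ.*-monoʳ-<-pos (+ 1 / 4)

  -- At s = 0 four times the variance is n + n / (n - 1).
  n/4<statisticVariance-0 : ∀ k → + (2 ℕ.+ k) / 4 ℚ.< statisticVariance (2 ℕ.+ k) 0ℚ
  n/4<statisticVariance-0 k = begin-strict
    + (2 ℕ.+ k) / 4                    ≡⟨ fromℕℚ-/4 (2 ℕ.+ k) ⟩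
    + 1 / 4 * N                        <⟨ quarter-mono-< (p<p+q N (ℚ.positive⁻¹ (q * N) {{ℚ.pos*pos⇒pos q {{positive (recip>0 k)}} N {{fromℕℚ-suc-pos (suc k)}}}})) ⟩
    + 1 / 4 * (N + q * N)              ≡⟨ cong (+ 1 / 4 *_) (solve 2 (λ N q → N :+ q :* N := con 1ℚ :* N :+ con 1ℚ :* (q :* N)) refl N q) ⟩
    + 1 / 4 * (1ℚ * N + 1ℚ * (q * N))  ≡⟨ cong (λ z → + 1 / 4 * (z * N + z * (q * N))) (sym (recip-fromℕ (suc k))) ⟩
    + 1 / 4 * (r * N * N + r * N * (q * N))
      ≡⟨ cong (+ 1 / 4 *_) (solve 3 (λ r q N → r :* N :* N :+ r :* N :* (q :* N)
           := r :* (N :* N) :+ r :* q :* ((con 0ℚ :* con 0ℚ :- N) :* (con 0ℚ :* con 0ℚ :- N)) :- r :* (con 0ℚ :* con 0ℚ) :* (r :* (con 0ℚ :* con 0ℚ))) refl r q N) ⟩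
    statisticVariance (2 ℕ.+ k) 0ℚ     ∎
    where
    N = fromℕℚ (2 ℕ.+ k)
    r = recip (suc k)
    q = recip k

  -- At s = 1 four times the variance is n + 1 - 1 / n - 1 / n², and 1 / n ≤ ½ leaves an excess of
  -- at least 1/4.
  n/4<statisticVariance-1 : ∀ k → + (2 ℕ.+ k) / 4 ℚ.< statisticVariance (2 ℕ.+ k) 1ℚ
  n/4<statisticVariance-1 k = begin-strict
    + (2 ℕ.+ k) / 4                    ≡⟨ fromℕℚ-/4 (2 ℕ.+ k) ⟩
    + 1 / 4 * N                        <⟨ quarter-mono-< (p<p+q N 0<gap′) ⟩
    + 1 / 4 * (N + (1ℚ - (r + r * r))) ≡⟨ cong (+ 1 / 4 *_) regroup ⟩
    statisticVariance (2 ℕ.+ k) 1ℚ     ∎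
    where
    N = fromℕℚ (2 ℕ.+ k)
    M = fromℕℚ (suc k)
    r = recip (suc k)
    q = recip k
    r≤½ : r ℚ.≤ ½
    r≤½ = recip-antitone {1} {suc k} (ℕ.s≤s ℕ.z≤n)
    0<gap′ : 0ℚ ℚ.< 1ℚ - (r + r * r)
    0<gap′ = ℚ.<-≤-trans (ℚ.positive⁻¹ (+ 1 / 4)) (ℚ.+-monoʳ-≤ 1ℚ (ℚ.neg-antimono-≤ (ℚ.+-mono-≤ r≤½ (*-mono {r} {½} {r} {½} (recip≥0 (suc k)) (recip≥0 1) r≤½ r≤½))))
    N≡1+M : N ≡ 1ℚ + M
    N≡1+M = fromℕℚ-+ 1 (suc k)
    regroup : N + (1ℚ - (r + r * r)) ≡ r * (N * N) + r * q * ((1ℚ * 1ℚ - N) * (1ℚ * 1ℚ - N)) - r * (1ℚ * 1ℚ) * (r * (1ℚ * 1ℚ))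
    regroup = begin-equality
      N + (1ℚ - (r + r * r))
        ≡⟨ solve 2 (λ N r → N :+ (con 1ℚ :- (r :+ r :* r)) := con 1ℚ :* N :+ (con 1ℚ :- r :* con 1ℚ) :- r :* r) refl N r ⟩
      1ℚ * N + (1ℚ - r * 1ℚ) - r * r
        ≡⟨ cong (λ z → z * N + (z - r * 1ℚ) - r * r) (sym (recip-fromℕ (suc k))) ⟩
      r * N * N + (r * N - r * 1ℚ) - r * r
        ≡⟨ cong (λ z → r * N * N + z - r * r) (trans (cong (λ z → r * z - r * 1ℚ) N≡1+M)
             (solve 2 (λ r M → r :* (con 1ℚ :+ M) :- r :* con 1ℚ := r :* (con 1ℚ :* M)) refl r M)) ⟩
      r * N * N + r * (1ℚ * M) - r * r
        ≡⟨ cong (λ z → r * N * N + r * (z * M) - r * r) (sym (recip-fromℕ k)) ⟩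
      r * N * N + r * (q * M * M) - r * r
        ≡⟨ cong (λ z → r * N * N + r * (q * z * z) - r * r) (trans (solve 1 (λ M → M := con 1ℚ :+ M :- con 1ℚ) refl M) (cong (λ z → z - 1ℚ) (sym N≡1+M))) ⟩
      r * N * N + r * (q * (N - 1ℚ) * (N - 1ℚ)) - r * r
        ≡⟨ solve 3 (λ N r q → r :* N :* N :+ r :* (q :* (N :- con 1ℚ) :* (N :- con 1ℚ)) :- r :* r
             := r :* (N :* N) :+ r :* q :* ((con 1ℚ :* con 1ℚ :- N) :* (con 1ℚ :* con 1ℚ :- N)) :- r :* (con 1ℚ :* con 1ℚ) :* (r :* (con 1ℚ :* con 1ℚ))) refl N r q ⟩
      r * (N * N) + r * q * ((1ℚ * 1ℚ - N) * (1ℚ * 1ℚ - N)) - r * (1ℚ * 1ℚ) * (r * (1ℚ * 1ℚ)) ∎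

module _ where
  open ≤ᴿ-Reasoning
  open ℝ-Solver

  statistic-variance>n/4 : ∀ {n} → 2 ≤ n → ∃ λ v → + n / 4 ℚ.< v × variance {{n !≢0}} (λ k → statistic (nthPermutation n k)) ≃ fromℚ v
  statistic-variance>n/4 {suc (suc k)} (ℕ.s≤s (ℕ.s≤s _)) = cases (sum-sgn (suc (suc k)))
    where
    cases : sumᴿ (sgn {2 ℕ.+ k}) ≃ fromℚ 0ℚ ⊎ sumᴿ (sgn {2 ℕ.+ k}) ≃ fromℚ 1ℚ →
      ∃ λ v → + (2 ℕ.+ k) / 4 ℚ.< v × variance {{(2 ℕ.+ k) !≢0}} (λ i → statistic (nthPermutation (2 ℕ.+ k) i)) ≃ fromℚ v
    cases (inj₁ e) = statisticVariance (2 ℕ.+ k) 0ℚ , n/4<statisticVariance-0 k , variance-statistic (2 ℕ.+ k) e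
    cases (inj₂ e) = statisticVariance (2 ℕ.+ k) 1ℚ , n/4<statisticVariance-1 k , variance-statistic (2 ℕ.+ k) e

  sumᴿ≤count : ∀ {n} {A : Set} {P : A → Set} (P? : Decidable P) (f : Fin n → A) (c : Fin n → ℝ) →
    (∀ i → P (f i) → c i ≤ᴿ 1ᴿ) → (∀ i → ¬ P (f i) → c i ≤ᴿ 0ᴿ) → sumᴿ c ≤ᴿ fromℕ (length (filter P? (tabulate f)))
  sumᴿ≤count {zero}  P? f c h₁ h₀ = ≤ᴿ-refl
  sumᴿ≤count {suc n} P? f c h₁ h₀ with P? (f zero)
  ... | yes p = ≤ᴿ-trans (+ᴿ-mono-≤ (h₁ zero p) (sumᴿ≤count P? (f ∘ suc) (c ∘ suc) (h₁ ∘ suc) (h₀ ∘ suc)))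
    (pointwise⇒≤ᴿ λ _ → ℚ.≤-reflexive (sym (fromℕℚ-+ 1 (length (filter P? (tabulate (f ∘ suc)))))))
  ... | no ¬p = ≤ᴿ-trans (+ᴿ-mono-≤ (h₀ zero ¬p) (sumᴿ≤count P? (f ∘ suc) (c ∘ suc) (h₁ ∘ suc) (h₀ ∘ suc)))
    (proj₁ (solve 1 (λ x → con 0ℚ :+ x := x) ≃-refl (fromℕ (length (filter P? (tabulate (f ∘ suc)))))))

  ∣∣ᴿ≤ : ∀ {x y} → x ≤ᴿ y → (-ᴿ x) ≤ᴿ y → ∣ x ∣ᴿ ≤ᴿ y
  ∣∣ᴿ≤ x≤y -x≤y = mk≤ᴿ λ 0<ε →
    let M , p = within x≤y 0<ε
        N , q = within -x≤y 0<ε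
    in M ℕ.⊔ N , λ le → ∣p∣≤ (p (ℕ.m⊔n≤o⇒m≤o M N le)) (q (ℕ.m⊔n≤o⇒n≤o M N le))

  -- Signs enter only through their squares: (s - u)² + (s + v)² = 4 - 2 s (u - v) is nonnegative.
  half-difference≤1 : ∀ s u v → s *ᴿ s ≃ 1ᴿ → u *ᴿ u ≃ 1ᴿ → v *ᴿ v ≃ 1ᴿ → fromℚ ½ *ᴿ (s *ᴿ (u -ᴿ v)) ≤ᴿ 1ᴿ
  half-difference≤1 s u v s² u² v² = 0≤-⇒≤ (begin
    0ᴿ
      ≃⟨ solve 0 (con 0ℚ := con (+ 1 / 4) :* (con 0ℚ :+ con 0ℚ)) ≃-refl ⟩
    fromℚ (+ 1 / 4) *ᴿ (0ᴿ +ᴿ 0ᴿ)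
      ≤⟨ *ᴿ-monoˡ-≤ (fromℚ-mono (recip≥0 3)) (+ᴿ-mono-≤ (squareᴿ-nonNeg (s -ᴿ u)) (squareᴿ-nonNeg (s +ᴿ v))) ⟩
    fromℚ (+ 1 / 4) *ᴿ ((s -ᴿ u) *ᴿ (s -ᴿ u) +ᴿ (s +ᴿ v) *ᴿ (s +ᴿ v))
      ≃⟨ solve 3 (λ s u v → con (+ 1 / 4) :* ((s :- u) :* (s :- u) :+ (s :+ v) :* (s :+ v))
           := con (+ 1 / 4) :* (con (fromℕℚ 2) :* (s :* s) :+ u :* u :+ v :* v) :- con ½ :* (s :* (u :- v))) ≃-refl s u v ⟩
    fromℚ (+ 1 / 4) *ᴿ (fromℕ 2 *ᴿ (s *ᴿ s) +ᴿ u *ᴿ u +ᴿ v *ᴿ v) -ᴿ fromℚ ½ *ᴿ (s *ᴿ (u -ᴿ v))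
      ≃⟨ +ᴿ-cong (*ᴿ-congˡ (fromℚ (+ 1 / 4)) (+ᴿ-cong (+ᴿ-cong (*ᴿ-congˡ (fromℕ 2) s²) u²) v²)) ≃-refl ⟩
    fromℚ (+ 1 / 4) *ᴿ (fromℕ 2 *ᴿ 1ᴿ +ᴿ 1ᴿ +ᴿ 1ᴿ) -ᴿ fromℚ ½ *ᴿ (s *ᴿ (u -ᴿ v))
      ≃⟨ solve 1 (λ x → con (+ 1 / 4) :* (con (fromℕℚ 2) :* con 1ℚ :+ con 1ℚ :+ con 1ℚ) :- x := con 1ℚ :- x) ≃-refl (fromℚ ½ *ᴿ (s *ᴿ (u -ᴿ v))) ⟩
    1ᴿ -ᴿ fromℚ ½ *ᴿ (s *ᴿ (u -ᴿ v)) ∎)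

  -- Positions where π and ρ agree cancel, and every other one contributes at most 1; the factor ½
  -- in `statistic` is chosen for this.
  statistic-difference : ∀ {n} (π ρ : Permutation′ n) → statistic π -ᴿ statistic ρ ≤ᴿ fromℕ (hamming π ρ)
  statistic-difference {n} π ρ = ≤ᴿ-trans (proj₁ rewritten)
    (sumᴿ≤count (λ i → ¬? (π ⟨$⟩ʳ i Fin.≟ ρ ⟨$⟩ʳ i)) id c
      (λ i _ → half-difference≤1 (sgn i) (sgn (π ⟨$⟩ʳ i)) (sgn (ρ ⟨$⟩ʳ i)) (sgn² i) (sgn² (π ⟨$⟩ʳ i)) (sgn² (ρ ⟨$⟩ʳ i)))
      (λ i ¬≢ → proj₁ (equal i (decidable-stable (π ⟨$⟩ʳ i Fin.≟ ρ ⟨$⟩ʳ i) ¬≢))))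
    where
    c : Fin n → ℝ
    c i = fromℚ ½ *ᴿ (sgn i *ᴿ (sgn (π ⟨$⟩ʳ i) -ᴿ sgn (ρ ⟨$⟩ʳ i)))

    equal : ∀ i → π ⟨$⟩ʳ i ≡ ρ ⟨$⟩ʳ i → c i ≃ 0ᴿ
    equal i e = ≃-trans (*ᴿ-congˡ (fromℚ ½) (*ᴿ-congˡ (sgn i) (+ᴿ-cong (≡⇒≃ (cong sgn e)) ≃-refl)))
      (solve 2 (λ s u → con ½ :* (s :* (u :- u)) := con 0ℚ) ≃-refl (sgn i) (sgn (ρ ⟨$⟩ʳ i)))

    rewritten : statistic π -ᴿ statistic ρ ≃ sumᴿ c
    rewritten = ≃-trans (solve 2 (λ p q → con ½ :* p :- con ½ :* q := con ½ :* (p :+ :- q)) ≃-refl (pairing sgn sgn π) (pairing sgn sgn ρ))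
      (≃-sym (≃-trans (sumᴿ-*ˡ (fromℚ ½) (λ i → sgn i *ᴿ (sgn (π ⟨$⟩ʳ i) -ᴿ sgn (ρ ⟨$⟩ʳ i)))) (*ᴿ-congˡ (fromℚ ½)
        (≃-trans (sumᴿ-cong (λ i → solve 3 (λ s u v → s :* (u :- v) := s :* u :+ :- (s :* v)) ≃-refl (sgn i) (sgn (π ⟨$⟩ʳ i)) (sgn (ρ ⟨$⟩ʳ i))))
          (≃-trans (sumᴿ-+ (λ i → sgn i *ᴿ sgn (π ⟨$⟩ʳ i)) (λ i → -ᴿ (sgn i *ᴿ sgn (ρ ⟨$⟩ʳ i))))
            (+ᴿ-cong ≃-refl (sumᴿ-neg (λ i → sgn i *ᴿ sgn (ρ ⟨$⟩ʳ i)))))))))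

  statistic-lipschitz : ∀ n → IsLipschitz (S n) statistic
  statistic-lipschitz n π ρ = ∣∣ᴿ≤ (statistic-difference π ρ)
    (≤ᴿ-trans (proj₁ (solve 2 (λ x y → :- (x :- y) := y :- x) ≃-refl (statistic π) (statistic ρ)))
      (≤ᴿ-trans (statistic-difference ρ π) (proj₁ (IsGeneralMetric.sym (FiniteMetricSpace.isMetric (S n)) ρ π))))

-- Subgaussian constants of metric spaces

opaque
  unfolding avg

  -- Once `avg` unfolds to the expectation `𝔼`, the two notions agree by definition.
  IsSubgaussian⇒Subgaussian : ∀ Ω X {s} → IsSubgaussian Ω X s →
    Subgaussian {{FiniteMetricSpace.nonempty Ω}} (λ i → X (FiniteMetricSpace.point Ω i)) s
  IsSubgaussian⇒Subgaussian Ω X h = h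

  Subgaussian⇒IsSubgaussian : ∀ Ω X {s} →
    Subgaussian {{FiniteMetricSpace.nonempty Ω}} (λ i → X (FiniteMetricSpace.point Ω i)) s → IsSubgaussian Ω X s
  Subgaussian⇒IsSubgaussian Ω X h = h

module _ where
  open ≤ᴿ-Reasoning
  open ℝ-Solver

  lipschitz⇒≤ : ∀ Ω X → IsLipschitz Ω X → ∀ u v → X u ≤ᴿ X v +ᴿ FiniteMetricSpace.d Ω u v
  lipschitz⇒≤ Ω X lip u v = shifted (X u) (X v) (FiniteMetricSpace.d Ω u v) (lip u v)
    where
    shifted : ∀ x y d → ∣ x -ᴿ y ∣ᴿ ≤ᴿ d → x ≤ᴿ y +ᴿ d
    shifted x y d h = begin
      x                       ≃⟨ solve 2 (λ x y → x := y :+ (x :- y)) ≃-refl x y ⟩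
      y +ᴿ (x -ᴿ y)           ≤⟨ +ᴿ-mono-≤ ≤ᴿ-refl (≤ᴿ-trans (pointwise⇒≤ᴿ λ n → p≤∣p∣ (seq x n - seq y n)) h) ⟩
      y +ᴿ d                  ∎

  zero-lipschitz : ∀ Ω → IsLipschitz Ω (λ _ → 0ᴿ)
  zero-lipschitz Ω u v = ≤ᴿ-trans (pointwise⇒≤ᴿ λ _ → ℚ.≤-refl {0ℚ})
    (IsGeneralMetric.nonNegative (FiniteMetricSpace.isMetric Ω) {u} {v})

  <ᴿ-≤ᴿ-fromℚ : ∀ {p q x} → p ℚ.< q → fromℚ q ≤ᴿ x → fromℚ p <ᴿ x
  <ᴿ-≤ᴿ-fromℚ {p} {q} {x} p<q q≤x =
    let N , h = within q≤x (halfPos 0<q-p)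
    in mk<ᴿ (halfPos 0<q-p) (N , λ {n} N≤n → subst₂ ℚ._≤_
      (solveℚ 2 (λ p q → q :+ℚ negℚ (conℚ ½ :*ℚ (q :+ℚ negℚ p)) :=ℚ p :+ℚ conℚ ½ :*ℚ (q :+ℚ negℚ p)) refl p q)
      (solveℚ 2 (λ x d → x :+ℚ d :+ℚ negℚ d :=ℚ x) refl (seq x n) (½ * (q - p)))
      (ℚ.+-monoˡ-≤ (- (½ * (q - p))) (h N≤n)))
    where
    open +-*-Solver using () renaming (solve to solveℚ; _:+_ to _:+ℚ_; :-_ to negℚ; con to conℚ; _:*_ to _:*ℚ_; _:=_ to _:=ℚ_)
    0<q-p : 0ℚ ℚ.< q - p
    0<q-p = subst (ℚ._< q - p) (ℚ.+-inverseʳ p) (ℚ.+-monoˡ-< (- p) p<q)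

  ≤ᴿ-<ᴿ-fromℚ : ∀ {p q x} → x ≤ᴿ fromℚ p → p ℚ.< q → x <ᴿ fromℚ q
  ≤ᴿ-<ᴿ-fromℚ {p} {q} {x} x≤p p<q =
    let N , h = within x≤p (halfPos 0<q-p)
    in mk<ᴿ (halfPos 0<q-p) (N , λ {n} N≤n → ℚ.≤-trans (ℚ.+-monoˡ-≤ (½ * (q - p)) (h N≤n))
      (ℚ.≤-reflexive (solveℚ 2 (λ p q → p :+ℚ conℚ ½ :*ℚ (q :+ℚ negℚ p) :+ℚ conℚ ½ :*ℚ (q :+ℚ negℚ p) :=ℚ q) refl p q)))
    where
    open +-*-Solver using () renaming (solve to solveℚ; _:+_ to _:+ℚ_; :-_ to negℚ; con to conℚ; _:*_ to _:*ℚ_; _:=_ to _:=ℚ_)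
    0<q-p : 0ℚ ℚ.< q - p
    0<q-p = subst (ℚ._< q - p) (ℚ.+-inverseʳ p) (ℚ.+-monoˡ-< (- p) p<q)

-- One-sided Lipschitz functions suffice, since graph distances are symmetric.
GraphBound : FiniteConnectedGraph → ℚ → Set
GraphBound G c = (X : Vertex → ℝ) → (∀ u v → X u ≤ᴿ X v +ᴿ fromℕ (dist u v)) →
  Subgaussian {{nonempty}} (λ i → X (Inverse.to enumeration i)) (fromℚ c)
  where open FiniteConnectedGraph G

-- Constants of complete graphs, of their products and of permutations.

module SubgaussianConstants (em : ExcludedMiddle 0ℓ) where
  open Classical em
  open Completeness em
  open SubgaussianBounds em
  open Hoeffding em
  open ThreePoints em
  open Products em
  open ≤ᴿ-Reasoning
  open ℝ-Solver

  module _ (Ω : FiniteMetricSpace) where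
    open FiniteMetricSpace Ω

    proxy-exists : ∀ X {b} → Subgaussian {{nonempty}} (λ i → X (point i)) b → ∃ (IsVarianceProxy Ω X)
    proxy-exists X sg = convert (optimal-exists {{nonempty}} (λ i → X (point i)) (_ , sg))
      where
      convert : ∃ (IsLeast (Subgaussian {{nonempty}} (λ i → X (point i)))) → ∃ (IsVarianceProxy Ω X)
      convert (s , p , least) = s , Subgaussian⇒IsSubgaussian Ω X p , λ y h → least y (IsSubgaussian⇒Subgaussian Ω X h)

    module _ {b} (bound : ∀ X → IsLipschitz Ω X → Subgaussian {{nonempty}} (λ i → X (point i)) b) where
      proxy≤bound : ∀ s → (∃ λ X → IsLipschitz Ω X × IsVarianceProxy Ω X s) → s ≤ᴿ b
      proxy≤bound s (X , lip , _ , least) = least b (Subgaussian⇒IsSubgaussian Ω X (bound X lip))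

      constant-exists : ∃ (IsSubgaussianConstant Ω)
      -- The zero function is Lipschitz, so the set whose supremum is taken is inhabited.
      constant-exists = supremum-exists {λ s → ∃ λ X → IsLipschitz Ω X × IsVarianceProxy Ω X s} (attained (proxy-exists (λ _ → 0ᴿ) (bound (λ _ → 0ᴿ) (zero-lipschitz Ω)))) b proxy≤bound
        where
        attained : ∃ (IsVarianceProxy Ω (λ _ → 0ᴿ)) → ∃ λ s → ∃ λ X → IsLipschitz Ω X × IsVarianceProxy Ω X s
        attained (s , p) = s , (λ _ → 0ᴿ) , zero-lipschitz Ω , p

      constant≤bound : ∀ {σ²} → IsSubgaussianConstant Ω σ² → σ² ≤ᴿ b
      constant≤bound (_ , least) = least b proxy≤bound

      variance≤constant : ∀ {σ²} → IsSubgaussianConstant Ω σ² → ∀ X → IsLipschitz Ω X → variance {{nonempty}} (λ i → X (point i)) ≤ᴿ σ²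
      variance≤constant (upper , _) X lip = through (proxy-exists X (bound X lip))
        where
        through : ∃ (IsVarianceProxy Ω X) → variance {{nonempty}} (λ i → X (point i)) ≤ᴿ _
        through (s , p) = ≤ᴿ-trans (variance≤ {{nonempty}} (λ i → X (point i)) (IsSubgaussian⇒Subgaussian Ω X (proj₁ p))) (upper s (X , lip , p))

  dist-K≤1 : ∀ m {{_ : ℕ.NonZero m}} u v → FiniteConnectedGraph.dist (K m) u v ≤ 1
  dist-K≤1 m u v with u Fin.≟ v
  ... | yes _ = ℕ.z≤n
  ... | no  _ = ℕ.s≤s ℕ.z≤n

  K-hasRange : ∀ m {{_ : ℕ.NonZero m}} (X : Fin m → ℝ) → (∀ u v → X u ≤ᴿ X v +ᴿ fromℕ (FiniteConnectedGraph.dist (K m) u v)) → HasRange X 1ᴿ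
  K-hasRange m X lip u v = ≤ᴿ-trans (lip u v) (+ᴿ-mono-≤ ≤ᴿ-refl (fromℕ-mono (dist-K≤1 m u v)))

  K-bound : ∀ m {{_ : ℕ.NonZero m}} → GraphBound (K m) (+ 1 / 4)
  K-bound m X lip = hoeffding X (K-hasRange m X lip)

  K₃-bound : GraphBound (K 3) σ₃
  K₃-bound X lip = three-points X (K-hasRange 3 X lip)

  module _ (G H : FiniteConnectedGraph) where
    private
      module G = FiniteConnectedGraph G
      module H = FiniteConnectedGraph H

    -- Averaging over a fibre gives a Lipschitz function on G, since moving the first coordinate
    -- alone costs only `G.dist`; the restriction to a fibre is Lipschitz on H for the same reason.
    □-bound : ∀ {a b} → 0ℚ ℚ.≤ b → GraphBound G a → GraphBound H b → GraphBound (G □ H) (a + b)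
    □-bound {a} {b} 0≤b boundG boundH X lip = Subgaussian-mono {{FiniteConnectedGraph.nonempty (G □ H)}} _ (pointwise⇒≤ᴿ λ _ → ℚ.≤-refl)
      (Subgaussian-× {{G.nonempty}} {{H.nonempty}} {{FiniteConnectedGraph.nonempty (G □ H)}} (λ p → X (Inverse.to G.enumeration (proj₁ p) , Inverse.to H.enumeration (proj₂ p)))
        (boundG (λ u → avg {{H.nonempty}} (λ j → X (u , Inverse.to H.enumeration j))) average-lip)
        (λ i → boundH (λ v → X (Inverse.to G.enumeration i , v)) (fibre-lip (Inverse.to G.enumeration i)))
        (fromℚ-mono 0≤b))
      where
      G-dist-refl : ∀ u → G.dist u u ≤ 0
      G-dist-refl u = G.minimal []
      H-dist-refl : ∀ v → H.dist v v ≤ 0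
      H-dist-refl v = H.minimal []

      fibre-lip : ∀ u v w → X (u , v) ≤ᴿ X (u , w) +ᴿ fromℕ (H.dist v w)
      fibre-lip u v w = ≤ᴿ-trans (lip (u , v) (u , w)) (+ᴿ-mono-≤ ≤ᴿ-refl (fromℕ-mono (ℕ.+-monoˡ-≤ (H.dist v w) (G-dist-refl u))))

      average-lip : ∀ u v → avg {{H.nonempty}} (λ j → X (u , Inverse.to H.enumeration j)) ≤ᴿ avg {{H.nonempty}} (λ j → X (v , Inverse.to H.enumeration j)) +ᴿ fromℕ (G.dist u v)
      average-lip u v = ≤ᴿ-trans (avg-mono {{H.nonempty}} (λ j → ≤ᴿ-trans (lip (u , Inverse.to H.enumeration j) (v , Inverse.to H.enumeration j))
          (+ᴿ-mono-≤ ≤ᴿ-refl (fromℕ-mono (ℕ.≤-trans (ℕ.+-monoʳ-≤ (G.dist u v) (H-dist-refl (Inverse.to H.enumeration j))) (ℕ.≤-reflexive (ℕ.+-identityʳ (G.dist u v))))))))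
        (proj₁ (≃-trans (avg-+ {{H.nonempty}} (λ j → X (v , Inverse.to H.enumeration j)) (λ _ → fromℕ (G.dist u v))) (+ᴿ-cong ≃-refl (avg-const {{H.nonempty}} (fromℕ (G.dist u v))))))

  -- `σ₃` for `K 3` and 1/4 for every other factor of `J (3 ℕ.+ k)`.
  jBound : ℕ → ℚ
  jBound zero    = σ₃ + + 1 / 4
  jBound (suc k) = + 1 / 4 + jBound k

  jBound-nonNeg : ∀ k → 0ℚ ℚ.≤ jBound k
  jBound-nonNeg zero    = from-yes (0ℚ ℚ.≤? σ₃ + + 1 / 4)
  jBound-nonNeg (suc k) = +-nonNeg (recip≥0 3) (jBound-nonNeg k)

  -- Both sides grow by 1/4 with k, so the gap stays at the 1/4 - `σ₃` of the base case, which is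
  -- decided by evaluation.
  jBound+¼<n/4 : ∀ k → jBound k + + 1 / 4 ℚ.< + 1 / 4 * fromℕℚ (3 ℕ.+ k)
  jBound+¼<n/4 zero    = from-yes (σ₃ + + 1 / 4 + + 1 / 4 ℚ.<? + 1 / 4 * fromℕℚ 3)
  jBound+¼<n/4 (suc k) = subst₂ ℚ._<_ (sym (ℚ.+-assoc (+ 1 / 4) (jBound k) (+ 1 / 4)))
    (trans (solveℚ 1 (λ n → conℚ (+ 1 / 4) :+ℚ conℚ (+ 1 / 4) :*ℚ n :=ℚ conℚ (+ 1 / 4) :*ℚ (conℚ 1ℚ :+ℚ n)) refl (fromℕℚ (3 ℕ.+ k)))
      (cong (λ z → + 1 / 4 * z) (sym (fromℕℚ-+ 1 (3 ℕ.+ k)))))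
    (ℚ.+-monoʳ-< (+ 1 / 4) (jBound+¼<n/4 k))
    where open +-*-Solver using () renaming (solve to solveℚ; _:+_ to _:+ℚ_; con to conℚ; _:*_ to _:*ℚ_; _:=_ to _:=ℚ_)

  J-bound : ∀ k → GraphBound (J (3 ℕ.+ k)) (jBound k)
  J-bound zero    = □-bound (K 3) (K 2) (recip≥0 3) K₃-bound (K-bound 2)
  J-bound (suc k) = □-bound (K (4 ℕ.+ k)) (J (3 ℕ.+ k)) (jBound-nonNeg k) (K-bound (4 ℕ.+ k)) (J-bound k)

  hamming≤n : ∀ n (π ρ : Permutation′ n) → hamming π ρ ≤ n
  hamming≤n n π ρ = ℕ.≤-trans (length-filter (λ i → ¬? (π ⟨$⟩ʳ i Fin.≟ ρ ⟨$⟩ʳ i)) (allFin n)) (ℕ.≤-reflexive (length-tabulate {n = n} id))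

  -- This crude bound guarantees that the variance proxies and their supremum exist; the estimate
  -- for `S n` itself comes from the variance.
  S-bound : ∀ n X → IsLipschitz (S n) X → Subgaussian {{n !≢0}} (λ i → X (nthPermutation n i)) (fromℕ 4 *ᴿ (fromℕ n *ᴿ fromℕ n))
  S-bound n X lip = Subgaussian-of-range {{n !≢0}} (λ i → X (nthPermutation n i))
    (λ i j → ≤ᴿ-trans (lipschitz⇒≤ (S n) X lip (nthPermutation n i) (nthPermutation n j))
      (+ᴿ-mono-≤ ≤ᴿ-refl (fromℕ-mono (hamming≤n n (nthPermutation n i) (nthPermutation n j)))))

  J-space-bound : ∀ k X → IsLipschitz (graphMetricSpace (J (3 ℕ.+ k))) X →
    Subgaussian {{FiniteConnectedGraph.nonempty (J (3 ℕ.+ k))}} (λ i → X (Inverse.to (FiniteConnectedGraph.enumeration (J (3 ℕ.+ k))) i)) (fromℚ (jBound k))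
  J-space-bound k X lip = J-bound k X (lipschitz⇒≤ (graphMetricSpace (J (3 ℕ.+ k))) X lip)

  n/4<constant : ∀ n → 2 ≤ n → ∀ {σ²} → IsSubgaussianConstant (S n) σ² → fromℚ (+ n / 4) <ᴿ σ²
  n/4<constant n 2≤n isConstant =
    let v , n/4<v , e = statistic-variance>n/4 2≤n
    in <ᴿ-≤ᴿ-fromℚ n/4<v (≤ᴿ-trans (proj₂ e) (variance≤constant (S n) (S-bound n) isConstant statistic (statistic-lipschitz n)))

  constant+¼<n/4 : ∀ k {σ²} → IsSubgaussianConstant (graphMetricSpace (J (3 ℕ.+ k))) σ² → σ² +ᴿ fromℚ (+ 1 / 4) <ᴿ fromℚ (+ (3 ℕ.+ k) / 4)
  constant+¼<n/4 k isConstant = ≤ᴿ-<ᴿ-fromℚ {jBound k + + 1 / 4}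
    (≤ᴿ-trans (+ᴿ-mono-≤ (constant≤bound (graphMetricSpace (J (3 ℕ.+ k))) (J-space-bound k) isConstant) ≤ᴿ-refl) (pointwise⇒≤ᴿ λ _ → ℚ.≤-refl))
    (subst (jBound k + + 1 / 4 ℚ.<_) (sym (fromℕℚ-/4 (3 ℕ.+ k))) (jBound+¼<n/4 k))

theorem2p4 : ExcludedMiddle 0ℓ → (n : ℕ) → 3 ≤ n →
    ∃ λ σ²S → ∃ λ σ²J →
    IsSubgaussianConstant (S n) σ²S ×
    IsSubgaussianConstant (graphMetricSpace (J n)) σ²J ×
    (fromℚ (+ n / 4) <ᴿ σ²S) ×
    (σ²J +ᴿ fromℚ (+ 1 / 4) <ᴿ fromℚ (+ n / 4))
theorem2p4 em (suc (suc (suc k))) (ℕ.s≤s (ℕ.s≤s (ℕ.s≤s _))) =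
  let σ²S , isS = constant-exists (S n) (S-bound n)
      σ²J , isJ = constant-exists (graphMetricSpace (J n)) (J-space-bound k)
  in σ²S , σ²J , isS , isJ , n/4<constant n (ℕ.s≤s (ℕ.s≤s ℕ.z≤n)) isS , constant+¼<n/4 k isJ
  where
  open SubgaussianConstants em
  n = 3 ℕ.+ k
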